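{- Let $R$ be a field, let $(\mathcal G,\Gamma)$ be a Hecke pair with $\Gamma$ finitely generated, let $\mathcal P\subset\mathcal G$ be a conjugation-invariant subset, let $V$ be an $R[\mathcal G]$-module and let $q\ge 1$ be an integer. Then there is a natural injection of smooth $\mathcal G$-modules $$L_q(\mathcal P,V)\ \hookrightarrow\ \widehat{\mathrm{Hom}}_{\mathcal P}^{\otimes (q-1)}\otimes V^\infty ,$$ where the tensor products are over $R$.
   Context: A Hecke pair $(\mathcal G,\Gamma)$ is a group $\mathcal G$ with a subgroup $\Gamma$ such that $\Gamma g\Gamma/\Gamma$ is finite for every $g\in\mathcal G$. A congruence subgroup of $\Gamma$ is a subgroup of $\Gamma$ containing a group of the form $\Gamma\cap g_1\Gamma g_1^{ -1}\cap\dots\cap g_n\Gamma g_n^{ -1}$ with $g_1,\dots,g_n\in\mathcal G$. $\mathcal G$ is made a topological group with the congruence subgroups as a unit neighborhood base. An element of an $R[\mathcal G]$-module is smooth if it is fixed by some congruence subgroup; $V^\infty$ is the submodule of smooth elements of $V$, and a module is smooth if all its elements are smooth. For a group $\Sigma$, a conjugation-invariant subset $P\subset \Sigma$, an $R[\Sigma]$-module $V$ and $q\in\mathbb N$, let $\mathrm H^0_q(\Sigma,P,V)$ be the set of all $v\in V$ with $I^q v=0$ and $pv=v$ for every $p\in P$, where $I$ is the augmentation ideal of $R[\Sigma]$; set $\mathrm H^0_0(\Sigma,P,V)=0$ and $$\overline{\mathrm H}_q(\Sigma,P,V)=\mathrm H^0_q(\Sigma,P,V)/\mathrm H^0_{q-1}(\Sigma,P,V).$$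 For a subgroup $\Sigma\subset\Gamma$ write $\overline{\mathrm H}_q(\Sigma,\mathcal P,V)$ for $\overline{\mathrm H}_q(\Sigma,\mathcal P\cap\Sigma,V)$. Put $$L_q(\mathcal P,V)=\varinjlim_\Sigma \overline{\mathrm H}_q(\Sigma,\mathcal P,V),$$ the direct limit over all congruence subgroups $\Sigma$ of $\Gamma$ with respect to the restriction maps. The element $g\in\mathcal G$ acts on $L_q(\mathcal P,V)$ through the maps $\overline{\mathrm H}_q(\Sigma,\mathcal P,V)\to\overline{\mathrm H}_q(g\Sigma g^{ -1},\mathcal P,V)\to\overline{\mathrm H}_q(\Sigma\cap g\Sigma g^{ -1},\mathcal P,V)$, the first being $v\mapsto gv$ and the second restriction; this makes $L_q(\mathcal P,V)$ a smooth module. $\mathrm{Hom}_{\mathcal P}(\Sigma,R)$ is the set of group homomorphisms $\Sigma\to (R,+)$ vanishing on $\Sigma\cap\mathcal P$, and $\widehat{\mathrm{Hom}}_{\mathcal P}=\varinjlim_\Sigma\mathrm{Hom}_{\mathcal P}(\Sigma,R)$, the limit over all congruence subgroups with respect to restriction. It is a smooth $\mathcal G$-module through the maps $\mathrm{Hom}_{\mathcal P}(\Sigma,R)\to\mathrm{Hom}_{\mathcal P}(g\Sigma g^{ -1},R)\to\mathrm{Hom}_{\mathcal P}(\Sigma\cap g\Sigma g^{ -1},R)$ given by conjugation and restriction. The injection is the one induced by iterating the order-lowering maps $\overline{\mathrm H}_q(\Sigma,\mathcal P,V)\to\mathrm{Hom}_{\mathcal P}(\Sigma,\overline{\mathrm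 H}_{q-1}(\Sigma,\mathcal P,V))\cong\mathrm{Hom}_{\mathcal P}(\Sigma,R)\otimes\overline{\mathrm H}_{q-1}(\Sigma,\mathcal P,V)$, $v\mapsto(\gamma\mapsto(\gamma-1)v)$. -}

module Defs where

open import Level using (_⊔_) renaming (suc to lsuc)
open import Algebra.Bundles using (Group; CommutativeRing)
open import Algebra.Core using (Op₁; Op₂)
open import Algebra.Module.Bundles using (LeftModule)
open import Algebra.Module.Core using (Opₗ)
open import Algebra.Module.Structures using (IsLeftSemimodule; IsLeftModule)
open import Algebra.Morphism.Structures using (module GroupMorphisms)
open import Algebra.Module.Morphism.Structures using (module LeftModuleMorphisms)
import Algebra.Module.Construct.TensorUnit as TensorUnit
import Algebra.Module.Morphism.Construct.Composition as Composition
import Algebra.Properties.AbelianGroup as AbelianGroupProperties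
import Algebra.Properties.Group as GroupProperties
open import Data.Fin.Base using (Fin)
open import Data.List.Base using (List; []; _∷_; _++_; map)
open import Data.List.Relation.Unary.All using (All; []; _∷_)
import Data.List.Relation.Unary.All as All
import Data.List.Relation.Unary.All.Properties as All
open import Data.Nat.Base using (ℕ; zero; suc; pred)
open import Data.Product.Base using (Σ; ∃₂; Σ-syntax; ∃-syntax; _×_; _,_; proj₁; proj₂)
open import Function.Base using (id; _∘_)
open import Function.Bundles using (Inverse)
open import Function.Definitions using (Injective; Bijective)
open import Relation.Binary.Bundles using (Setoid)
open import Relation.Binary.Core using (Rel)
open import Relation.Binary.Definitions using (_Respects_)
import Relation.Binary.PropositionalEquality.Properties as ≡
import Relation.Binary.Reasoning.Setoid as SetoidReasoning
open import Relation.Nullary.Negation.Core using (¬_)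
open import Relation.Unary using (Pred)

record Field a : Set (lsuc a) where
  field
    commutativeRing : CommutativeRing a a
  open CommutativeRing commutativeRing public
  field
    1≉0     : ¬ 1# ≈ 0#
    inverse : ∀ x → ¬ x ≈ 0# → ∃[ y ] x * y ≈ 1#

module _ {a b c d} (G : Group a b) (H : Group c d) where
  private
    module G = Group G
    module H = Group H
  open GroupMorphisms G.rawGroup H.rawGroup

  -- Proofs of laws are opaque here and below, so that comparing two structures
  -- never compares the normal forms of those proofs.
  opaque
    mkGroupHomomorphism : (f : G.Carrier → H.Carrier) →
                          (∀ {x y} → x G.≈ y → f x H.≈ f y) →
                          (∀ x y → f (x G.∙ y) H.≈ f x H.∙ f y) →
                          IsGroupHomomorphism f
    mkGroupHomomorphism f f-cong f-∙ = record
      { isMonoidHomomorphism = record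
        { isMagmaHomomorphism = record
          { isRelHomomorphism = record { cong = f-cong }
          ; homo = f-∙ }
        ; ε-homo = f-ε }
      ; ⁻¹-homo = λ x → HP.inverseˡ-unique _ _
          (H.trans (H.sym (f-∙ _ _)) (H.trans (f-cong (G.inverseˡ x)) f-ε)) }
      where
      module HP = GroupProperties H
      f-ε : f G.ε H.≈ H.ε
      f-ε = HP.identityˡ-unique _ (f G.ε)
              (H.trans (H.sym (f-∙ _ _)) (f-cong (G.identityˡ G.ε)))

module Modules {r} (R : CommutativeRing r r) where
  private
    module R = CommutativeRing R

  Mod : ∀ m ℓ → Set (r ⊔ lsuc (m ⊔ ℓ))
  Mod m ℓ = LeftModule R.ring m ℓ

  ⟨R⟩ : Mod r r
  ⟨R⟩ = TensorUnit.leftModule {R = R.ring}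

  isModule : ∀ {m ℓ} {M : Set m} {≈ : Rel M ℓ} {+ : Op₂ M} {0# : M} {* : Opₗ R.Carrier M} →
             IsLeftSemimodule R.semiring ≈ + 0# * →
             IsLeftModule R.ring ≈ + 0# (* (R.- R.1#)) *
  isModule M = record
    { isLeftSemimodule = M
    ; -ᴹ‿cong = *ₗ-cong R.refl
    ; -ᴹ‿inverse = (λ x → ≈ᴹ-trans (+ᴹ-cong ≈ᴹ-refl (≈ᴹ-sym (*ₗ-identityˡ x)))
                            (≈ᴹ-trans (≈ᴹ-sym (*ₗ-distribʳ x _ _))
                            (≈ᴹ-trans (*ₗ-cong (R.-‿inverseˡ _) ≈ᴹ-refl) (*ₗ-zeroˡ x))))
                 , (λ x → ≈ᴹ-trans (+ᴹ-cong (≈ᴹ-sym (*ₗ-identityˡ x)) ≈ᴹ-refl)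
                            (≈ᴹ-trans (≈ᴹ-sym (*ₗ-distribʳ x _ _))
                            (≈ᴹ-trans (*ₗ-cong (R.-‿inverseʳ _) ≈ᴹ-refl) (*ₗ-zeroˡ x)))) }
    where open IsLeftSemimodule M

  neg≈ : ∀ {m ℓ} (M : Mod m ℓ) → let open LeftModule M in
         ∀ x → (R.- R.1#) *ₗ x ≈ᴹ -ᴹ x
  neg≈ M x = inverseˡ-unique _ _
      (≈ᴹ-trans (+ᴹ-cong ≈ᴹ-refl (≈ᴹ-sym (*ₗ-identityˡ x)))
      (≈ᴹ-trans (≈ᴹ-sym (*ₗ-distribʳ x _ _))
      (≈ᴹ-trans (*ₗ-cong (R.-‿inverseˡ _) ≈ᴹ-refl) (*ₗ-zeroˡ x))))
    where
    open LeftModule M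
    open AbelianGroupProperties +ᴹ-abelianGroup

  interchange : ∀ {m ℓ} (M : Mod m ℓ) → let open LeftModule M in
                ∀ w x y z → (w +ᴹ x) +ᴹ (y +ᴹ z) ≈ᴹ (w +ᴹ y) +ᴹ (x +ᴹ z)
  interchange M w x y z = begin
    (w +ᴹ x) +ᴹ (y +ᴹ z) ≈⟨ +ᴹ-assoc w x _ ⟩
    w +ᴹ (x +ᴹ (y +ᴹ z)) ≈⟨ +ᴹ-cong ≈ᴹ-refl (+ᴹ-assoc x y z) ⟨
    w +ᴹ ((x +ᴹ y) +ᴹ z) ≈⟨ +ᴹ-cong ≈ᴹ-refl (+ᴹ-cong (+ᴹ-comm x y) ≈ᴹ-refl) ⟩
    w +ᴹ ((y +ᴹ x) +ᴹ z) ≈⟨ +ᴹ-cong ≈ᴹ-refl (+ᴹ-assoc y x z) ⟩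
    w +ᴹ (y +ᴹ (x +ᴹ z)) ≈⟨ +ᴹ-assoc w y _ ⟨
    (w +ᴹ y) +ᴹ (x +ᴹ z) ∎
    where
    open LeftModule M
    open SetoidReasoning ≈ᴹ-setoid

  *ₗ-comm : ∀ {m ℓ} (M : Mod m ℓ) → let open LeftModule M in
            ∀ s t x → s *ₗ t *ₗ x ≈ᴹ t *ₗ s *ₗ x
  *ₗ-comm M s t x = ≈ᴹ-trans (≈ᴹ-sym (*ₗ-assoc s t x))
    (≈ᴹ-trans (*ₗ-cong (R.*-comm s t) ≈ᴹ-refl) (*ₗ-assoc t s x))
    where open LeftModule M

  infixr 4 _⟶_
  record _⟶_ {m ℓ m′ ℓ′} (M : Mod m ℓ) (N : Mod m′ ℓ′)
             : Set (r ⊔ m ⊔ ℓ ⊔ m′ ⊔ ℓ′) where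
    private
      module M = LeftModule M
      module N = LeftModule N
    open LeftModuleMorphisms M.rawLeftModule N.rawLeftModule
    field
      to                       : M.Carrierᴹ → N.Carrierᴹ
      isLeftModuleHomomorphism : IsLeftModuleHomomorphism to
    open IsLeftModuleHomomorphism isLeftModuleHomomorphism public

  module _ {m ℓ m′ ℓ′} {M : Mod m ℓ} {N : Mod m′ ℓ′} where
    private
      module M = LeftModule M
      module N = LeftModule N

    linear : (f : M.Carrierᴹ → N.Carrierᴹ) →
             (∀ {x y} → x M.≈ᴹ y → f x N.≈ᴹ f y) →
             (∀ x y → f (x M.+ᴹ y) N.≈ᴹ f x N.+ᴹ f y) →
             (∀ s x → f (s M.*ₗ x) N.≈ᴹ s N.*ₗ f x) →
             M ⟶ N
    linear f f-cong f-+ f-* = record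
      { to = f
      ; isLeftModuleHomomorphism = record
        { +ᴹ-isGroupHomomorphism = mkGroupHomomorphism M.+ᴹ-group N.+ᴹ-group f f-cong f-+
        ; *ₗ-homo = f-* } }

    sub-homo : (f : M ⟶ N) → let open _⟶_ f in
               ∀ x y → to (x M.+ᴹ M.-ᴹ y) N.≈ᴹ to x N.+ᴹ N.-ᴹ to y
    sub-homo f x y = N.≈ᴹ-trans (+ᴹ-homo _ _) (N.+ᴹ-cong N.≈ᴹ-refl (-ᴹ-homo y))
      where open _⟶_ f

  idₗ : ∀ {m ℓ} {M : Mod m ℓ} → M ⟶ M
  idₗ {M = M} = linear id id (λ _ _ → ≈ᴹ-refl) (λ _ _ → ≈ᴹ-refl)
    where open LeftModule M

  infixr 9 _∘ₗ_
  _∘ₗ_ : ∀ {m₁ ℓ₁ m₂ ℓ₂ m₃ ℓ₃} {M : Mod m₁ ℓ₁} {N : Mod m₂ ℓ₂} {O : Mod m₃ ℓ₃} →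
         N ⟶ O → M ⟶ N → M ⟶ O
  _∘ₗ_ {O = O} g f = record
    { to = _⟶_.to g ∘ _⟶_.to f
    ; isLeftModuleHomomorphism = Composition.isLeftModuleHomomorphism
        (LeftModule.≈ᴹ-trans O)
        (_⟶_.isLeftModuleHomomorphism f) (_⟶_.isLeftModuleHomomorphism g) }

  record Submodule {m ℓ} (M : Mod m ℓ) p : Set (r ⊔ m ⊔ ℓ ⊔ lsuc p) where
    open LeftModule M
    field
      mem       : Pred Carrierᴹ p
      resp      : mem Respects _≈ᴹ_
      0-closed  : mem 0ᴹ
      +-closed  : ∀ {x y} → mem x → mem y → mem (x +ᴹ y)
      *-closed  : ∀ s {x} → mem x → mem (s *ₗ x)

    neg-closed : ∀ {x} → mem x → mem (-ᴹ x)
    neg-closed {x} x∈ = resp (neg≈ M x) (*-closed (R.- R.1#) x∈)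

  module _ {m ℓ p} {M : Mod m ℓ} (S : Submodule M p) where
    open LeftModule M
    open Submodule S

    -- Stated at a level that lets carrier and equality of a submodule agree.
    infix 4 _≈ˢ_
    record _≈ˢ_ (x y : Σ Carrierᴹ mem) : Set (ℓ ⊔ p) where
      constructor lift
      field lower : proj₁ x ≈ᴹ proj₁ y

    infixl 6 _+ˢ_
    _+ˢ_ : Op₂ (Σ Carrierᴹ mem)
    (x , x∈) +ˢ (y , y∈) = x +ᴹ y , +-closed x∈ y∈

    infixr 7 _·ˢ_
    _·ˢ_ : Opₗ R.Carrier (Σ Carrierᴹ mem)
    s ·ˢ (x , x∈) = s *ₗ x , *-closed s x∈

    0ˢ : Σ Carrierᴹ mem
    0ˢ = 0ᴹ , 0-closed

    -ˢ_ : Op₁ (Σ Carrierᴹ mem)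
    -ˢ (x , x∈) = -ᴹ x , neg-closed x∈

    opaque
      submodule-laws : IsLeftModule R.ring _≈ˢ_ _+ˢ_ 0ˢ -ˢ_ _·ˢ_
      submodule-laws = record
          { isLeftSemimodule = record
            { +ᴹ-isCommutativeMonoid = record
              { isMonoid = record
                { isSemigroup = record
                  { isMagma = record
                    { isEquivalence = record
                      { refl = lift ≈ᴹ-refl
                      ; sym = λ (lift e) → lift (≈ᴹ-sym e)
                      ; trans = λ (lift e) (lift f) → lift (≈ᴹ-trans e f) }
                    ; ∙-cong = λ (lift e) (lift f) → lift (+ᴹ-cong e f) }
                  ; assoc = λ x y z → lift (+ᴹ-assoc _ _ _) }
                ; identity = (λ x → lift (+ᴹ-identityˡ _)) , (λ x → lift (+ᴹ-identityʳ _)) }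
              ; comm = λ x y → lift (+ᴹ-comm _ _) }
            ; isPreleftSemimodule = record
              { *ₗ-cong = λ e (lift f) → lift (*ₗ-cong e f)
              ; *ₗ-zeroˡ = λ x → lift (*ₗ-zeroˡ _)
              ; *ₗ-distribʳ = λ x s t → lift (*ₗ-distribʳ _ _ _)
              ; *ₗ-identityˡ = λ x → lift (*ₗ-identityˡ _)
              ; *ₗ-assoc = λ s t x → lift (*ₗ-assoc _ _ _)
              ; *ₗ-zeroʳ = λ s → lift (*ₗ-zeroʳ _)
              ; *ₗ-distribˡ = λ s x y → lift (*ₗ-distribˡ _ _ _) } }
          ; -ᴹ‿cong = λ (lift e) → lift (-ᴹ‿cong e)
          ; -ᴹ‿inverse = (λ x → lift (-ᴹ‿inverseˡ _)) , (λ x → lift (-ᴹ‿inverseʳ _)) }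

    submodule : Mod (m ⊔ p) (ℓ ⊔ p)
    submodule = record { isLeftModule = submodule-laws }

    private
      open AbelianGroupProperties +ᴹ-abelianGroup

      telescope : ∀ x y z → (x +ᴹ -ᴹ y) +ᴹ (y +ᴹ -ᴹ z) ≈ᴹ x +ᴹ -ᴹ z
      telescope x y z = ≈ᴹ-trans (+ᴹ-assoc x _ _)
        (+ᴹ-cong ≈ᴹ-refl (≈ᴹ-trans (≈ᴹ-sym (+ᴹ-assoc _ y _))
          (≈ᴹ-trans (+ᴹ-cong (-ᴹ‿inverseˡ y) ≈ᴹ-refl) (+ᴹ-identityˡ _))))

      *ₗ-neg : ∀ s y → s *ₗ (-ᴹ y) ≈ᴹ -ᴹ (s *ₗ y)
      *ₗ-neg s y = inverseˡ-unique _ _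
        (≈ᴹ-trans (≈ᴹ-sym (*ₗ-distribˡ s _ y))
          (≈ᴹ-trans (*ₗ-cong R.refl (-ᴹ‿inverseˡ y)) (*ₗ-zeroʳ s)))

    infix 4 _≈/_
    record _≈/_ (x y : Carrierᴹ) : Set p where
      constructor modulo
      field difference : mem (x +ᴹ -ᴹ y)

    mod-≈ : ∀ {x y} → x ≈ᴹ y → x ≈/ y
    mod-≈ e = modulo (resp (≈ᴹ-sym (x≈y⇒x∙y⁻¹≈ε e)) 0-closed)

    opaque
      quotient-laws : IsLeftModule R.ring _≈/_ _+ᴹ_ 0ᴹ -ᴹ_ _*ₗ_
      quotient-laws = record
          { isLeftSemimodule = record
            { +ᴹ-isCommutativeMonoid = record
              { isMonoid = record
                { isSemigroup = record
                  { isMagma = record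
                    { isEquivalence = record
                      { refl = mod-≈ ≈ᴹ-refl
                      ; sym = λ {x} {y} (modulo e) → modulo (resp (⁻¹-anti-homo‿- x y) (neg-closed e))
                      ; trans = λ {x} {y} {z} (modulo e) (modulo f) →
                          modulo (resp (telescope x y z) (+-closed e f)) }
                    ; ∙-cong = λ {x} {y} {u} {v} (modulo e) (modulo f) → modulo
                        (resp (≈ᴹ-trans (interchange M _ _ _ _) (+ᴹ-cong ≈ᴹ-refl (⁻¹-∙-comm y v)))
                              (+-closed e f)) }
                  ; assoc = λ x y z → mod-≈ (+ᴹ-assoc _ _ _) }
                ; identity = (λ x → mod-≈ (+ᴹ-identityˡ _)) , (λ x → mod-≈ (+ᴹ-identityʳ _)) }
              ; comm = λ x y → mod-≈ (+ᴹ-comm _ _) }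
            ; isPreleftSemimodule = record
              { *ₗ-cong = λ {s} {t} {x} {y} e (modulo f) → modulo
                  (resp (≈ᴹ-trans (*ₗ-distribˡ s x _)
                          (+ᴹ-cong ≈ᴹ-refl
                            (≈ᴹ-trans (*ₗ-neg s y) (-ᴹ‿cong (*ₗ-cong e ≈ᴹ-refl)))))
                        (*-closed s f))
              ; *ₗ-zeroˡ = λ x → mod-≈ (*ₗ-zeroˡ _)
              ; *ₗ-distribʳ = λ x s t → mod-≈ (*ₗ-distribʳ _ _ _)
              ; *ₗ-identityˡ = λ x → mod-≈ (*ₗ-identityˡ _)
              ; *ₗ-assoc = λ s t x → mod-≈ (*ₗ-assoc _ _ _)
              ; *ₗ-zeroʳ = λ s → mod-≈ (*ₗ-zeroʳ _)
              ; *ₗ-distribˡ = λ s x y → mod-≈ (*ₗ-distribˡ _ _ _) } }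
          ; -ᴹ‿cong = λ {x} {y} (modulo e) →
              modulo (resp (≈ᴹ-sym (⁻¹-∙-comm x (-ᴹ y))) (neg-closed e))
          ; -ᴹ‿inverse = (λ x → mod-≈ (-ᴹ‿inverseˡ _)) , (λ x → mod-≈ (-ᴹ‿inverseʳ _)) }

    quotient : Mod m p
    quotient = record { isLeftModule = quotient-laws }

  module Presented {g} (Gen : Set g) where

    data Term : Set (r ⊔ g) where
      0ᵗ   : Term
      _+ᵗ_ : Term → Term → Term
      _·ᵗ_ : R.Carrier → Term → Term
      gen  : Gen → Term

    eval : ∀ {m ℓ} (M : Mod m ℓ) → (Gen → LeftModule.Carrierᴹ M) →
           Term → LeftModule.Carrierᴹ M
    eval M f 0ᵗ       = LeftModule.0ᴹ M
    eval M f (s +ᵗ t) = LeftModule._+ᴹ_ M (eval M f s) (eval M f t)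
    eval M f (x ·ᵗ t) = LeftModule._*ₗ_ M x (eval M f t)
    eval M f (gen i)  = f i

    module _ {ρ} (_~_ : Rel Term ρ) where

      infix 4 _≈ᵗ_
      data _≈ᵗ_ : Rel Term (r ⊔ g ⊔ ρ) where
        relation : ∀ {s t} → s ~ t → s ≈ᵗ t
        refl     : ∀ {s} → s ≈ᵗ s
        sym      : ∀ {s t} → s ≈ᵗ t → t ≈ᵗ s
        trans    : ∀ {s t u} → s ≈ᵗ t → t ≈ᵗ u → s ≈ᵗ u
        +-cong   : ∀ {s t u v} → s ≈ᵗ t → u ≈ᵗ v → s +ᵗ u ≈ᵗ t +ᵗ v
        ·-cong   : ∀ {x y s t} → x R.≈ y → s ≈ᵗ t → x ·ᵗ s ≈ᵗ y ·ᵗ t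
        +-assoc  : ∀ s t u → (s +ᵗ t) +ᵗ u ≈ᵗ s +ᵗ (t +ᵗ u)
        +-0      : ∀ s → 0ᵗ +ᵗ s ≈ᵗ s
        +-comm   : ∀ s t → s +ᵗ t ≈ᵗ t +ᵗ s
        ·-+ʳ     : ∀ s x y → (x R.+ y) ·ᵗ s ≈ᵗ (x ·ᵗ s) +ᵗ (y ·ᵗ s)
        ·-+ˡ     : ∀ x s t → x ·ᵗ (s +ᵗ t) ≈ᵗ (x ·ᵗ s) +ᵗ (x ·ᵗ t)
        ·-*      : ∀ x y s → (x R.* y) ·ᵗ s ≈ᵗ x ·ᵗ (y ·ᵗ s)
        ·-1      : ∀ s → R.1# ·ᵗ s ≈ᵗ s
        ·-0ˡ     : ∀ s → R.0# ·ᵗ s ≈ᵗ 0ᵗ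
        ·-0ʳ     : ∀ x → x ·ᵗ 0ᵗ ≈ᵗ 0ᵗ

      opaque
        presented-laws : IsLeftModule R.ring _≈ᵗ_ _+ᵗ_ 0ᵗ ((R.- R.1#) ·ᵗ_) _·ᵗ_
        presented-laws = isModule record
            { +ᴹ-isCommutativeMonoid = record
              { isMonoid = record
                { isSemigroup = record
                  { isMagma = record
                    { isEquivalence = record { refl = refl ; sym = sym ; trans = trans }
                    ; ∙-cong = +-cong }
                  ; assoc = +-assoc }
                ; identity = +-0 , λ s → trans (+-comm s 0ᵗ) (+-0 s) }
              ; comm = +-comm }
            ; isPreleftSemimodule = record
              { *ₗ-cong = ·-cong
              ; *ₗ-zeroˡ = ·-0ˡ
              ; *ₗ-distribʳ = ·-+ʳ
              ; *ₗ-identityˡ = ·-1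
              ; *ₗ-assoc = ·-*
              ; *ₗ-zeroʳ = ·-0ʳ
              ; *ₗ-distribˡ = ·-+ˡ } }

      presented : Mod (r ⊔ g) (r ⊔ g ⊔ ρ)
      presented = record { isLeftModule = presented-laws }

      module _ {m ℓ} (M : Mod m ℓ) (f : Gen → LeftModule.Carrierᴹ M) where
        private module M = LeftModule M

        eval-cong : (∀ {s t} → s ~ t → eval M f s M.≈ᴹ eval M f t) →
                    ∀ {s t} → s ≈ᵗ t → eval M f s M.≈ᴹ eval M f t
        eval-cong h (relation e)    = h e
        eval-cong h refl            = M.≈ᴹ-refl
        eval-cong h (sym e)         = M.≈ᴹ-sym (eval-cong h e)
        eval-cong h (trans e e′)    = M.≈ᴹ-trans (eval-cong h e) (eval-cong h e′)
        eval-cong h (+-cong e e′)   = M.+ᴹ-cong (eval-cong h e) (eval-cong h e′)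
        eval-cong h (·-cong x e)    = M.*ₗ-cong x (eval-cong h e)
        eval-cong h (+-assoc s t u) = M.+ᴹ-assoc _ _ _
        eval-cong h (+-0 s)         = M.+ᴹ-identityˡ _
        eval-cong h (+-comm s t)    = M.+ᴹ-comm _ _
        eval-cong h (·-+ʳ s x y)    = M.*ₗ-distribʳ _ _ _
        eval-cong h (·-+ˡ x s t)    = M.*ₗ-distribˡ _ _ _
        eval-cong h (·-* x y s)     = M.*ₗ-assoc _ _ _
        eval-cong h (·-1 s)         = M.*ₗ-identityˡ _
        eval-cong h (·-0ˡ s)        = M.*ₗ-zeroˡ _
        eval-cong h (·-0ʳ x)        = M.*ₗ-zeroʳ _

        evalₗ : (∀ {s t} → s ~ t → eval M f s M.≈ᴹ eval M f t) → presented ⟶ M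
        evalₗ h = linear (eval M f) (eval-cong h) (λ _ _ → M.≈ᴹ-refl) (λ _ _ → M.≈ᴹ-refl)

  module _ {m ℓ m′ ℓ′} (M : Mod m ℓ) (N : Mod m′ ℓ′) where
    private
      module M = LeftModule M
      module N = LeftModule N
    open Presented (M.Carrierᴹ × N.Carrierᴹ)

    data Bilinear : Rel Term (r ⊔ m ⊔ ℓ ⊔ m′ ⊔ ℓ′) where
      ⊗-cong : ∀ {x x′ y y′} → x M.≈ᴹ x′ → y N.≈ᴹ y′ →
               Bilinear (gen (x , y)) (gen (x′ , y′))
      +ˡ : ∀ x x′ y → Bilinear (gen (x M.+ᴹ x′ , y)) (gen (x , y) +ᵗ gen (x′ , y))
      +ʳ : ∀ x y y′ → Bilinear (gen (x , y N.+ᴹ y′)) (gen (x , y) +ᵗ gen (x , y′))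
      *ˡ : ∀ s x y → Bilinear (gen (s M.*ₗ x , y)) (s ·ᵗ gen (x , y))
      *ʳ : ∀ s x y → Bilinear (gen (x , s N.*ₗ y)) (s ·ᵗ gen (x , y))

    infixr 7 _⊗_
    _⊗_ : Mod (r ⊔ m ⊔ m′) (r ⊔ m ⊔ ℓ ⊔ m′ ⊔ ℓ′)
    _⊗_ = presented Bilinear

  module _ {m₁ ℓ₁ m₂ ℓ₂ m₃ ℓ₃} {M : Mod m₁ ℓ₁} {N : Mod m₂ ℓ₂} {O : Mod m₃ ℓ₃} where
    private
      module M = LeftModule M
      module N = LeftModule N
      module O = LeftModule O
    open Presented (M.Carrierᴹ × N.Carrierᴹ)

    ⊗-lift : (β : M.Carrierᴹ → N.Carrierᴹ → O.Carrierᴹ) →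
             (∀ {x x′ y y′} → x M.≈ᴹ x′ → y N.≈ᴹ y′ → β x y O.≈ᴹ β x′ y′) →
             (∀ x x′ y → β (x M.+ᴹ x′) y O.≈ᴹ β x y O.+ᴹ β x′ y) →
             (∀ x y y′ → β x (y N.+ᴹ y′) O.≈ᴹ β x y O.+ᴹ β x y′) →
             (∀ s x y → β (s M.*ₗ x) y O.≈ᴹ s O.*ₗ β x y) →
             (∀ s x y → β x (s N.*ₗ y) O.≈ᴹ s O.*ₗ β x y) →
             M ⊗ N ⟶ O
    ⊗-lift β β-cong β-+ˡ β-+ʳ β-*ˡ β-*ʳ = evalₗ (Bilinear M N) O (λ (x , y) → β x y) λ
      { (⊗-cong e f) → β-cong e f
      ; (+ˡ x x′ y)  → β-+ˡ x x′ y
      ; (+ʳ x y y′)  → β-+ʳ x y y′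
      ; (*ˡ s x y)   → β-*ˡ s x y
      ; (*ʳ s x y)   → β-*ʳ s x y }

  module _ {m₁ ℓ₁ m₂ ℓ₂ m₃ ℓ₃ m₄ ℓ₄}
           {M : Mod m₁ ℓ₁} {N : Mod m₂ ℓ₂} {M′ : Mod m₃ ℓ₃} {N′ : Mod m₄ ℓ₄} where
    private
      module M′ = LeftModule M′
      module N′ = LeftModule N′
    open Presented (M′.Carrierᴹ × N′.Carrierᴹ)

    infixr 7 _⊗₁_
    _⊗₁_ : M ⟶ M′ → N ⟶ N′ → M ⊗ N ⟶ M′ ⊗ N′
    f ⊗₁ h = ⊗-lift {O = M′ ⊗ N′} (λ x y → gen (f.to x , h.to y))
      (λ e e′ → relation (⊗-cong (f.⟦⟧-cong e) (h.⟦⟧-cong e′)))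
      (λ x x′ y → trans (relation (⊗-cong (f.+ᴹ-homo x x′) N′.≈ᴹ-refl)) (relation (+ˡ _ _ _)))
      (λ x y y′ → trans (relation (⊗-cong M′.≈ᴹ-refl (h.+ᴹ-homo y y′))) (relation (+ʳ _ _ _)))
      (λ s x y → trans (relation (⊗-cong (f.*ₗ-homo s x) N′.≈ᴹ-refl)) (relation (*ˡ _ _ _)))
      (λ s x y → trans (relation (⊗-cong M′.≈ᴹ-refl (h.*ₗ-homo s y))) (relation (*ʳ _ _ _)))
      where
      module f = _⟶_ f
      module h = _⟶_ h

  record DirectedSystem i e m ℓ : Set (r ⊔ lsuc (i ⊔ e ⊔ m ⊔ ℓ)) where
    infix 4 _≤_
    field
      Index   : Set i
      base    : Index
      _≤_     : Rel Index e
      ≤-refl  : ∀ {j} → j ≤ j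
      ≤-trans : ∀ {j k l} → j ≤ k → k ≤ l → j ≤ l
      _∨_     : Index → Index → Index
      ubˡ     : ∀ j k → j ≤ j ∨ k
      ubʳ     : ∀ j k → k ≤ j ∨ k
      M       : Index → Mod m ℓ
      res     : ∀ {j k} → j ≤ k → M j ⟶ M k
    module M j = LeftModule (M j)
    field
      res-id  : ∀ {j} (p : j ≤ j) x → M._≈ᴹ_ j (_⟶_.to (res p) x) x
      res-∘   : ∀ {j k l} (p : j ≤ k) (q : k ≤ l) (s : j ≤ l) x →
                M._≈ᴹ_ l (_⟶_.to (res q) (_⟶_.to (res p) x)) (_⟶_.to (res s) x)

  module DirectLimit {i e m ℓ} (D : DirectedSystem i e m ℓ) where
    open DirectedSystem D
    module res {j k} (p : j ≤ k) = _⟶_ (res p)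

    Element : Set (i ⊔ m)
    Element = Σ[ j ∈ Index ] M.Carrierᴹ j

    infix 4 _≈_
    record _≈_ (x y : Element) : Set (i ⊔ e ⊔ ℓ) where
      constructor common
      field
        above : Index
        left  : proj₁ x ≤ above
        right : proj₁ y ≤ above
        equal : M._≈ᴹ_ above (res.to left (proj₂ x)) (res.to right (proj₂ y))

    shift : ∀ {j k} (p : j ≤ k) x → (j , x) ≈ (k , res.to p x)
    shift {k = k} p x = common k p ≤-refl (M.≈ᴹ-sym k (res-id ≤-refl _))

    ≈-at : ∀ {j x y} → M._≈ᴹ_ j x y → (j , x) ≈ (j , y)
    ≈-at {j} e = common j ≤-refl ≤-refl (res.⟦⟧-cong ≤-refl e)

    ≈-refl : ∀ {x} → x ≈ x
    ≈-refl {j , x} = ≈-at (M.≈ᴹ-refl j)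

    ≈-sym : ∀ {x y} → x ≈ y → y ≈ x
    ≈-sym (common l p q e) = common l q p (M.≈ᴹ-sym l e)

    ≈-trans : ∀ {x y z} → x ≈ y → y ≈ z → x ≈ z
    ≈-trans {j , x} {k , y} {l , z} (common u p q e) (common v s t f) =
      common w (≤-trans p uw) (≤-trans t vw) (begin
        res.to (≤-trans p uw) x  ≈⟨ res-∘ p uw _ x ⟨
        res.to uw (res.to p x)   ≈⟨ res.⟦⟧-cong uw e ⟩
        res.to uw (res.to q y)   ≈⟨ res-∘ q uw _ y ⟩
        res.to (≤-trans q uw) y  ≈⟨ res-∘ s vw _ y ⟨
        res.to vw (res.to s y)   ≈⟨ res.⟦⟧-cong vw f ⟩
        res.to vw (res.to t z)   ≈⟨ res-∘ t vw _ z ⟩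
        res.to (≤-trans t vw) z  ∎)
      where
      w = u ∨ v
      uw = ubˡ u v
      vw = ubʳ u v
      open SetoidReasoning (M.≈ᴹ-setoid w)

    setoid : Setoid (i ⊔ m) (i ⊔ e ⊔ ℓ)
    setoid = record
      { Carrier = Element
      ; _≈_ = _≈_
      ; isEquivalence = record { refl = ≈-refl ; sym = ≈-sym ; trans = ≈-trans } }

    _+_ : Element → Element → Element
    (j , x) + (k , y) = j ∨ k , M._+ᴹ_ (j ∨ k) (res.to (ubˡ j k) x) (res.to (ubʳ j k) y)

    _*_ : R.Carrier → Element → Element
    s * (j , x) = j , M._*ₗ_ j s x

    +-at : ∀ {j k l} (p : j ≤ l) (q : k ≤ l) x y →
           (j , x) + (k , y) ≈ (l , M._+ᴹ_ l (res.to p x) (res.to q y))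
    +-at {j} {k} {l} p q x y = common w j∨k≤w l≤w (begin
        res.to j∨k≤w (M._+ᴹ_ (j ∨ k) (res.to (ubˡ j k) x) (res.to (ubʳ j k) y))
          ≈⟨ res.+ᴹ-homo j∨k≤w _ _ ⟩
        M._+ᴹ_ w (res.to j∨k≤w (res.to (ubˡ j k) x)) (res.to j∨k≤w (res.to (ubʳ j k) y))
          ≈⟨ M.+ᴹ-cong w (res-∘ _ _ (≤-trans p l≤w) x) (res-∘ _ _ (≤-trans q l≤w) y) ⟩
        M._+ᴹ_ w (res.to (≤-trans p l≤w) x) (res.to (≤-trans q l≤w) y)
          ≈⟨ M.+ᴹ-cong w (res-∘ p l≤w _ x) (res-∘ q l≤w _ y) ⟨
        M._+ᴹ_ w (res.to l≤w (res.to p x)) (res.to l≤w (res.to q y))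
          ≈⟨ res.+ᴹ-homo l≤w _ _ ⟨
        res.to l≤w (M._+ᴹ_ l (res.to p x) (res.to q y)) ∎)
      where
      w = (j ∨ k) ∨ l
      j∨k≤w = ubˡ (j ∨ k) l
      l≤w = ubʳ (j ∨ k) l
      open SetoidReasoning (M.≈ᴹ-setoid w)

    +-here : ∀ {j} x y → (j , x) + (j , y) ≈ (j , M._+ᴹ_ j x y)
    +-here {j} x y = ≈-trans (+-at ≤-refl ≤-refl x y)
      (≈-at (M.+ᴹ-cong j (res-id _ x) (res-id _ y)))

    +-cong : ∀ {x y u v} → x ≈ y → u ≈ v → x + u ≈ y + v
    +-cong {_ , x} {_ , y} {_ , u} {_ , v} (common l p q e) (common l′ p′ q′ e′) = begin
      (_ , x) + (_ , u)
        ≈⟨ +-at (≤-trans p lw) (≤-trans p′ lw′) x u ⟩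
      (w , M._+ᴹ_ w (res.to (≤-trans p lw) x) (res.to (≤-trans p′ lw′) u))
        ≈⟨ ≈-at (M.+ᴹ-cong w (up lw p q e) (up lw′ p′ q′ e′)) ⟩
      (w , M._+ᴹ_ w (res.to (≤-trans q lw) y) (res.to (≤-trans q′ lw′) v))
        ≈⟨ +-at (≤-trans q lw) (≤-trans q′ lw′) y v ⟨
      (_ , y) + (_ , v) ∎
      where
      w = l ∨ l′
      lw = ubˡ l l′
      lw′ = ubʳ l l′
      up : ∀ {j k l} (t : l ≤ w) (p : j ≤ l) (q : k ≤ l) {x y} →
           M._≈ᴹ_ l (res.to p x) (res.to q y) →
           M._≈ᴹ_ w (res.to (≤-trans p t) x) (res.to (≤-trans q t) y)
      up t p q e = M.≈ᴹ-trans w (M.≈ᴹ-sym w (res-∘ p t _ _))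
        (M.≈ᴹ-trans w (res.⟦⟧-cong t e) (res-∘ q t _ _))
      open SetoidReasoning setoid

    *-cong : ∀ {s t x y} → s R.≈ t → x ≈ y → s * x ≈ t * y
    *-cong c (common l p q e) = common l p q
      (M.≈ᴹ-trans l (res.*ₗ-homo p _ _)
        (M.≈ᴹ-trans l (M.*ₗ-cong l c e) (M.≈ᴹ-sym l (res.*ₗ-homo q _ _))))

    0≈ : ∀ j k → (j , M.0ᴹ j) ≈ (k , M.0ᴹ k)
    0≈ j k = common (j ∨ k) (ubˡ j k) (ubʳ j k)
      (M.≈ᴹ-trans (j ∨ k) (res.0ᴹ-homo (ubˡ j k)) (M.≈ᴹ-sym (j ∨ k) (res.0ᴹ-homo (ubʳ j k))))

    +-comm : ∀ x y → x + y ≈ y + x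
    +-comm (j , x) (k , y) = ≈-trans (≈-at (M.+ᴹ-comm (j ∨ k) _ _))
      (≈-sym (+-at (ubʳ j k) (ubˡ j k) y x))

    +-assoc : ∀ x y z → (x + y) + z ≈ x + (y + z)
    +-assoc x@(j , x₀) y@(k , y₀) z@(l , z₀) = begin
      (x + y) + z   ≈⟨ +-cong (+-cong x≈ y≈) z≈ ⟩
      (x′ + y′) + z′ ≈⟨ +-cong (+-here _ _) ≈-refl ⟩
      (w , _) + z′   ≈⟨ +-here _ _ ⟩
      (w , _)        ≈⟨ ≈-at (M.+ᴹ-assoc w _ _ _) ⟩
      (w , _)        ≈⟨ +-here _ _ ⟨
      x′ + (w , _)   ≈⟨ +-cong ≈-refl (+-here _ _) ⟨
      x′ + (y′ + z′) ≈⟨ +-cong x≈ (+-cong y≈ z≈) ⟨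
      x + (y + z)    ∎
      where
      w = (j ∨ k) ∨ l
      j≤w = ≤-trans (ubˡ j k) (ubˡ (j ∨ k) l)
      k≤w = ≤-trans (ubʳ j k) (ubˡ (j ∨ k) l)
      l≤w = ubʳ (j ∨ k) l
      x′ = w , res.to j≤w x₀
      y′ = w , res.to k≤w y₀
      z′ = w , res.to l≤w z₀
      x≈ : x ≈ x′
      x≈ = shift j≤w x₀
      y≈ : y ≈ y′
      y≈ = shift k≤w y₀
      z≈ : z ≈ z′
      z≈ = shift l≤w z₀
      open SetoidReasoning setoid

    0# : Element
    0# = base , M.0ᴹ base

    +-0 : ∀ x → 0# + x ≈ x
    +-0 (j , x) = ≈-trans (+-cong (0≈ base j) ≈-refl)
        (≈-trans (+-here _ _) (≈-at (M.+ᴹ-identityˡ j x)))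

    opaque
      lim-laws : IsLeftModule R.ring _≈_ _+_ 0# ((R.- R.1#) *_) _*_
      lim-laws = isModule record
          { +ᴹ-isCommutativeMonoid = record
            { isMonoid = record
              { isSemigroup = record
                { isMagma = record
                  { isEquivalence = Setoid.isEquivalence setoid
                  ; ∙-cong = +-cong }
                ; assoc = +-assoc }
              ; identity = +-0 , λ x → ≈-trans (+-comm x 0#) (+-0 x) }
            ; comm = +-comm }
          ; isPreleftSemimodule = record
            { *ₗ-cong = *-cong
            ; *ₗ-zeroˡ = λ (j , x) → ≈-trans (≈-at (M.*ₗ-zeroˡ j x)) (0≈ j base)
            ; *ₗ-distribʳ = λ (j , x) s t →
                ≈-trans (≈-at (M.*ₗ-distribʳ j x s t)) (≈-sym (+-here _ _))
            ; *ₗ-identityˡ = λ (j , x) → ≈-at (M.*ₗ-identityˡ j x)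
            ; *ₗ-assoc = λ s t (j , x) → ≈-at (M.*ₗ-assoc j s t x)
            ; *ₗ-zeroʳ = λ s → ≈-at (M.*ₗ-zeroʳ base s)
            ; *ₗ-distribˡ = λ s (j , x) (k , y) →
                ≈-at {j ∨ k} (M.≈ᴹ-trans (j ∨ k) (M.*ₗ-distribˡ (j ∨ k) s _ _)
                  (M.≈ᴹ-sym (j ∨ k) (M.+ᴹ-cong (j ∨ k)
                    (res.*ₗ-homo (ubˡ j k) s x) (res.*ₗ-homo (ubʳ j k) s y)))) } }

    lim : Mod (i ⊔ m) (i ⊔ e ⊔ ℓ)
    lim = record { isLeftModule = lim-laws }

    ι : ∀ j → M j ⟶ lim
    ι j = linear (j ,_) ≈-at (λ x y → ≈-sym (+-here x y)) (λ _ _ → ≈-refl)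

  module _ {i e m ℓ i′ e′ m′ ℓ′} (D : DirectedSystem i e m ℓ) (E : DirectedSystem i′ e′ m′ ℓ′) where
    private
      module D = DirectedSystem D
      module E = DirectedSystem E
      module limD = DirectLimit D
      module limE = DirectLimit E

    record SystemMap : Set (r ⊔ i ⊔ e ⊔ m ⊔ ℓ ⊔ i′ ⊔ e′ ⊔ m′ ⊔ ℓ′) where
      field
        act     : D.Index → E.Index
        mono    : ∀ {j k} → j D.≤ k → act j E.≤ act k
        at      : ∀ j → D.M j ⟶ E.M (act j)
        natural : ∀ {j k} (p : j D.≤ k) x →
                  E.M._≈ᴹ_ (act k) (_⟶_.to (at k) (_⟶_.to (D.res p) x))
                                   (_⟶_.to (E.res (mono p)) (_⟶_.to (at j) x))

    lim₁ : SystemMap → limD.lim ⟶ limE.lim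
    lim₁ f = linear to to-cong to-+ (λ s (j , x) → limE.≈-at (at.*ₗ-homo j s x))
      where
      open SystemMap f
      module at j = _⟶_ (at j)
      to : limD.Element → limE.Element
      to (j , x) = act j , at.to j x
      open SetoidReasoning limE.setoid

      step : ∀ {j k} (p : j D.≤ k) x → to (j , x) limE.≈ to (k , limD.res.to p x)
      step p x = limE.≈-trans (limE.shift (mono p) _) (limE.≈-sym (limE.≈-at (natural p x)))

      to-cong : ∀ {x y} → x limD.≈ y → to x limE.≈ to y
      to-cong {j , x} {k , y} (limD.common l p q e) = begin
        to (j , x)               ≈⟨ step p x ⟩
        to (l , limD.res.to p x) ≈⟨ limE.≈-at (at.⟦⟧-cong l e) ⟩
        to (l , limD.res.to q y) ≈⟨ step q y ⟨
        to (k , y)               ∎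

      to-+ : ∀ x y → to (x limD.+ y) limE.≈ to x limE.+ to y
      to-+ (j , x) (k , y) = begin
        to ((j , x) limD.+ (k , y))         ≈⟨ limE.≈-at (at.+ᴹ-homo l _ _) ⟩
        (act l , E.M._+ᴹ_ (act l) _ _)      ≈⟨ limE.+-here _ _ ⟨
        to (l , limD.res.to p x) limE.+ to (l , limD.res.to q y)
                                            ≈⟨ limE.+-cong (step p x) (step q y) ⟨
        to (j , x) limE.+ to (k , y)        ∎
        where
        l = j D.∨ k
        p = D.ubˡ j k
        q = D.ubʳ j k

module Subgroups {a} (G : Group a a) where
  open Group G hiding (refl; sym; trans)
  private
    module G = Group G
    module GP = GroupProperties G
  open SetoidReasoning G.setoid

  infixl 8 _^_
  _^_ : Carrier → Carrier → Carrier
  x ^ g = g ⁻¹ ∙ x ∙ g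

  ^-cong : ∀ {x y g h} → x ≈ y → g ≈ h → x ^ g ≈ y ^ h
  ^-cong e f = ∙-cong (∙-cong (⁻¹-cong f) e) f

  ^-∙ : ∀ x y g → (x ∙ y) ^ g ≈ x ^ g ∙ y ^ g
  ^-∙ x y g = G.sym (begin
    (g ⁻¹ ∙ x ∙ g) ∙ (g ⁻¹ ∙ y ∙ g) ≈⟨ assoc _ g _ ⟩
    g ⁻¹ ∙ x ∙ (g ∙ (g ⁻¹ ∙ y ∙ g)) ≈⟨ ∙-congˡ (∙-congˡ (assoc _ y g)) ⟩
    g ⁻¹ ∙ x ∙ (g ∙ (g ⁻¹ ∙ (y ∙ g))) ≈⟨ ∙-congˡ (GP.\\-leftDividesˡ g _) ⟩
    g ⁻¹ ∙ x ∙ (y ∙ g)              ≈⟨ assoc _ y g ⟨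
    g ⁻¹ ∙ x ∙ y ∙ g                ≈⟨ ∙-congʳ (assoc _ x y) ⟩
    g ⁻¹ ∙ (x ∙ y) ∙ g              ∎)

  ε-^ : ∀ g → ε ^ g ≈ ε
  ε-^ g = G.trans (∙-congʳ (identityʳ _)) (inverseˡ g)

  ⁻¹-^ : ∀ x g → (x ⁻¹) ^ g ≈ (x ^ g) ⁻¹
  ⁻¹-^ x g = GP.inverseˡ-unique _ _
    (G.trans (G.sym (^-∙ _ x g)) (G.trans (^-cong (inverseˡ x) G.refl) (ε-^ g)))

  ^-ε : ∀ x → x ^ ε ≈ x
  ^-ε x = G.trans (identityʳ _) (G.trans (∙-congʳ GP.ε⁻¹≈ε) (identityˡ x))

  ^-^ : ∀ x g h → x ^ (g ∙ h) ≈ (x ^ g) ^ h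
  ^-^ x g h = begin
    (g ∙ h) ⁻¹ ∙ x ∙ (g ∙ h)      ≈⟨ ∙-congʳ (∙-congʳ (GP.⁻¹-anti-homo-∙ g h)) ⟩
    h ⁻¹ ∙ g ⁻¹ ∙ x ∙ (g ∙ h)     ≈⟨ assoc _ g h ⟨
    h ⁻¹ ∙ g ⁻¹ ∙ x ∙ g ∙ h       ≈⟨ ∙-congʳ (∙-congʳ (assoc _ _ x)) ⟩
    h ⁻¹ ∙ (g ⁻¹ ∙ x) ∙ g ∙ h     ≈⟨ ∙-congʳ (assoc _ _ g) ⟩
    h ⁻¹ ∙ (g ⁻¹ ∙ x ∙ g) ∙ h     ∎

  ∙-^ : ∀ x g → g ∙ x ^ g ≈ x ∙ g
  ∙-^ x g = G.trans (∙-congˡ (assoc _ x g)) (GP.\\-leftDividesˡ g _)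

  record Subgroup : Set (lsuc a) where
    field
      mem       : Pred Carrier a
      resp      : mem Respects _≈_
      ε-closed  : mem ε
      ∙-closed  : ∀ {x y} → mem x → mem y → mem (x ∙ y)
      ⁻¹-closed : ∀ {x} → mem x → mem (x ⁻¹)

    group : Group a a
    group = record
      { Carrier = Σ Carrier mem
      ; _≈_ = λ x y → proj₁ x ≈ proj₁ y
      ; _∙_ = λ (x , x∈) (y , y∈) → x ∙ y , ∙-closed x∈ y∈
      ; ε = ε , ε-closed
      ; _⁻¹ = λ (x , x∈) → x ⁻¹ , ⁻¹-closed x∈
      ; isGroup = record
        { isMonoid = record
          { isSemigroup = record
            { isMagma = record
              { isEquivalence = record { refl = G.refl ; sym = G.sym ; trans = G.trans }
              ; ∙-cong = ∙-cong }
            ; assoc = λ _ _ _ → assoc _ _ _ }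
          ; identity = (λ _ → identityˡ _) , (λ _ → identityʳ _) }
        ; inverse = (λ _ → inverseˡ _) , (λ _ → inverseʳ _)
        ; ⁻¹-cong = ⁻¹-cong } }

  infix 4 _∈_ _⊆_
  _∈_ : Carrier → Subgroup → Set a
  x ∈ S = Subgroup.mem S x

  _⊆_ : Rel Subgroup a
  S ⊆ T = ∀ x → x ∈ S → x ∈ T

  infixr 7 _∩_
  _∩_ : Subgroup → Subgroup → Subgroup
  S ∩ T = record
    { mem = λ x → x ∈ S × x ∈ T
    ; resp = λ e (x∈S , x∈T) → S.resp e x∈S , T.resp e x∈T
    ; ε-closed = S.ε-closed , T.ε-closed
    ; ∙-closed = λ (x∈S , x∈T) (y∈S , y∈T) → S.∙-closed x∈S y∈S , T.∙-closed x∈T y∈T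
    ; ⁻¹-closed = λ (x∈S , x∈T) → S.⁻¹-closed x∈S , T.⁻¹-closed x∈T }
    where
    module S = Subgroup S
    module T = Subgroup T

  -- gSg⁻¹, since x ∈ gSg⁻¹ iff g⁻¹xg ∈ S.
  conj : Carrier → Subgroup → Subgroup
  conj g S = record
    { mem = λ x → x ^ g ∈ S
    ; resp = λ e → S.resp (^-cong e G.refl)
    ; ε-closed = S.resp (G.sym (ε-^ g)) S.ε-closed
    ; ∙-closed = λ x∈ y∈ → S.resp (G.sym (^-∙ _ _ g)) (S.∙-closed x∈ y∈)
    ; ⁻¹-closed = λ x∈ → S.resp (G.sym (⁻¹-^ _ g)) (S.⁻¹-closed x∈) }
    where module S = Subgroup S

  FinitelyGenerated : Subgroup → Set (lsuc a)
  FinitelyGenerated S =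
    ∃[ n ] Σ[ s ∈ (Fin n → Carrier) ]
    (∀ i → s i ∈ S) × (∀ T → (∀ i → s i ∈ T) → S ⊆ T)

  -- ΓgΓ/Γ.
  cosets : Subgroup → Carrier → Setoid a a
  cosets Γ g = record
    { Carrier = Σ[ x ∈ Carrier ] ∃₂ λ γ δ → γ ∈ Γ × δ ∈ Γ × x ≈ γ ∙ g ∙ δ
    ; _≈_ = λ x y → proj₁ x ⁻¹ ∙ proj₁ y ∈ Γ
    ; isEquivalence = record
      { refl = Γ.resp (G.sym (inverseˡ _)) Γ.ε-closed
      ; sym = λ e → Γ.resp (GP.⁻¹-anti-homo-\\ _ _) (Γ.⁻¹-closed e)
      ; trans = λ {x} {y} {z} e f →
          Γ.resp (G.trans (assoc _ _ _) (∙-congˡ (GP.\\-leftDividesˡ (proj₁ y) (proj₁ z))))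
                 (Γ.∙-closed e f) } }
    where module Γ = Subgroup Γ

  IsHeckePair : Subgroup → Set a
  IsHeckePair Γ = ∀ g → ∃[ n ] Inverse (≡.setoid (Fin n)) (cosets Γ g)

  record ConjugationInvariantSubset : Set (lsuc a) where
    field
      mem      : Pred Carrier a
      resp     : mem Respects _≈_
      conj-inv : ∀ g {x} → mem x → mem (g ∙ x ∙ g ⁻¹)

    ^-closed : ∀ g {x} → mem x → mem (x ^ g)
    ^-closed g x∈ = resp (∙-congˡ (GP.⁻¹-involutive g)) (conj-inv (g ⁻¹) x∈)

  module _ (Γ : Subgroup) where

    record CongruenceSubgroup : Set (lsuc a) where
      field
        subgroup : Subgroup
        ⊆Γ       : subgroup ⊆ Γ
        gs       : List Carrier
        contains : ∀ x → x ∈ Γ → All (λ g → x ∈ conj g Γ) gs → x ∈ subgroup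
      open Subgroup subgroup public

    open CongruenceSubgroup using (subgroup)

    infix 4 _⊇_
    record _⊇_ (S T : CongruenceSubgroup) : Set a where
      constructor contained
      field inclusion : subgroup T ⊆ subgroup S

    whole : CongruenceSubgroup
    whole = record { subgroup = Γ ; ⊆Γ = λ _ x∈ → x∈ ; gs = [] ; contains = λ _ x∈ _ → x∈ }

    meet : CongruenceSubgroup → CongruenceSubgroup → CongruenceSubgroup
    meet S T = record
      { subgroup = subgroup S ∩ subgroup T
      ; ⊆Γ = λ x (x∈S , _) → S.⊆Γ x x∈S
      ; gs = S.gs ++ T.gs
      ; contains = λ x x∈Γ x∈gs → S.contains x x∈Γ (All.++⁻ˡ S.gs x∈gs)
                               , T.contains x x∈Γ (All.++⁻ʳ S.gs x∈gs) }
      where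
      module S = CongruenceSubgroup S
      module T = CongruenceSubgroup T

    -- S ∩ gSg⁻¹ contains Γ ∩ ⋂ gᵢΓgᵢ⁻¹ ∩ gΓg⁻¹ ∩ ⋂ ggᵢΓ(ggᵢ)⁻¹ if S contains Γ ∩ ⋂ gᵢΓgᵢ⁻¹.
    shrink : Carrier → CongruenceSubgroup → CongruenceSubgroup
    shrink g S = record
      { subgroup = subgroup S ∩ conj g (subgroup S)
      ; ⊆Γ = λ x (x∈S , _) → S.⊆Γ x x∈S
      ; gs = S.gs ++ g ∷ map (g ∙_) S.gs
      ; contains = contains }
      where
      module S = CongruenceSubgroup S
      contains : ∀ x → x ∈ Γ → All (λ h → x ∈ conj h Γ) (S.gs ++ g ∷ map (g ∙_) S.gs) →
                 x ∈ subgroup S ∩ conj g (subgroup S)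
      contains x x∈Γ x∈ with All.++⁻ʳ S.gs x∈
      ... | x∈g ∷ x∈gs =
        S.contains x x∈Γ (All.++⁻ˡ S.gs x∈) ,
        S.contains (x ^ g) x∈g
          (All.map (λ {h} → Subgroup.resp Γ (^-^ x g h)) (All.map⁻ x∈gs))

module GroupRing {a} (R : CommutativeRing a a) (S : Group a a) where
  private
    module R = CommutativeRing R
    module S = Group S
  open Modules R
  open Presented S.Carrier public

  data _~_ : Rel Term a where
    gen-cong : ∀ {x y} → x S.≈ y → gen x ~ gen y

  R[S] : Mod a a
  R[S] = presented _~_

  infixl 7 _⊛_
  _⊛_ : Term → Term → Term
  s ⊛ t = eval R[S] (λ x → eval R[S] (λ y → gen (x S.∙ y)) t) s

  aug : Term → R.Carrier
  aug = eval ⟨R⟩ (λ _ → R.1#)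

  -- The powers of the augmentation ideal, the kernel of aug.
  data I^ : ℕ → Pred Term a where
    all  : ∀ {s} → I^ 0 s
    prod : ∀ {q s t} → I^ q s → aug t R.≈ R.0# → I^ (suc q) (s ⊛ t)
    sum  : ∀ {q s t} → I^ q s → I^ q t → I^ q (s +ᵗ t)
    none : ∀ {q} → I^ q 0ᵗ
    resp : ∀ {q s t} → _≈ᵗ_ _~_ s t → I^ q s → I^ q t

module _ {a} (R : CommutativeRing a a) (S T : Group a a) where
  private
    module R = CommutativeRing R
    module S = Group S
    module T = Group T
    module R[S] = GroupRing R S
    module R[T] = GroupRing R T
  open Modules R
  open GroupMorphisms S.rawGroup T.rawGroup

  module GroupRingMap {φ : S.Carrier → T.Carrier} (φ-hom : IsGroupHomomorphism φ) where
    private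
      module φ = IsGroupHomomorphism φ-hom
    open Presented using (gen; 0ᵗ; _+ᵗ_; _·ᵗ_)
    open R[T] using (refl; +-cong; ·-cong; relation; gen-cong)

    push : R[S].Term → R[T].Term
    push = R[S].eval R[T].R[S] (λ x → gen (φ x))

    push-cong : ∀ {s t} → R[S]._≈ᵗ_ R[S]._~_ s t → R[T]._≈ᵗ_ R[T]._~_ (push s) (push t)
    push-cong = R[S].eval-cong R[S]._~_ R[T].R[S] _
      λ { (R[S].gen-cong e) → relation (gen-cong (φ.⟦⟧-cong e)) }

    push-⊛ : ∀ s t → R[T]._≈ᵗ_ R[T]._~_ (push (s R[S].⊛ t)) (push s R[T].⊛ push t)
    push-⊛ 0ᵗ        t = refl
    push-⊛ (s +ᵗ s′) t = +-cong (push-⊛ s t) (push-⊛ s′ t)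
    push-⊛ (x ·ᵗ s)  t = ·-cong R.refl (push-⊛ s t)
    push-⊛ (gen x)   t = go t
      where
      go : ∀ t → R[T]._≈ᵗ_ R[T]._~_ (push (gen x R[S].⊛ t)) (gen (φ x) R[T].⊛ push t)
      go 0ᵗ        = refl
      go (t +ᵗ t′) = +-cong (go t) (go t′)
      go (y ·ᵗ t)  = ·-cong R.refl (go t)
      go (gen y)   = relation (gen-cong (φ.homo x y))

    push-aug : ∀ s → R[T].aug (push s) R.≈ R[S].aug s
    push-aug 0ᵗ       = R.refl
    push-aug (s +ᵗ t) = R.+-cong (push-aug s) (push-aug t)
    push-aug (x ·ᵗ s) = R.*-cong R.refl (push-aug s)
    push-aug (gen x)  = R.refl

    push-I^ : ∀ {q s} → R[S].I^ q s → R[T].I^ q (push s)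
    push-I^ R[S].all = R[T].all
    push-I^ (R[S].prod {s = s} {t} p e) = R[T].resp (R[T].sym (push-⊛ s t))
      (R[T].prod {t = push t} (push-I^ p) (R.trans (push-aug t) e))
    push-I^ (R[S].sum p p′)  = R[T].sum (push-I^ p) (push-I^ p′)
    push-I^ R[S].none        = R[T].none
    push-I^ (R[S].resp e p)  = R[T].resp (push-cong e) (push-I^ p)

module Representations {a} (R : CommutativeRing a a) (G : Group a a) where
  private
    module R = CommutativeRing R
    module G = Group G
  open Modules R public
  open Subgroups G

  -- An R[G]-module, as an R-module with a linear action of G.
  record GModule m ℓ : Set (a ⊔ lsuc (m ⊔ ℓ)) where
    field
      mod : Mod m ℓ
    open LeftModule mod public
    infixr 7 _▷_
    field
      _▷_     : G.Carrier → Carrierᴹ → Carrierᴹ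
      ▷-cong  : ∀ {g h x y} → g G.≈ h → x ≈ᴹ y → g ▷ x ≈ᴹ h ▷ y
      ▷-+     : ∀ g x y → g ▷ (x +ᴹ y) ≈ᴹ g ▷ x +ᴹ g ▷ y
      ▷-*     : ∀ g s x → g ▷ (s *ₗ x) ≈ᴹ s *ₗ (g ▷ x)
      ε-▷     : ∀ x → G.ε ▷ x ≈ᴹ x
      ∙-▷     : ∀ g h x → (g G.∙ h) ▷ x ≈ᴹ g ▷ h ▷ x

    ▷ₗ : G.Carrier → mod ⟶ mod
    ▷ₗ g = linear (g ▷_) (▷-cong G.refl) (▷-+ g) (▷-* g)

    ^-▷ : ∀ x g v → g ▷ (x ^ g) ▷ v ≈ᴹ x ▷ g ▷ v
    ^-▷ x g v = ≈ᴹ-trans (≈ᴹ-sym (∙-▷ _ _ v))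
      (≈ᴹ-trans (▷-cong (∙-^ x g) ≈ᴹ-refl) (∙-▷ _ _ v))

  record _⟶ᴳ_ {m ℓ m′ ℓ′} (V : GModule m ℓ) (W : GModule m′ ℓ′)
              : Set (a ⊔ m ⊔ ℓ ⊔ m′ ⊔ ℓ′) where
    private
      module V = GModule V
      module W = GModule W
    field
      linearMap   : V.mod ⟶ W.mod
    open _⟶_ linearMap public
    field
      equivariant : ∀ g x → to (g V.▷ x) W.≈ᴹ g W.▷ to x

  infixr 7 _⊗ᴳ_
  _⊗ᴳ_ : ∀ {m ℓ m′ ℓ′} → GModule m ℓ → GModule m′ ℓ′ →
         GModule (a ⊔ m ⊔ m′) (a ⊔ m ⊔ ℓ ⊔ m′ ⊔ ℓ′)
  _⊗ᴳ_ {m} {ℓ} {m′} {ℓ′} V W = record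
    { mod = V.mod ⊗ W.mod
    ; _▷_ = _▷_
    ; ▷-cong = λ {g} {h} {x} {y} e f →
        trans (_⟶_.⟦⟧-cong (V.▷ₗ g ⊗₁ W.▷ₗ g) f) (▷-congˡ e y)
    ; ▷-+ = λ _ _ _ → refl
    ; ▷-* = λ _ _ _ → refl
    ; ε-▷ = ε-▷
    ; ∙-▷ = ∙-▷ }
    where
    module V = GModule V
    module W = GModule W
    open Presented (V.Carrierᴹ × W.Carrierᴹ)
    infix 4 _≈_
    _≈_ : Rel Term (a ⊔ m ⊔ ℓ ⊔ m′ ⊔ ℓ′)
    _≈_ = _≈ᵗ_ (Bilinear V.mod W.mod)
    infixr 7 _▷_
    _▷_ : G.Carrier → Term → Term
    g ▷ t = _⟶_.to (V.▷ₗ g ⊗₁ W.▷ₗ g) t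

    ▷-congˡ : ∀ {g h} → g G.≈ h → ∀ t → g ▷ t ≈ h ▷ t
    ▷-congˡ e 0ᵗ       = refl
    ▷-congˡ e (s +ᵗ t) = +-cong (▷-congˡ e s) (▷-congˡ e t)
    ▷-congˡ e (x ·ᵗ t) = ·-cong R.refl (▷-congˡ e t)
    ▷-congˡ e (gen _)  = relation (⊗-cong (V.▷-cong e V.≈ᴹ-refl) (W.▷-cong e W.≈ᴹ-refl))

    ε-▷ : ∀ t → G.ε ▷ t ≈ t
    ε-▷ 0ᵗ       = refl
    ε-▷ (s +ᵗ t) = +-cong (ε-▷ s) (ε-▷ t)
    ε-▷ (x ·ᵗ t) = ·-cong R.refl (ε-▷ t)
    ε-▷ (gen (x , y)) = relation (⊗-cong (V.ε-▷ x) (W.ε-▷ y))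

    ∙-▷ : ∀ g h t → (g G.∙ h) ▷ t ≈ g ▷ h ▷ t
    ∙-▷ g h 0ᵗ       = refl
    ∙-▷ g h (s +ᵗ t) = +-cong (∙-▷ g h s) (∙-▷ g h t)
    ∙-▷ g h (x ·ᵗ t) = ·-cong R.refl (∙-▷ g h t)
    ∙-▷ g h (gen (x , y)) = relation (⊗-cong (V.∙-▷ g h x) (W.∙-▷ g h y))

  module _ {i e m ℓ} (D : DirectedSystem i e m ℓ) (f : G.Carrier → SystemMap D D) where
    open DirectLimit D
    private module f g = _⟶_ (lim₁ D D (f g))

    limᴳ : (∀ {g h} → g G.≈ h → ∀ x → f.to g x ≈ f.to h x) →
           (∀ x → f.to G.ε x ≈ x) →
           (∀ g h x → f.to (g G.∙ h) x ≈ f.to g (f.to h x)) →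
           GModule (i ⊔ m) (i ⊔ e ⊔ ℓ)
    limᴳ f-cong f-ε f-∙ = record
      { mod = lim
      ; _▷_ = f.to
      ; ▷-cong = λ {g} {h} {x} {y} e e′ → ≈-trans (f.⟦⟧-cong g e′) (f-cong e y)
      ; ▷-+ = f.+ᴹ-homo
      ; ▷-* = f.*ₗ-homo
      ; ε-▷ = f-ε
      ; ∙-▷ = f-∙ }

  -- W^{⊗n} ⊗ V, bracketed to the right.
  _^⊗_⊗_ : GModule (lsuc a) (lsuc a) → ℕ → GModule (lsuc a) (lsuc a) → GModule (lsuc a) (lsuc a)
  W ^⊗ zero  ⊗ V = V
  W ^⊗ suc n ⊗ V = W ⊗ᴳ (W ^⊗ n ⊗ V)

module HigherOrder {a} (R : CommutativeRing a a) (G : Group a a)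
                   (P : Subgroups.ConjugationInvariantSubset G) where
  private
    module R = CommutativeRing R
    module G = Group G
    module P = Subgroups.ConjugationInvariantSubset P
  open Subgroups G
  open Representations R G
  open Presented using (gen; 0ᵗ; _+ᵗ_; _·ᵗ_)

  module _ (S : Subgroup) where
    private
      module S = Subgroup S
      module R[S] = GroupRing R S.group

    module _ (V : GModule a a) where
      open GModule V

      infixr 7 _•_
      _•_ : R[S].Term → Carrierᴹ → Carrierᴹ
      s • v = R[S].eval mod (λ (x , _) → x ▷ v) s

      •-cong : ∀ s {v w} → v ≈ᴹ w → s • v ≈ᴹ s • w
      •-cong 0ᵗ       e = ≈ᴹ-refl
      •-cong (s +ᵗ t) e = +ᴹ-cong (•-cong s e) (•-cong t e)
      •-cong (x ·ᵗ s) e = *ₗ-cong R.refl (•-cong s e)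
      •-cong (gen _)  e = ▷-cong G.refl e

      •-+ : ∀ s v w → s • (v +ᴹ w) ≈ᴹ s • v +ᴹ s • w
      •-+ 0ᵗ       v w = ≈ᴹ-sym (+ᴹ-identityˡ 0ᴹ)
      •-+ (s +ᵗ t) v w = ≈ᴹ-trans (+ᴹ-cong (•-+ s v w) (•-+ t v w)) (interchange mod _ _ _ _)
      •-+ (x ·ᵗ s) v w = ≈ᴹ-trans (*ₗ-cong R.refl (•-+ s v w)) (*ₗ-distribˡ x _ _)
      •-+ (gen _)  v w = ▷-+ _ v w

      •-* : ∀ s x v → s • (x *ₗ v) ≈ᴹ x *ₗ (s • v)
      •-* 0ᵗ       x v = ≈ᴹ-sym (*ₗ-zeroʳ x)
      •-* (s +ᵗ t) x v = ≈ᴹ-trans (+ᴹ-cong (•-* s x v) (•-* t x v)) (≈ᴹ-sym (*ₗ-distribˡ x _ _))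
      •-* (y ·ᵗ s) x v = ≈ᴹ-trans (*ₗ-cong R.refl (•-* s x v)) (*ₗ-comm mod y x _)
      •-* (gen _)  x v = ▷-* _ x v

      •ₗ : R[S].Term → mod ⟶ mod
      •ₗ s = linear (s •_) (•-cong s) (•-+ s) (•-* s)

      ⊛-• : ∀ s t v → (s R[S].⊛ t) • v ≈ᴹ s • t • v
      ⊛-• 0ᵗ        t v = ≈ᴹ-refl
      ⊛-• (s +ᵗ s′) t v = +ᴹ-cong (⊛-• s t v) (⊛-• s′ t v)
      ⊛-• (x ·ᵗ s)  t v = *ₗ-cong R.refl (⊛-• s t v)
      ⊛-• (gen x)   t v = go t
        where
        go : ∀ t → (gen x R[S].⊛ t) • v ≈ᴹ proj₁ x ▷ t • v
        go 0ᵗ        = ≈ᴹ-sym (_⟶_.0ᴹ-homo (▷ₗ (proj₁ x)))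
        go (t +ᵗ t′) = ≈ᴹ-trans (+ᴹ-cong (go t) (go t′)) (≈ᴹ-sym (▷-+ _ _ _))
        go (y ·ᵗ t)  = ≈ᴹ-trans (*ₗ-cong R.refl (go t)) (≈ᴹ-sym (▷-* _ _ _))
        go (gen y)   = ∙-▷ _ _ v

      H⁰ : ℕ → Submodule mod a
      H⁰ zero = record
        { mem = λ v → v ≈ᴹ 0ᴹ
        ; resp = λ e f → ≈ᴹ-trans (≈ᴹ-sym e) f
        ; 0-closed = ≈ᴹ-refl
        ; +-closed = λ e f → ≈ᴹ-trans (+ᴹ-cong e f) (+ᴹ-identityˡ 0ᴹ)
        ; *-closed = λ x e → ≈ᴹ-trans (*ₗ-cong R.refl e) (*ₗ-zeroʳ x) }
      H⁰ q@(suc _) = record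
        { mem = λ v → (∀ {s} → R[S].I^ q s → s • v ≈ᴹ 0ᴹ) ×
                      (∀ p → P.mem p → p ∈ S → p ▷ v ≈ᴹ v)
        ; resp = λ e (k , f) →
            (λ {s} i → ≈ᴹ-trans (•-cong s (≈ᴹ-sym e)) (k i)) ,
            (λ p p∈P p∈S → ≈ᴹ-trans (▷-cong G.refl (≈ᴹ-sym e)) (≈ᴹ-trans (f p p∈P p∈S) e))
        ; 0-closed = (λ {s} _ → _⟶_.0ᴹ-homo (•ₗ s)) , (λ p _ _ → _⟶_.0ᴹ-homo (▷ₗ p))
        ; +-closed = λ (k , f) (k′ , f′) →
            (λ {s} i → ≈ᴹ-trans (•-+ s _ _) (≈ᴹ-trans (+ᴹ-cong (k i) (k′ i)) (+ᴹ-identityˡ 0ᴹ))) ,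
            (λ p p∈P p∈S → ≈ᴹ-trans (▷-+ p _ _) (+ᴹ-cong (f p p∈P p∈S) (f′ p p∈P p∈S)))
        ; *-closed = λ x (k , f) →
            (λ {s} i → ≈ᴹ-trans (•-* s x _) (≈ᴹ-trans (*ₗ-cong R.refl (k i)) (*ₗ-zeroʳ x))) ,
            (λ p p∈P p∈S → ≈ᴹ-trans (▷-* p x _) (*ₗ-cong R.refl (f p p∈P p∈S))) }

      -- H⁰ (pred q) ∩ H⁰ q, which is H⁰ (pred q) because I^q ⊆ I^(pred q).
      H⁰′ : ∀ q → Submodule (submodule (H⁰ q)) a
      H⁰′ q = record
        { mem = λ (v , _) → H.mem v
        ; resp = λ (lift e) → H.resp e
        ; 0-closed = H.0-closed
        ; +-closed = λ x∈ y∈ → H.+-closed x∈ y∈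
        ; *-closed = λ c x∈ → H.*-closed c x∈ }
        where module H = Submodule (H⁰ (pred q))

      H̄ : ℕ → Mod a a
      H̄ q = quotient (H⁰′ q)

      H̄-≈ : ∀ q {v w : LeftModule.Carrierᴹ (H̄ q)} → proj₁ v ≈ᴹ proj₁ w → LeftModule._≈ᴹ_ (H̄ q) v w
      H̄-≈ q e = mod-≈ (H⁰′ q) (lift e)

      Δ : G.Carrier → Carrierᴹ → Carrierᴹ
      Δ x v = x ▷ v +ᴹ -ᴹ v

      Δ-+ : ∀ x v w → Δ x (v +ᴹ w) ≈ᴹ Δ x v +ᴹ Δ x w
      Δ-+ x v w = ≈ᴹ-trans (+ᴹ-cong (▷-+ x v w) (≈ᴹ-sym (⁻¹-∙-comm v w))) (interchange mod _ _ _ _)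
        where open AbelianGroupProperties +ᴹ-abelianGroup

      -- xy - 1 = (x - 1)(y - 1) + (x - 1) + (y - 1)
      Δ-∙ : ∀ x y v → Δ (x G.∙ y) v +ᴹ -ᴹ (Δ x v +ᴹ Δ y v) ≈ᴹ Δ x (Δ y v)
      Δ-∙ x y v = begin
        ((x G.∙ y) ▷ v +ᴹ -ᴹ v) +ᴹ -ᴹ (Δ x v +ᴹ Δ y v)
          ≈⟨ +ᴹ-cong (+ᴹ-cong (∙-▷ x y v) ≈ᴹ-refl) (≈ᴹ-sym (⁻¹-∙-comm _ _)) ⟩
        (x ▷ y ▷ v +ᴹ -ᴹ v) +ᴹ (-ᴹ Δ x v +ᴹ -ᴹ Δ y v)
          ≈⟨ +ᴹ-assoc _ _ _ ⟨
        ((x ▷ y ▷ v +ᴹ -ᴹ v) +ᴹ -ᴹ Δ x v) +ᴹ -ᴹ Δ y v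
          ≈⟨ +ᴹ-cong (+ᴹ-cong ≈ᴹ-refl (⁻¹-anti-homo‿- _ _)) ≈ᴹ-refl ⟩
        ((x ▷ y ▷ v +ᴹ -ᴹ v) +ᴹ (v +ᴹ -ᴹ (x ▷ v))) +ᴹ -ᴹ Δ y v
          ≈⟨ +ᴹ-cong (+ᴹ-assoc _ _ _) ≈ᴹ-refl ⟩
        (x ▷ y ▷ v +ᴹ (-ᴹ v +ᴹ (v +ᴹ -ᴹ (x ▷ v)))) +ᴹ -ᴹ Δ y v
          ≈⟨ +ᴹ-cong (+ᴹ-cong ≈ᴹ-refl (\\-leftDividesʳ v _)) ≈ᴹ-refl ⟩
        (x ▷ y ▷ v +ᴹ -ᴹ (x ▷ v)) +ᴹ -ᴹ Δ y v
          ≈⟨ +ᴹ-cong (sub-homo (▷ₗ x) _ _) ≈ᴹ-refl ⟨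
        Δ x (Δ y v) ∎
        where
        open SetoidReasoning ≈ᴹ-setoid
        open AbelianGroupProperties +ᴹ-abelianGroup

      γ-1 : ∀ {γ} → γ ∈ S → R[S].Term
      γ-1 {γ} γ∈S = gen (γ , γ∈S) +ᵗ ((R.- R.1#) ·ᵗ gen (G.ε , S.ε-closed))

      γ-1∈I : ∀ {γ} (γ∈S : γ ∈ S) → R[S].aug (γ-1 γ∈S) R.≈ R.0#
      γ-1∈I _ = R.trans (R.+-cong R.refl (R.*-identityʳ _)) (R.-‿inverseʳ R.1#)

      γ-1-• : ∀ {γ} (γ∈S : γ ∈ S) v → γ-1 γ∈S • v ≈ᴹ Δ γ v
      γ-1-• _ v = +ᴹ-cong ≈ᴹ-refl
        (≈ᴹ-trans (*ₗ-cong R.refl (ε-▷ v)) (neg≈ mod v))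

      kill : ∀ q {γ v} → γ ∈ S → Submodule.mem (H⁰ (suc q)) v →
             ∀ {s} → R[S].I^ q s → s • Δ γ v ≈ᴹ 0ᴹ
      kill q {v = v} γ∈S (k , _) {s} i =
        ≈ᴹ-trans (•-cong s (≈ᴹ-sym (γ-1-• γ∈S v)))
          (≈ᴹ-trans (≈ᴹ-sym (⊛-• s (γ-1 γ∈S) v))
            (k (R[S].prod {t = γ-1 γ∈S} i (γ-1∈I γ∈S))))

      Δ-H⁰ : ∀ q {γ v} → γ ∈ S → Submodule.mem (H⁰ q) v → Submodule.mem (H⁰ (pred q)) (Δ γ v)
      Δ-H⁰ zero {γ} _ e = ≈ᴹ-trans
        (+ᴹ-cong (≈ᴹ-trans (▷-cong G.refl e) (_⟶_.0ᴹ-homo (▷ₗ γ))) (-ᴹ‿cong e)) (-ᴹ‿inverseʳ 0ᴹ)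
      Δ-H⁰ (suc zero) γ∈S v∈ = ≈ᴹ-trans (≈ᴹ-sym (ε-▷ _))
        (kill 0 γ∈S v∈ {gen (G.ε , S.ε-closed)} R[S].all)
      Δ-H⁰ (suc (suc q)) {γ} {v} γ∈S v∈@(_ , f) = kill (suc q) γ∈S v∈ ,
        λ p p∈P p∈S → ≈ᴹ-trans (sub-homo (▷ₗ p) _ _)
          (+ᴹ-cong (≈ᴹ-trans (≈ᴹ-sym (^-▷ p γ v))
                     (▷-cong G.refl (f (p ^ γ) (P.^-closed γ p∈P)
                       (S.∙-closed (S.∙-closed (S.⁻¹-closed γ∈S) p∈S) γ∈S))))
                   (-ᴹ‿cong (f p p∈P p∈S)))

    module _ {m ℓ} (M : Mod m ℓ) where
      private module M = LeftModule M
      open GroupMorphisms (Group.rawGroup S.group) M.+ᴹ-rawGroup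

      record Homᴾ : Set (a ⊔ m ⊔ ℓ) where
        field
          fun                 : Σ G.Carrier S.mem → M.Carrierᴹ
          isGroupHomomorphism : IsGroupHomomorphism fun
          vanishes            : ∀ s → P.mem (proj₁ s) → fun s M.≈ᴹ M.0ᴹ
        open IsGroupHomomorphism isGroupHomomorphism public
      open Homᴾ

      mkHom : (f : Σ G.Carrier S.mem → M.Carrierᴹ) →
              (∀ {s t} → proj₁ s G.≈ proj₁ t → f s M.≈ᴹ f t) →
              (∀ s t → f (Group._∙_ S.group s t) M.≈ᴹ f s M.+ᴹ f t) →
              (∀ s → P.mem (proj₁ s) → f s M.≈ᴹ M.0ᴹ) → Homᴾ
      mkHom f f-cong f-∙ f-P = record
        { fun = f
        ; isGroupHomomorphism = mkGroupHomomorphism S.group M.+ᴹ-group f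
            (λ {s} {t} → f-cong {s} {t}) f-∙
        ; vanishes = f-P }

      infix 4 _≈ʰ_
      record _≈ʰ_ (f f′ : Homᴾ) : Set (a ⊔ ℓ) where
        constructor pointwise
        field at : ∀ s → fun f s M.≈ᴹ fun f′ s
      open _≈ʰ_

      infixl 6 _+ʰ_
      _+ʰ_ : Op₂ Homᴾ
      f +ʰ f′ = mkHom (λ s → fun f s M.+ᴹ fun f′ s)
        (λ {s} {t} e → M.+ᴹ-cong (⟦⟧-cong f {s} {t} e) (⟦⟧-cong f′ {s} {t} e))
        (λ s t → M.≈ᴹ-trans (M.+ᴹ-cong (homo f s t) (homo f′ s t)) (interchange M _ _ _ _))
        (λ s s∈P → M.≈ᴹ-trans (M.+ᴹ-cong (vanishes f s s∈P) (vanishes f′ s s∈P))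
                              (M.+ᴹ-identityˡ M.0ᴹ))

      infixr 7 _·ʰ_
      _·ʰ_ : Opₗ R.Carrier Homᴾ
      x ·ʰ f = mkHom (λ s → x M.*ₗ fun f s)
        (λ {s} {t} e → M.*ₗ-cong R.refl (⟦⟧-cong f {s} {t} e))
        (λ s t → M.≈ᴹ-trans (M.*ₗ-cong R.refl (homo f s t)) (M.*ₗ-distribˡ x _ _))
        (λ s s∈P → M.≈ᴹ-trans (M.*ₗ-cong R.refl (vanishes f s s∈P)) (M.*ₗ-zeroʳ x))

      0ʰ : Homᴾ
      0ʰ = mkHom (λ _ → M.0ᴹ) (λ _ → M.≈ᴹ-refl)
        (λ _ _ → M.≈ᴹ-sym (M.+ᴹ-identityˡ M.0ᴹ)) (λ _ _ → M.≈ᴹ-refl)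

      opaque
        Hom-laws : IsLeftModule R.ring _≈ʰ_ _+ʰ_ 0ʰ ((R.- R.1#) ·ʰ_) _·ʰ_
        Hom-laws = isModule record
          { +ᴹ-isCommutativeMonoid = record
            { isMonoid = record
              { isSemigroup = record
                { isMagma = record
                  { isEquivalence = record
                    { refl = pointwise λ _ → M.≈ᴹ-refl
                    ; sym = λ e → pointwise λ s → M.≈ᴹ-sym (at e s)
                    ; trans = λ e f → pointwise λ s → M.≈ᴹ-trans (at e s) (at f s) }
                  ; ∙-cong = λ e f → pointwise λ s → M.+ᴹ-cong (at e s) (at f s) }
                ; assoc = λ _ _ _ → pointwise λ _ → M.+ᴹ-assoc _ _ _ }
              ; identity = (λ _ → pointwise λ _ → M.+ᴹ-identityˡ _)
                         , (λ _ → pointwise λ _ → M.+ᴹ-identityʳ _) }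
            ; comm = λ _ _ → pointwise λ _ → M.+ᴹ-comm _ _ }
          ; isPreleftSemimodule = record
            { *ₗ-cong = λ e f → pointwise λ s → M.*ₗ-cong e (at f s)
            ; *ₗ-zeroˡ = λ _ → pointwise λ _ → M.*ₗ-zeroˡ _
            ; *ₗ-distribʳ = λ _ _ _ → pointwise λ _ → M.*ₗ-distribʳ _ _ _
            ; *ₗ-identityˡ = λ _ → pointwise λ _ → M.*ₗ-identityˡ _
            ; *ₗ-assoc = λ _ _ _ → pointwise λ _ → M.*ₗ-assoc _ _ _
            ; *ₗ-zeroʳ = λ _ → pointwise λ _ → M.*ₗ-zeroʳ _
            ; *ₗ-distribˡ = λ _ _ _ → pointwise λ _ → M.*ₗ-distribˡ _ _ _ } }

      Hom : Mod (a ⊔ m ⊔ ℓ) (a ⊔ ℓ)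
      Hom = record { isLeftModule = Hom-laws }

  -- The canonical map χ ⊗ x ↦ (γ ↦ χ(γ) x).
  module _ (S : Subgroup) {m ℓ} (M : Mod m ℓ) where
    private module M = LeftModule M
    open Homᴾ

    evaluate : Hom S ⟨R⟩ ⊗ M ⟶ Hom S M
    evaluate = ⊗-lift pure
      (λ e f → pointwise λ s → M.*ₗ-cong (_≈ʰ_.at e s) f)
      (λ χ χ′ x → pointwise λ s → M.*ₗ-distribʳ x _ _)
      (λ χ x x′ → pointwise λ s → M.*ₗ-distribˡ _ x x′)
      (λ c χ x → pointwise λ s → M.*ₗ-assoc c _ x)
      (λ c χ x → pointwise λ s → *ₗ-comm M _ c x)
      where
      pure : Homᴾ S ⟨R⟩ → M.Carrierᴹ → Homᴾ S M
      pure χ x = mkHom S M (λ s → fun χ s M.*ₗ x)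
        (λ {s} {t} e → M.*ₗ-cong (⟦⟧-cong χ {s} {t} e) M.≈ᴹ-refl)
        (λ s t → M.≈ᴹ-trans (M.*ₗ-cong (homo χ s t) M.≈ᴹ-refl) (M.*ₗ-distribʳ x _ _))
        (λ s s∈P → M.≈ᴹ-trans (M.*ₗ-cong (vanishes χ s s∈P) M.≈ᴹ-refl) (M.*ₗ-zeroˡ x))

  -- The order-lowering map v ↦ (γ ↦ (γ - 1)v).
  module _ (S : Subgroup) (V : GModule a a) (q : ℕ) where
    open GModule V

    lowering : H̄ S V (suc q) ⟶ Hom S (H̄ S V q)
    lowering = linear
      (λ (v , v∈) → mkHom S (H̄ S V q) (λ (γ , γ∈S) → Δ S V γ v , Δ-H⁰ S V (suc q) γ∈S v∈)
        (λ {s} {t} e → H̄-≈ S V q (+ᴹ-cong (▷-cong e ≈ᴹ-refl) ≈ᴹ-refl))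
        (λ (γ , γ∈S) (δ , δ∈S) → modulo (Submodule.resp (H⁰ S V (pred q))
          (≈ᴹ-sym (Δ-∙ S V γ δ v)) (Δ-H⁰ S V q γ∈S (Δ-H⁰ S V (suc q) δ∈S v∈))))
        (λ (γ , γ∈S) γ∈P → H̄-≈ S V q
          (≈ᴹ-trans (+ᴹ-cong (proj₂ v∈ γ γ∈P γ∈S) ≈ᴹ-refl) (-ᴹ‿inverseʳ v))))
      (λ {(v , _)} {(w , _)} (modulo v-w∈) → pointwise λ (γ , γ∈S) → modulo
        (Submodule.resp (H⁰ S V (pred q)) (Δ-sub γ v w) (Δ-H⁰ S V q γ∈S v-w∈)))
      (λ (v , _) (w , _) → pointwise λ (γ , _) → H̄-≈ S V q (Δ-+ S V γ v w))
      (λ x (v , _) → pointwise λ (γ , _) → H̄-≈ S V q (_⟶_.*ₗ-homo (Δₗ γ) x v))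
      where
      Δₗ : G.Carrier → mod ⟶ mod
      Δₗ γ = linear (Δ S V γ) (λ e → +ᴹ-cong (▷-cong G.refl e) (-ᴹ‿cong e)) (Δ-+ S V γ)
        (λ x v → ≈ᴹ-trans (+ᴹ-cong (▷-* γ x v) (*-neg x v)) (≈ᴹ-sym (*ₗ-distribˡ x _ _)))
        where
        *-neg : ∀ x v → -ᴹ (x *ₗ v) ≈ᴹ x *ₗ (-ᴹ v)
        *-neg x v = ≈ᴹ-trans (≈ᴹ-sym (neg≈ mod _))
          (≈ᴹ-trans (*ₗ-comm mod _ x v) (*ₗ-cong R.refl (neg≈ mod v)))
      Δ-sub : ∀ γ v w → Δ S V γ (v +ᴹ -ᴹ w) ≈ᴹ Δ S V γ v +ᴹ -ᴹ Δ S V γ w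
      Δ-sub γ = sub-homo (Δₗ γ)

  -- The data inducing maps H̄_q(T, V) → H̄_q(S, W): restriction, translation by an
  -- element of G and coefficient maps are the instances below.
  record Twist (S T : Subgroup) (V W : GModule a a) : Set a where
    private
      module V = GModule V
      module W = GModule W
      module S = Subgroup S
      module T = Subgroup T
    field
      φ       : Σ G.Carrier S.mem → Σ G.Carrier T.mem
      φ-hom   : GroupMorphisms.IsGroupHomomorphism (Group.rawGroup S.group) (Group.rawGroup T.group) φ
      φ-P     : ∀ s → P.mem (proj₁ s) → P.mem (proj₁ (φ s))
      F       : V.mod ⟶ W.mod
      twisted : ∀ s v → _⟶_.to F (proj₁ (φ s) V.▷ v) W.≈ᴹ proj₁ s W.▷ _⟶_.to F v

  module _ {S T : Subgroup} {V W : GModule a a} (t : Twist S T V W) where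
    open Twist t
    private
      module V = GModule V
      module W = GModule W
      module S = Subgroup S
      module T = Subgroup T
      module F = _⟶_ F
    open GroupRingMap R S.group T.group φ-hom

    twisted-• : ∀ s v → F.to (_•_ T V (push s) v) W.≈ᴹ _•_ S W s (F.to v)
    twisted-• 0ᵗ       v = F.0ᴹ-homo
    twisted-• (s +ᵗ t) v = W.≈ᴹ-trans (F.+ᴹ-homo _ _) (W.+ᴹ-cong (twisted-• s v) (twisted-• t v))
    twisted-• (x ·ᵗ s) v = W.≈ᴹ-trans (F.*ₗ-homo _ _) (W.*ₗ-cong R.refl (twisted-• s v))
    twisted-• (gen x)  v = twisted x v

    H⁰-mem : ∀ q {v} → Submodule.mem (H⁰ T V q) v → Submodule.mem (H⁰ S W q) (F.to v)
    H⁰-mem zero e = W.≈ᴹ-trans (F.⟦⟧-cong e) F.0ᴹ-homo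
    H⁰-mem (suc q) {v} (k , f) =
      (λ {s} i → W.≈ᴹ-trans (W.≈ᴹ-sym (twisted-• s v))
                   (W.≈ᴹ-trans (F.⟦⟧-cong (k (push-I^ i))) F.0ᴹ-homo)) ,
      (λ p p∈P p∈S → W.≈ᴹ-trans (W.≈ᴹ-sym (twisted (p , p∈S) v))
        (F.⟦⟧-cong (f _ (φ-P (p , p∈S) p∈P) (proj₂ (φ (p , p∈S))))))

    H̄₁ : ∀ q → H̄ T V q ⟶ H̄ S W q
    H̄₁ q = linear (λ (v , v∈) → F.to v , H⁰-mem q v∈)
      (λ {(v , _)} {(w , _)} (modulo e) → modulo
        (Submodule.resp (H⁰ S W (pred q)) (sub-homo F v w) (H⁰-mem (pred q) e)))
      (λ (v , _) (w , _) → H̄-≈ S W q (F.+ᴹ-homo v w))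
      (λ x (v , _) → H̄-≈ S W q (F.*ₗ-homo x v))

  module _ {S T : Subgroup} where
    private
      module S = Subgroup S
      module T = Subgroup T

    inclusion : S ⊆ T → (V : GModule a a) → Twist S T V V
    inclusion S⊆T V = record
      { φ = λ (x , x∈S) → x , S⊆T x x∈S
      ; φ-hom = mkGroupHomomorphism S.group T.group _ id (λ _ _ → G.refl)
      ; φ-P = λ _ p → p
      ; F = idₗ
      ; twisted = λ _ _ → ≈ᴹ-refl }
      where open GModule V

    restrict : ∀ {m ℓ} {M : Mod m ℓ} → S ⊆ T → Hom T M ⟶ Hom S M
    restrict {M = M} S⊆T = linear
      (λ f → let open Homᴾ f in mkHom S M (λ s → fun (i s))
        (λ {s} {t} → ⟦⟧-cong {i s} {i t}) (λ s t → ≈ᴹ-trans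
            (⟦⟧-cong {i (Group._∙_ S.group s t)} {Group._∙_ T.group (i s) (i t)} G.refl)
            (homo (i s) (i t)))
        (λ s → vanishes (i s)))
      (λ e → pointwise λ s → _≈ʰ_.at e (i s))
      (λ _ _ → pointwise λ _ → ≈ᴹ-refl) (λ _ _ → pointwise λ _ → ≈ᴹ-refl)
      where
      open LeftModule M
      i : Σ G.Carrier S.mem → Σ G.Carrier T.mem
      i (x , x∈S) = x , S⊆T x x∈S

  module _ (g : G.Carrier) (S : Subgroup) where
    private
      module S = Subgroup S
      module gS = Subgroup (conj g S)

      c : Σ G.Carrier gS.mem → Σ G.Carrier S.mem
      c (x , x∈) = x ^ g , x∈

    translate : (V : GModule a a) → Twist (conj g S) S V V
    translate V = record
      { φ = c
      ; φ-hom = mkGroupHomomorphism gS.group S.group c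
          (λ e → ^-cong e G.refl) (λ (x , _) (y , _) → ^-∙ x y g)
      ; φ-P = λ _ → P.^-closed g
      ; F = ▷ₗ g
      ; twisted = λ (x , _) v → ^-▷ x g v }
      where open GModule V

    conjugate : ∀ {m ℓ} {M : Mod m ℓ} → Hom S M ⟶ Hom (conj g S) M
    conjugate {M = M} = linear
      (λ f → let open Homᴾ f in mkHom (conj g S) M (λ s → fun (c s))
        (λ {s} {t} e → ⟦⟧-cong {c s} {c t} (^-cong e G.refl))
        (λ s@(x , _) t@(y , _) →
          ≈ᴹ-trans (⟦⟧-cong {c (Group._∙_ gS.group s t)} {Group._∙_ S.group (c s) (c t)} (^-∙ x y g))
                   (homo (c s) (c t)))
        (λ s p → vanishes (c s) (P.^-closed g p)))
      (λ e → pointwise λ s → _≈ʰ_.at e (c s))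
      (λ _ _ → pointwise λ _ → ≈ᴹ-refl) (λ _ _ → pointwise λ _ → ≈ᴹ-refl)
      where open LeftModule M

  mapCoefficients : (S : Subgroup) {V W : GModule a a} → V ⟶ᴳ W → Twist S S V W
  mapCoefficients S f = record
    { φ = id
    ; φ-hom = mkGroupHomomorphism S.group S.group id id (λ _ _ → G.refl)
    ; φ-P = λ _ p → p
    ; F = _⟶ᴳ_.linearMap f
    ; twisted = λ (x , _) v → _⟶ᴳ_.equivariant f x v }
    where module S = Subgroup S

module Hecke {a} (R : CommutativeRing a a) (G : Group a a)
             (Γ : Subgroups.Subgroup G) (P : Subgroups.ConjugationInvariantSubset G) where
  private
    module R = CommutativeRing R
    module G = Group G
    module P = Subgroups.ConjugationInvariantSubset P
  open Subgroups G
  open CongruenceSubgroup using (subgroup)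
  open _⊇_ using (inclusion)
  open Representations R G
  open HigherOrder R G P hiding (inclusion)
  private module HO = HigherOrder R G P

  Congruence : Set (lsuc a)
  Congruence = CongruenceSubgroup Γ

  _≽_ : Rel Congruence a
  _≽_ = _⊇_ Γ

  _∧_ : Congruence → Congruence → Congruence
  _∧_ = meet Γ

  meetˡ : ∀ S T → S ≽ (S ∧ T)
  meetˡ S T = contained λ _ (x∈S , _) → x∈S

  meetʳ : ∀ S T → T ≽ (S ∧ T)
  meetʳ S T = contained λ _ (_ , x∈T) → x∈T

  ≽-refl : ∀ {S} → S ≽ S
  ≽-refl = contained λ _ x∈S → x∈S

  ≽-trans : ∀ {S T U} → S ≽ T → T ≽ U → S ≽ U
  ≽-trans (contained i) (contained j) = contained λ x x∈U → i x (j x x∈U)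

  shrink-mono : ∀ g {S T} → S ≽ T → shrink Γ g S ≽ shrink Γ g T
  shrink-mono g (contained i) = contained λ x (x∈T , x^g∈T) → i x x∈T , i (x ^ g) x^g∈T

  conj⊇shrink : ∀ g S → subgroup (shrink Γ g S) ⊆ conj g (subgroup S)
  conj⊇shrink g S _ (_ , x^g∈S) = x^g∈S

  H̄-system : ℕ → GModule a a → DirectedSystem (lsuc a) a a a
  H̄-system q V = record
    { Index = Congruence
    ; base = whole Γ
    ; _≤_ = _≽_
    ; ≤-refl = ≽-refl
    ; ≤-trans = ≽-trans
    ; _∨_ = _∧_
    ; ubˡ = meetˡ
    ; ubʳ = meetʳ
    ; M = λ S → H̄ (subgroup S) V q
    ; res = res
    ; res-id = λ {S} _ _ → H̄-≈ (subgroup S) V q ≈ᴹ-refl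
    ; res-∘ = λ {_} {_} {T} _ _ _ _ → H̄-≈ (subgroup T) V q ≈ᴹ-refl }
    where
    open GModule V
    res : ∀ {S T} → S ≽ T → H̄ (subgroup S) V q ⟶ H̄ (subgroup T) V q
    res {S} {T} p = H̄₁ {subgroup T} {subgroup S} {V} {V} (HO.inclusion (inclusion p) V) q

  module _ (q : ℕ) (V : GModule a a) where
    open GModule V
    module lim = DirectLimit (H̄-system q V)

    same-vector : ∀ {x y : lim.Element} → proj₁ (proj₂ x) ≈ᴹ proj₁ (proj₂ y) → x lim.≈ y
    same-vector {S , _} {T , _} e =
      lim.common (S ∧ T) (meetˡ S T) (meetʳ S T) (H̄-≈ (subgroup (S ∧ T)) V q e)

    H̄-act : G.Carrier → SystemMap (H̄-system q V) (H̄-system q V)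
    H̄-act g = record
      { act = shrink Γ g
      ; mono = shrink-mono g
      ; at = at
      ; natural = λ {_} {T} _ _ → H̄-≈ (subgroup (shrink Γ g T)) V q ≈ᴹ-refl }
      where
      at : ∀ S → H̄ (subgroup S) V q ⟶ H̄ (subgroup (shrink Γ g S)) V q
      at S = restriction ∘ₗ translation
        where
        gS = conj g (subgroup S)
        translation : H̄ (subgroup S) V q ⟶ H̄ gS V q
        translation = H̄₁ {gS} {subgroup S} {V} {V} (translate g (subgroup S) V) q
        restriction : H̄ gS V q ⟶ H̄ (subgroup (shrink Γ g S)) V q
        restriction = H̄₁ {subgroup (shrink Γ g S)} {gS} {V} {V}
          (HO.inclusion {subgroup (shrink Γ g S)} {gS} (conj⊇shrink g S) V) q

    L : GModule (lsuc a) (lsuc a)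
    L = limᴳ (H̄-system q V) H̄-act
      (λ e _ → same-vector (▷-cong e ≈ᴹ-refl))
      (λ _ → same-vector (ε-▷ _))
      (λ g h _ → same-vector (∙-▷ g h _))

    class : (S : Congruence) → H̄ (subgroup S) V q ⟶ GModule.mod L
    class = lim.ι

  L-map : ∀ q {V W} → V ⟶ᴳ W → GModule.mod (L q V) ⟶ GModule.mod (L q W)
  L-map q {V} {W} f = lim₁ (H̄-system q V) (H̄-system q W) record
    { act = id
    ; mono = id
    ; at = at
    ; natural = λ {_} {T} _ _ → H̄-≈ (subgroup T) W q ≈ᴹ-refl }
    where
    open GModule W
    at : ∀ S → H̄ (subgroup S) V q ⟶ H̄ (subgroup S) W q
    at S = H̄₁ {subgroup S} {subgroup S} {V} {W} (mapCoefficients (subgroup S) f) q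

  Hom-system : DirectedSystem (lsuc a) a a a
  Hom-system = record
    { Index = Congruence
    ; base = whole Γ
    ; _≤_ = _≽_
    ; ≤-refl = ≽-refl
    ; ≤-trans = ≽-trans
    ; _∨_ = _∧_
    ; ubˡ = meetˡ
    ; ubʳ = meetʳ
    ; M = λ S → Hom (subgroup S) ⟨R⟩
    ; res = λ p → restrict (inclusion p)
    ; res-id = λ _ χ → pointwise λ s → Homᴾ.⟦⟧-cong χ G.refl
    ; res-∘ = λ _ _ _ χ → pointwise λ s → Homᴾ.⟦⟧-cong χ G.refl }

  module Ĥ = DirectLimit Hom-system

  same-hom : ∀ {x y : Ĥ.Element} → let open Homᴾ in
             (∀ s t → proj₁ s G.≈ proj₁ t → fun (proj₂ x) s R.≈ fun (proj₂ y) t) → x Ĥ.≈ y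
  same-hom {S , _} {T , _} e =
    Ĥ.common (S ∧ T) (meetˡ S T) (meetʳ S T) (pointwise λ _ → e _ _ G.refl)

  Hom-act : G.Carrier → SystemMap Hom-system Hom-system
  Hom-act g = record
    { act = shrink Γ g
    ; mono = shrink-mono g
    ; at = at
    ; natural = natural }
    where
    at : ∀ S → Hom (subgroup S) ⟨R⟩ ⟶ Hom (subgroup (shrink Γ g S)) ⟨R⟩
    at S = restrict (conj⊇shrink g S) ∘ₗ conjugate g (subgroup S)
    natural : ∀ {S T} (p : S ≽ T) χ →
      _≈ʰ_ (subgroup (shrink Γ g T)) ⟨R⟩
        (_⟶_.to (at T) (_⟶_.to (restrict (inclusion p)) χ))
        (_⟶_.to (restrict (inclusion (shrink-mono g p))) (_⟶_.to (at S) χ))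
    natural p χ = pointwise λ _ → Homᴾ.⟦⟧-cong χ G.refl

  Ĥom : GModule (lsuc a) (lsuc a)
  Ĥom = limᴳ Hom-system Hom-act
    (λ e (_ , χ) → same-hom λ _ _ e′ → Homᴾ.⟦⟧-cong χ (^-cong e′ e))
    (λ (_ , χ) → same-hom λ (s , _) _ e → Homᴾ.⟦⟧-cong χ (G.trans (^-ε s) e))
    (λ g h (_ , χ) → same-hom λ (s , _) _ e → Homᴾ.⟦⟧-cong χ
      (G.trans (^-^ s g h) (^-cong (^-cong e G.refl) G.refl)))

  classᴴ : (S : Congruence) → Hom (subgroup S) ⟨R⟩ ⟶ GModule.mod Ĥom
  classᴴ = Ĥ.ι

  module _ {m ℓ} (V : GModule m ℓ) where
    open GModule V

    Smooth : Pred Carrierᴹ (lsuc a ⊔ ℓ)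
    Smooth v = Σ[ S ∈ Congruence ] (∀ g → g ∈ subgroup S → g ▷ v ≈ᴹ v)

    IsSmooth : Set (lsuc a ⊔ m ⊔ ℓ)
    IsSmooth = ∀ v → Smooth v

    smoothElements : Submodule mod (lsuc a ⊔ ℓ)
    smoothElements = record
      { mem = Smooth
      ; resp = λ e (S , f) → S , λ g g∈S →
          ≈ᴹ-trans (▷-cong G.refl (≈ᴹ-sym e)) (≈ᴹ-trans (f g g∈S) e)
      ; 0-closed = whole Γ , λ g _ → _⟶_.0ᴹ-homo (▷ₗ g)
      ; +-closed = λ (S , f) (T , f′) → S ∧ T , λ g (g∈S , g∈T) →
          ≈ᴹ-trans (▷-+ g _ _) (+ᴹ-cong (f g g∈S) (f′ g g∈T))
      ; *-closed = λ x (S , f) → S , λ g g∈S →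
          ≈ᴹ-trans (▷-* g x _) (*ₗ-cong R.refl (f g g∈S)) }

    ▷-smooth : ∀ g {v} → Smooth v → Smooth (g ▷ v)
    ▷-smooth g {v} (S , f) = shrink Γ g S , λ x (_ , x^g∈S) →
      ≈ᴹ-trans (≈ᴹ-sym (^-▷ x g v)) (▷-cong G.refl (f (x ^ g) x^g∈S))

    infix 9 _^∞
    _^∞ : GModule (lsuc a ⊔ m ⊔ ℓ) (lsuc a ⊔ ℓ)
    _^∞ = record
      { mod = submodule smoothElements
      ; _▷_ = λ g (v , s) → g ▷ v , ▷-smooth g s
      ; ▷-cong = λ e (lift f) → lift (▷-cong e f)
      ; ▷-+ = λ g _ _ → lift (▷-+ g _ _)
      ; ▷-* = λ g x _ → lift (▷-* g x _)
      ; ε-▷ = λ _ → lift (ε-▷ _)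
      ; ∙-▷ = λ g h _ → lift (∙-▷ g h _) }

  _^∞₁ : ∀ {V W : GModule a a} → V ⟶ᴳ W → GModule.mod (V ^∞) ⟶ GModule.mod (W ^∞)
  _^∞₁ {V} {W} f = linear
    (λ (v , S , e) → to v , S , λ g g∈S → W.≈ᴹ-trans (W.≈ᴹ-sym (equivariant g v)) (⟦⟧-cong (e g g∈S)))
    (λ (lift e) → lift (⟦⟧-cong e)) (λ _ _ → lift (+ᴹ-homo _ _)) (λ x _ → lift (*ₗ-homo x _))
    where
    module W = GModule W
    open _⟶ᴳ_ f

  Target : ℕ → GModule a a → GModule (lsuc a) (lsuc a)
  Target n V = Ĥom ^⊗ n ⊗ (V ^∞)

  Target₁ : ∀ n {V W} → V ⟶ᴳ W → GModule.mod (Target n V) ⟶ GModule.mod (Target n W)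
  Target₁ zero    f = f ^∞₁
  Target₁ (suc n) {V} {W} f =
    _⊗₁_ {M = GModule.mod Ĥom} {N = GModule.mod (Target n V)}
         {M′ = GModule.mod Ĥom} {N′ = GModule.mod (Target n W)} idₗ (Target₁ n f)

  -- The canonical map Hom(S, R) ⊗ H̄_q → Hom(S, H̄_q) is an isomorphism, and
  -- lowering⊗ is the order-lowering map transported along its inverse.
  record TensorLowering (S : Subgroup) (V : GModule a a) (q : ℕ) : Set a where
    open _⟶_
    open LeftModule (Hom S ⟨R⟩ ⊗ H̄ S V q) using () renaming (_≈ᴹ_ to _≈⊗_)
    open LeftModule (Hom S (H̄ S V q)) using () renaming (_≈ᴹ_ to _≈ᴴ_)
    field
      canonical : Bijective _≈⊗_ _≈ᴴ_ (to (evaluate S (H̄ S V q)))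
      lowering⊗ : H̄ S V (suc q) ⟶ Hom S ⟨R⟩ ⊗ H̄ S V q
      lifts     : ∀ v → to (evaluate S (H̄ S V q)) (to lowering⊗ v) ≈ᴴ to (lowering S V q) v

  -- Φ₀ : L₁ → V^∞ sends the class of v ∈ V^S to v, and Φₙ₊₁ is the map induced by
  -- H̄_{n+2}(S) → Hom(S, R) ⊗ H̄_{n+1}(S) → Ĥom ⊗ L_{n+1} → Ĥom ⊗ (Ĥom^{⊗n} ⊗ V^∞).
  IteratedLowering : ∀ n V → L (suc n) V ⟶ᴳ Target n V → Set (lsuc a)
  IteratedLowering zero V Φ =
    ∀ S (v : LeftModule.Carrierᴹ (H̄ (subgroup S) V 1)) →
    proj₁ (to Φ (S , v)) ≈ᴹ proj₁ v
    where
    open GModule V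
    open _⟶ᴳ_
  IteratedLowering (suc n) V Φ =
    Σ[ Φ′ ∈ L (suc n) V ⟶ᴳ Target n V ] IteratedLowering n V Φ′ ×
    (∀ S → Σ[ λ⊗ ∈ TensorLowering (subgroup S) V (suc n) ]
           ∀ v → GModule._≈ᴹ_ (Target (suc n) V)
                   (to Φ (S , v))
                   (_⟶_.to (classᴴ S ⊗₁ (linearMap Φ′ ∘ₗ class (suc n) V S))
                           (_⟶_.to (TensorLowering.lowering⊗ λ⊗) v)))
    where open _⟶ᴳ_

  IsInjective : ∀ n V → L (suc n) V ⟶ᴳ Target n V → Set (lsuc a)
  IsInjective n V Φ =
    Injective (GModule._≈ᴹ_ (L (suc n) V)) (GModule._≈ᴹ_ (Target n V)) (_⟶ᴳ_.to Φ)

  IsNatural : ∀ n → (∀ V → L (suc n) V ⟶ᴳ Target n V) → Set (lsuc a)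
  IsNatural n Φ = ∀ {V W} (f : V ⟶ᴳ W) x →
    GModule._≈ᴹ_ (Target n W)
      (to (Φ W) (_⟶_.to (L-map (suc n) f) x))
      (_⟶_.to (Target₁ n f) (to (Φ V) x))
    where open _⟶ᴳ_

{-# OPTIONS --safe #-}

module Submission where

-- H̄_{q+1}(S) embeds into Hom(S, H̄_q(S)) by v ↦ (γ ↦ (γ − 1)v). Every congruence subgroup S
-- is finitely generated (Schreier: it has finite index in Γ), so S^ab ⊗ R has a finite basis,
-- consisting of classes sᵢ of generators with dual characters χᵢ, and f ↦ Σ χᵢ ⊗ f(sᵢ)
-- inverts Hom(S, R) ⊗ M → Hom(S, M). This inverse is natural, so the embeddings above induce
-- equivariant maps L_{q+1} → Ĥom ⊗ L_q on the limits, and Φ is obtained by iterating them.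
--
-- Injectivity is by induction on q and uses neither flatness nor that ⊗ commutes with limits:
-- χ ⊗ y ↦ (γ ↦ χ(γ)y) maps Ĥom ⊗ N into lim Hom(S, N). If Φ kills the class of v ∈ H̄_{q+1}(S),
-- it follows that Φ kills the class of (γ − 1)v in L_q for all γ in some congruence subgroup U,
-- so these classes vanish. As U is finitely generated, they vanish on a common T ⊆ U, and then
-- v lies in H⁰_q(T).

open import Defs
open import Level using (_⊔_) renaming (suc to lsuc)
open import Algebra.Bundles using (Group; CommutativeRing)
open import Algebra.Module.Bundles using (LeftModule)
open import Algebra.Morphism.Structures using (module GroupMorphisms)
import Algebra.Properties.AbelianGroup as AbelianGroupProperties
import Algebra.Properties.CommutativeMonoid.Sum as Summation
import Algebra.Properties.Group as GroupProperties
import Algebra.Properties.Ring as RingProperties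
open import Axiom.ExcludedMiddle using (ExcludedMiddle)
open import Data.Fin.Base using (Fin; zero; suc; punchIn; combine)
open import Data.Fin.Properties using (+↔⊎; *↔×; combine-injective)
open import Data.List.Base using (List; []; _∷_)
open import Data.List.Relation.Unary.All using (All; []; _∷_)
import Data.Nat.Base as ℕ
open import Data.Nat.Base using (ℕ; zero; suc; pred)
open import Data.Product.Base using (Σ; Σ-syntax; ∃-syntax; _×_; _,_; proj₁; proj₂)
open import Data.Sum.Base using (_⊎_; inj₁; inj₂)
open import Data.Sum.Function.Propositional using (_⊎-↔_)
open import Data.Vec.Functional using (Vector; removeAt)
open import Function.Base using (id; _∘_)
open import Function.Bundles using (Inverse; _↔_)
open import Function.Construct.Composition using (_↔-∘_)
open import Function.Construct.Identity using (↔-id)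
open import Relation.Binary.Bundles using (Setoid)
open import Relation.Binary.Core using (Rel)
open import Relation.Binary.PropositionalEquality.Core as ≡ using (_≡_)
import Relation.Binary.Reasoning.Setoid as SetoidReasoning
open import Relation.Nullary using (¬_; yes; no)
open import Relation.Nullary.Decidable using (decidable-stable)
open import Relation.Nullary.Negation using (contradiction)

-- Linear combinations and dual bases

module LinearCombinations {r} (R : CommutativeRing r r) {m ℓ} (A : Modules.Mod R m ℓ) where
  private module R = CommutativeRing R
  open Modules R
  open LeftModule A
  open Summation +ᴹ-commutativeMonoid using (sum; ∑-distrib-+; sum-remove; sum-cong-≋)

  infix 8 _∙_
  _∙_ : ∀ {n} → Vector R.Carrier n → Vector Carrierᴹ n → Carrierᴹ
  c ∙ b = sum (λ i → c i *ₗ b i)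

  Spans : ∀ {n} → Vector Carrierᴹ n → Set (r ⊔ m ⊔ ℓ)
  Spans b = ∀ x → ∃[ c ] x ≈ᴹ c ∙ b

  ∙-cong : ∀ {n} {c d : Vector R.Carrier n} {b} → (∀ i → c i R.≈ d i) → c ∙ b ≈ᴹ d ∙ b
  ∙-cong e = sum-cong-≋ (λ i → *ₗ-cong (e i) ≈ᴹ-refl)

  ∙-+ : ∀ {n} (c d : Vector R.Carrier n) b → (λ i → c i R.+ d i) ∙ b ≈ᴹ c ∙ b +ᴹ d ∙ b
  ∙-+ c d b = ≈ᴹ-trans (sum-cong-≋ (λ i → *ₗ-distribʳ (b i) (c i) (d i)))
                       (∑-distrib-+ (λ i → c i *ₗ b i) (λ i → d i *ₗ b i))

  *ₗ-sum : ∀ {n} s (x : Vector Carrierᴹ n) → s *ₗ sum x ≈ᴹ sum (λ i → s *ₗ x i)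
  *ₗ-sum {zero}  s x = *ₗ-zeroʳ s
  *ₗ-sum {suc n} s x = ≈ᴹ-trans (*ₗ-distribˡ s _ _) (+ᴹ-congˡ (*ₗ-sum s (x ∘ suc)))

  ∙-* : ∀ {n} s (c : Vector R.Carrier n) b → (λ i → s R.* c i) ∙ b ≈ᴹ s *ₗ c ∙ b
  ∙-* s c b = ≈ᴹ-trans (sum-cong-≋ (λ i → *ₗ-assoc s (c i) (b i)))
                       (≈ᴹ-sym (*ₗ-sum s (λ i → c i *ₗ b i)))

  ∙-0 : ∀ {n} b → (λ (_ : Fin n) → R.0#) ∙ b ≈ᴹ 0ᴹ
  ∙-0 b = ≈ᴹ-trans (∙-cong {d = λ _ → R.0# R.* R.0#} {b} (λ _ → R.sym (R.zeroˡ R.0#)))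
            (≈ᴹ-trans (∙-* R.0# (λ _ → R.0#) b) (*ₗ-zeroˡ _))

  δ : ∀ {n} → Fin n → Vector R.Carrier n
  δ zero    zero    = R.1#
  δ zero    (suc _) = R.0#
  δ (suc i) zero    = R.0#
  δ (suc i) (suc j) = δ i j

  δ-∙ : ∀ {n} i (b : Vector Carrierᴹ n) → δ i ∙ b ≈ᴹ b i
  δ-∙ zero    b = ≈ᴹ-trans (+ᴹ-cong (*ₗ-identityˡ _) (∙-0 (b ∘ suc))) (+ᴹ-identityʳ _)
  δ-∙ (suc i) b = ≈ᴹ-trans (+ᴹ-cong (*ₗ-zeroˡ _) (δ-∙ i (b ∘ suc))) (+ᴹ-identityˡ _)

  remove : ∀ {n} i (c : Vector R.Carrier (suc n)) b → c i R.≈ R.0# →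
           c ∙ b ≈ᴹ removeAt c i ∙ removeAt b i
  remove i c b e = ≈ᴹ-trans (sum-remove {i = i} (λ i → c i *ₗ b i))
    (≈ᴹ-trans (+ᴹ-congʳ (≈ᴹ-trans (*ₗ-cong e ≈ᴹ-refl) (*ₗ-zeroˡ _))) (+ᴹ-identityˡ _))

  -- A finite coordinate system whose vectors are chosen from `b` itself. The choice is recorded by
  -- `select` because later `b` consists of classes of group elements, at which homomorphisms can be
  -- evaluated.
  record DualBasis {n} (b : Vector Carrierᴹ n) : Set (r ⊔ m ⊔ ℓ) where
    field
      {dimension} : ℕ
      select      : Fin dimension → Fin n
      coordinate  : Fin dimension → A ⟶ ⟨R⟩
      expansion   : ∀ x → x ≈ᴹ (λ i → _⟶_.to (coordinate i) x) ∙ (b ∘ select)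

-- The form in which linear algebra over a field enters the modules below, which are stated over a
-- commutative ring.
HasDualBases : ∀ {r} → CommutativeRing r r → Set (lsuc r)
HasDualBases {r} R = (A : Modules.Mod R r r) {n : ℕ} (b : Vector (LeftModule.Carrierᴹ A) n) →
  LinearCombinations.Spans R A b → LinearCombinations.DualBasis R A b

-- Existence of dual bases over a field

module VectorSpaces {a} (em : ∀ {ℓ} → ExcludedMiddle ℓ) (F : Field a)
                    {m ℓ} (A : Modules.Mod (Field.commutativeRing F) m ℓ) where
  private module F = Field F
  open Modules F.commutativeRing
  open LinearCombinations F.commutativeRing A
  open LeftModule A
  open RingProperties F.ring using (-‿distribˡ-*; -1*x≈-x)
  open AbelianGroupProperties F.+-abelianGroup using (x∙y⁻¹≈ε⇒x≈y)

  NontrivialRelation : ∀ {n} → Vector Carrierᴹ n → Set _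
  NontrivialRelation {n} b = Σ[ c ∈ Vector F.Carrier n ] c ∙ b ≈ᴹ 0ᴹ × ∃[ i ] ¬ c i F.≈ F.0#

  removeDependent : ∀ {n} (b : Vector Carrierᴹ (suc n)) (c : Vector F.Carrier (suc n)) →
                    c ∙ b ≈ᴹ 0ᴹ → ∀ i → ¬ c i F.≈ F.0# → Spans b → Spans (removeAt b i)
  removeDependent b c c∙b≈0 i cᵢ≉0 span x with span x | F.inverse (c i) cᵢ≉0
  ... | d , x≈d∙b | s , cᵢs≈1 = removeAt d′ i , (begin
    x                                        ≈⟨ x≈d∙b ⟩
    d ∙ b                                    ≈⟨ +ᴹ-identityʳ _ ⟨
    d ∙ b +ᴹ 0ᴹ                              ≈⟨ +ᴹ-congˡ (*ₗ-zeroʳ u) ⟨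
    d ∙ b +ᴹ u *ₗ 0ᴹ                         ≈⟨ +ᴹ-congˡ (*ₗ-cong F.refl c∙b≈0) ⟨
    d ∙ b +ᴹ u *ₗ c ∙ b                      ≈⟨ +ᴹ-congˡ (∙-* u c b) ⟨
    d ∙ b +ᴹ (λ j → u F.* c j) ∙ b           ≈⟨ ∙-+ d (λ j → u F.* c j) b ⟨
    d′ ∙ b                                   ≈⟨ remove i d′ b d′ᵢ≈0 ⟩
    removeAt d′ i ∙ removeAt b i             ∎)
    where
    open SetoidReasoning ≈ᴹ-setoid
    -- The multiple -dᵢ/cᵢ of the relation `c`, which cancels the i-th coefficient of `d`.
    u = F.- (d i F.* s)
    d′ : Vector F.Carrier _
    d′ j = d j F.+ u F.* c j
    d′ᵢ≈0 : d′ i F.≈ F.0#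
    d′ᵢ≈0 = F.trans (F.+-congˡ (F.trans (F.sym (-‿distribˡ-* _ _)) (F.-‿cong (F.trans (F.*-assoc _ _ _)
      (F.trans (F.*-congˡ (F.trans (F.*-comm s _) cᵢs≈1)) (F.*-identityʳ _))))))
      (F.-‿inverseʳ (d i))

  -- The difference of two expansions is a relation, and a nonzero entry would make it nontrivial.
  -- Excluded middle turns the resulting double negation into equality.
  coordinatesUnique : ∀ {n} (b : Vector Carrierᴹ n) → ¬ NontrivialRelation b →
                      ∀ c d → c ∙ b ≈ᴹ d ∙ b → ∀ i → c i F.≈ d i
  coordinatesUnique b independent c d e i = x∙y⁻¹≈ε⇒x≈y _ _ (decidable-stable em λ ≉0 →
    independent ((λ j → c j F.+ F.- d j) , relation , i , ≉0))
    where
    relation : (λ j → c j F.+ F.- d j) ∙ b ≈ᴹ 0ᴹ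
    relation = begin
      (λ j → c j F.+ F.- d j) ∙ b              ≈⟨ ∙-+ c (λ j → F.- d j) b ⟩
      c ∙ b +ᴹ (λ j → F.- d j) ∙ b             ≈⟨ +ᴹ-cong e (∙-cong (λ j → F.sym (-1*x≈-x (d j)))) ⟩
      d ∙ b +ᴹ (λ j → F.- F.1# F.* d j) ∙ b    ≈⟨ +ᴹ-congˡ (∙-* _ d b) ⟩
      d ∙ b +ᴹ F.- F.1# *ₗ d ∙ b               ≈⟨ +ᴹ-congˡ (neg≈ A _) ⟩
      d ∙ b +ᴹ -ᴹ (d ∙ b)                      ≈⟨ -ᴹ‿inverseʳ _ ⟩
      0ᴹ                                       ∎
      where open SetoidReasoning ≈ᴹ-setoid

  -- As long as there is a nontrivial relation, a vector occurring in it is discarded. Once there is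
  -- none, coordinates are unique and therefore linear.
  dualBasis : ∀ {n} (b : Vector Carrierᴹ n) → Spans b → DualBasis b
  dualBasis b span with em {P = NontrivialRelation b}
  dualBasis {suc _} b span | yes (c , c∙b≈0 , i , cᵢ≉0) =
    record { select = punchIn i ∘ D.select ; coordinate = D.coordinate ; expansion = D.expansion }
    where module D = DualBasis (dualBasis (removeAt b i) (removeDependent b c c∙b≈0 i cᵢ≉0 span))
  dualBasis {n} b span | no independent = record
    { select = id
    ; coordinate = λ i → linear (λ x → coordinates x i)
        (λ {x} {y} x≈y → unique _ _ (≈ᴹ-trans (≈ᴹ-sym (expand x)) (≈ᴹ-trans x≈y (expand y))) i)
        (λ x y → unique _ _ (≈ᴹ-trans (≈ᴹ-sym (expand _)) (≈ᴹ-trans (+ᴹ-cong (expand x) (expand y))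
          (≈ᴹ-sym (∙-+ (coordinates x) (coordinates y) b)))) i)
        (λ s x → unique _ _ (≈ᴹ-trans (≈ᴹ-sym (expand _)) (≈ᴹ-trans (*ₗ-cong F.refl (expand x))
          (≈ᴹ-sym (∙-* s (coordinates x) b)))) i)
    ; expansion = expand }
    where
    unique : ∀ c d → c ∙ b ≈ᴹ d ∙ b → ∀ i → c i F.≈ d i
    unique = coordinatesUnique b independent
    coordinates : Carrierᴹ → Vector F.Carrier n
    coordinates x = proj₁ (span x)
    expand : ∀ x → x ≈ᴹ coordinates x ∙ b
    expand x = proj₂ (span x)

-- Finite index and finite generation of congruence subgroups

module CongruenceSubgroups {a} (em : ∀ {ℓ} → ExcludedMiddle ℓ) (G : Group a a) where
  open Group G
  open Subgroups G
  open GroupProperties G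
  private module G = Group G

  -- Encoded as a finite colouring of Γ whose colour classes each lie in a single left coset of S.
  record FiniteIndex (Γ S : Subgroup) : Set a where
    field
      {size}   : ℕ
      colour   : ∀ x → x ∈ Γ → Fin size
      separate : ∀ x y (x∈Γ : x ∈ Γ) (y∈Γ : y ∈ Γ) → colour x x∈Γ ≡ colour y y∈Γ → x ⁻¹ ∙ y ∈ S

  -- Elements of Γ suffice in the inclusion because x⁻¹y is in Γ. This matches the field `contains`
  -- of a congruence subgroup.
  FiniteIndex-⊆ : ∀ {Γ S T} → (∀ x → x ∈ Γ → x ∈ S → x ∈ T) → FiniteIndex Γ S → FiniteIndex Γ T
  FiniteIndex-⊆ {Γ} S⊆T finite = record
    { colour = colour
    ; separate = λ x y x∈Γ y∈Γ e →
        S⊆T _ (Subgroup.∙-closed Γ (Subgroup.⁻¹-closed Γ x∈Γ) y∈Γ) (separate x y x∈Γ y∈Γ e) }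
    where open FiniteIndex finite

  FiniteIndex-∩ : ∀ {Γ S T} → FiniteIndex Γ S → FiniteIndex Γ T → FiniteIndex Γ (S ∩ T)
  FiniteIndex-∩ s t = record
    { colour = λ x x∈Γ → combine (S.colour x x∈Γ) (T.colour x x∈Γ)
    ; separate = λ x y x∈Γ y∈Γ e → let e₁ , e₂ = combine-injective _ _ _ _ e in
        S.separate x y x∈Γ y∈Γ e₁ , T.separate x y x∈Γ y∈Γ e₂ }
    where
    module S = FiniteIndex s
    module T = FiniteIndex t

  FiniteIndex-refl : ∀ Γ → FiniteIndex Γ Γ
  FiniteIndex-refl Γ = record
    { size = 1
    ; colour = λ _ _ → zero
    ; separate = λ _ _ x∈Γ y∈Γ _ → Subgroup.∙-closed Γ (Subgroup.⁻¹-closed Γ x∈Γ) y∈Γ }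

  -- γ ↦ γgΓ identifies Γ/(Γ ∩ gΓg⁻¹) with ΓgΓ/Γ.
  FiniteIndex-conj : ∀ {Γ} → IsHeckePair Γ → ∀ g → FiniteIndex Γ (conj g Γ)
  FiniteIndex-conj {Γ} hecke g = record
    { colour = λ x x∈Γ → I.from (coset x x∈Γ)
    -- Equal colours give (xg)⁻¹(yg) ∈ Γ, which is rewritten as g⁻¹(x⁻¹y)g ∈ Γ.
    ; separate = λ x y x∈Γ y∈Γ e → Γ.resp
        (trans (∙-congʳ (⁻¹-anti-homo-∙ x g)) (trans (sym (assoc _ _ _)) (∙-congʳ (assoc _ _ _))))
        (C.trans {coset x x∈Γ} {I.to (I.from (coset x x∈Γ))} {coset y y∈Γ}
          (C.sym {I.to (I.from (coset x x∈Γ))} {coset x x∈Γ} (I.strictlyInverseˡ (coset x x∈Γ)))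
          (I.inverseˡ {coset y y∈Γ} e)) }
    where
    module Γ = Subgroup Γ
    module C = Setoid (cosets Γ g)
    module I = Inverse (proj₂ (hecke g))
    coset : ∀ x → x ∈ Γ → C.Carrier
    coset x x∈Γ = x ∙ g , x , ε , x∈Γ , Γ.ε-closed , sym (identityʳ _)

  -- Within Γ, the subgroup contains a finite intersection of conjugates gΓg⁻¹. Each has finite
  -- index by the Hecke condition, and pairs of colours handle intersections. The empty intersection
  -- is taken to be Γ.
  FiniteIndex-congruence : ∀ {Γ} → IsHeckePair Γ → (S : CongruenceSubgroup Γ) →
                           FiniteIndex Γ (CongruenceSubgroup.subgroup S)
  FiniteIndex-congruence {Γ} hecke S =
    FiniteIndex-⊆ {S = intersection gs} (λ x x∈Γ x∈ → contains x x∈Γ (∈-intersection gs x∈)) (go gs)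
    where
    open CongruenceSubgroup S
    intersection : List Carrier → Subgroup
    intersection []       = Γ
    intersection (g ∷ gs) = conj g Γ ∩ intersection gs
    ∈-intersection : ∀ gs {x} → x ∈ intersection gs → All (λ g → x ∈ conj g Γ) gs
    ∈-intersection []       _          = []
    ∈-intersection (g ∷ gs) (x∈ , x∈′) = x∈ ∷ ∈-intersection gs x∈′
    go : ∀ gs → FiniteIndex Γ (intersection gs)
    go []       = FiniteIndex-refl Γ
    go (g ∷ gs) = FiniteIndex-∩ (FiniteIndex-conj hecke g) (go gs)

  -- Representatives need not be distinct modulo S.
  record Representatives (Γ S : Subgroup) : Set a where
    field
      {number} : ℕ
      rep      : Fin number → Carrier
      rep∈     : ∀ i → rep i ∈ Γ
      covers   : ∀ x → x ∈ Γ → ∃[ i ] rep i ⁻¹ ∙ x ∈ S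

  representatives : ∀ {Γ S} → FiniteIndex Γ S → Representatives Γ S
  representatives {Γ} {S} finite = record
    { rep = λ i → proj₁ (choose i)
    ; rep∈ = λ i → proj₁ (proj₂ (choose i))
    ; covers = λ x x∈Γ → colour x x∈Γ , proj₂ (proj₂ (choose (colour x x∈Γ))) x x∈Γ ≡.refl }
    where
    open FiniteIndex finite
    choose : ∀ i → Σ[ r ∈ Carrier ] r ∈ Γ × (∀ x (x∈Γ : x ∈ Γ) → colour x x∈Γ ≡ i → r ⁻¹ ∙ x ∈ S)
    choose i with em {P = Σ[ r ∈ Carrier ] Σ[ r∈Γ ∈ r ∈ Γ ] colour r r∈Γ ≡ i}
    ... | yes (r , r∈Γ , e) = r , r∈Γ , λ x x∈Γ e′ → separate r x r∈Γ x∈Γ (≡.trans e (≡.sym e′))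
    -- A colour that does not occur gets ε as a default; its condition is vacuous.
    ... | no none = ε , Subgroup.ε-closed Γ , λ x x∈Γ e → contradiction (x , x∈Γ , e) none

  -- Schreier's generators: rₖ⁻¹ s rᵢ for s a generator or the inverse of one, together with
  -- those representatives that lie in S.
  module Schreier {Γ S : Subgroup} (S⊆Γ : S ⊆ Γ) (transversal : Representatives Γ S)
                  {n} (s : Fin n → Carrier) (s∈Γ : ∀ j → s j ∈ Γ)
                  (generate : ∀ T → (∀ j → s j ∈ T) → Γ ⊆ T) where
    private
      module Γ = Subgroup Γ
      module S = Subgroup S
    open Representatives transversal

    Generator : Set
    Generator = Fin number ⊎ (Fin n × Fin number ⊎ Fin n × Fin number)

    stepIndex : ∀ {γ} → γ ∈ Γ → Fin number → Fin number
    stepIndex γ∈Γ i = proj₁ (covers _ (Γ.∙-closed γ∈Γ (rep∈ i)))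

    step : ∀ {γ} → γ ∈ Γ → Fin number → Carrier
    step {γ} γ∈Γ i = rep (stepIndex γ∈Γ i) ⁻¹ ∙ (γ ∙ rep i)

    representative : ∀ i → Σ[ x ∈ Carrier ] x ∈ S × (rep i ∈ S → x ≡ rep i)
    representative i with em {P = rep i ∈ S}
    ... | yes r∈S = rep i , r∈S , λ _ → ≡.refl
    -- A representative outside S is replaced by the harmless generator ε, so that the generators
    -- stay indexed by a finite type without deciding membership in the index.
    ... | no r∉S = ε , S.ε-closed , λ r∈S → contradiction r∈S r∉S

    generator : Generator → Σ[ x ∈ Carrier ] x ∈ S
    generator (inj₁ i) = proj₁ (representative i) , proj₁ (proj₂ (representative i))
    generator (inj₂ (inj₁ (j , i))) = step (s∈Γ j) i , proj₂ (covers _ _)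
    generator (inj₂ (inj₂ (j , i))) = step (Γ.⁻¹-closed (s∈Γ j)) i , proj₂ (covers _ _)

    module _ (T : Subgroup) (generator∈T : ∀ u → proj₁ (generator u) ∈ T) where
      private
        module T = Subgroup T
        U = S ∩ T
        module U = Subgroup U

      -- Left multiplication by γ carries every coset rᵢU to some rⱼU. Membership in S is tracked
      -- along with membership in T because `S⊆T` must also place rⱼ in S.
      Steps : Carrier → Set a
      Steps γ = ∀ i → ∃[ j ] rep j ⁻¹ ∙ (γ ∙ rep i) ∈ U

      Steps-resp : ∀ {γ δ} → γ ≈ δ → Steps γ → Steps δ
      Steps-resp e steps i = proj₁ (steps i) , U.resp (∙-congˡ (∙-congʳ e)) (proj₂ (steps i))

      Steps-∙ : ∀ {γ δ} → Steps γ → Steps δ → Steps (γ ∙ δ)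
      Steps-∙ {γ} {δ} p q i = let j , δ∈ = q i ; k , γ∈ = p j in k , U.resp (begin
        rep k ⁻¹ ∙ (γ ∙ rep j) ∙ (rep j ⁻¹ ∙ (δ ∙ rep i))   ≈⟨ assoc _ _ _ ⟩
        rep k ⁻¹ ∙ (γ ∙ rep j ∙ (rep j ⁻¹ ∙ (δ ∙ rep i)))   ≈⟨ ∙-congˡ (assoc _ _ _) ⟩
        rep k ⁻¹ ∙ (γ ∙ (rep j ∙ (rep j ⁻¹ ∙ (δ ∙ rep i)))) ≈⟨ ∙-congˡ (∙-congˡ (\\-leftDividesˡ _ _)) ⟩
        rep k ⁻¹ ∙ (γ ∙ (δ ∙ rep i))                        ≈⟨ ∙-congˡ (assoc _ _ _) ⟨
        rep k ⁻¹ ∙ (γ ∙ δ ∙ rep i)                          ∎) (U.∙-closed γ∈ δ∈)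
        where open SetoidReasoning G.setoid

      Steps-ε : Steps ε
      Steps-ε i = i , U.resp (sym (trans (∙-congˡ (identityˡ _)) (inverseˡ _))) U.ε-closed

      -- Closure under inverses is built in by demanding `Steps` of γ⁻¹ as well. This is why the
      -- steps of the inverses of the `s j` are among the generators.
      stepping : Subgroup
      stepping = record
        { mem = λ γ → Steps γ × Steps (γ ⁻¹)
        ; resp = λ e (p , q) → Steps-resp e p , Steps-resp (⁻¹-cong e) q
        ; ε-closed = Steps-ε , Steps-resp (sym ε⁻¹≈ε) Steps-ε
        ; ∙-closed = λ (p , q) (p′ , q′) →
            Steps-∙ p p′ , Steps-resp (sym (⁻¹-anti-homo-∙ _ _)) (Steps-∙ q′ q)
        ; ⁻¹-closed = λ (p , q) → q , Steps-resp (sym (⁻¹-involutive _)) p }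

      Γ⊆stepping : Γ ⊆ stepping
      Γ⊆stepping = generate stepping λ j →
        (λ i → _ , proj₂ (generator (inj₂ (inj₁ (j , i)))) , generator∈T (inj₂ (inj₁ (j , i)))) ,
        (λ i → _ , proj₂ (generator (inj₂ (inj₂ (j , i)))) , generator∈T (inj₂ (inj₂ (j , i))))

      rep∈T : ∀ i → rep i ∈ S → rep i ∈ T
      rep∈T i r∈S = ≡.subst (_∈ T) (proj₂ (proj₂ (representative i)) r∈S) (generator∈T (inj₁ i))

      -- Take rᵢ in the trivial coset, so rᵢ ∈ U. From γrᵢ ∈ rⱼU follows rⱼ⁻¹γ ∈ U, hence rⱼ ∈ S.
      -- Such representatives are generators, so rⱼ ∈ T and γ = rⱼ(rⱼ⁻¹γ) ∈ T.
      S⊆T : S ⊆ T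
      S⊆T γ γ∈S = T.resp (\\-leftDividesˡ (rep j) γ) (T.∙-closed (rep∈T j rⱼ∈S) (proj₂ rⱼ⁻¹γ∈U))
        where
        i = proj₁ (covers ε Γ.ε-closed)
        rᵢ∈S : rep i ∈ S
        rᵢ∈S = S.resp (trans (⁻¹-cong (identityʳ _)) (⁻¹-involutive _))
          (S.⁻¹-closed (proj₂ (covers ε Γ.ε-closed)))
        step-γ = proj₁ (Γ⊆stepping γ (S⊆Γ γ γ∈S)) i
        j = proj₁ step-γ
        rⱼ⁻¹γ∈U : rep j ⁻¹ ∙ γ ∈ U
        rⱼ⁻¹γ∈U = U.resp (trans (∙-congʳ (sym (assoc _ _ _))) (//-rightDividesʳ (rep i) _))
          (U.∙-closed (proj₂ step-γ) (U.⁻¹-closed (rᵢ∈S , rep∈T i rᵢ∈S)))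
        rⱼ∈S : rep j ∈ S
        rⱼ∈S = S.resp (trans (∙-congˡ (trans (⁻¹-anti-homo-∙ _ _) (∙-congˡ (⁻¹-involutive _))))
                             (\\-leftDividesˡ γ (rep j)))
          (S.∙-closed γ∈S (S.⁻¹-closed (proj₁ rⱼ⁻¹γ∈U)))

    finitelyGenerated : FinitelyGenerated S
    finitelyGenerated = _ , proj₁ ∘ generator ∘ I.to , proj₂ ∘ generator ∘ I.to ,
      λ T ∈T → S⊆T T λ u → ≡.subst (λ v → proj₁ (generator v) ∈ T) (I.strictlyInverseˡ u) (∈T (I.from u))
      where
      enumerate : Fin (number ℕ.+ (n ℕ.* number ℕ.+ n ℕ.* number)) ↔ Generator
      enumerate = (↔-id _ ⊎-↔ ((*↔× ⊎-↔ *↔×) ↔-∘ +↔⊎)) ↔-∘ +↔⊎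
      module I = Inverse enumerate

  congruenceFinitelyGenerated : ∀ {Γ} → IsHeckePair Γ → FinitelyGenerated Γ →
    (S : CongruenceSubgroup Γ) → FinitelyGenerated (CongruenceSubgroup.subgroup S)
  congruenceFinitelyGenerated hecke (_ , s , s∈Γ , generate) S =
    Schreier.finitelyGenerated (CongruenceSubgroup.⊆Γ S)
      (representatives (FiniteIndex-congruence hecke S)) s s∈Γ generate

-- Linear maps on presented modules, finite sums and limits

module ModuleMaps {r} (R : CommutativeRing r r) where
  private module R = CommutativeRing R
  open Modules R
  open Presented using (Term; 0ᵗ; _+ᵗ_; _·ᵗ_; gen)
  open _⟶_ using (to)

  -- Terms are linear expressions in generators. Identities between maps on tensor products are
  -- reduced to pure tensors in this way below.
  presented-ext : ∀ {g ρ o ℓ} {Gen : Set g} {_~_ : Rel (Term Gen) ρ} {O : Mod o ℓ}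
    (f h : Presented.presented Gen _~_ ⟶ O) →
    (∀ x → LeftModule._≈ᴹ_ O (to f (gen x)) (to h (gen x))) →
    ∀ t → LeftModule._≈ᴹ_ O (to f t) (to h t)
  presented-ext {O = O} f h e = go
    where
    open LeftModule O
    module f = _⟶_ f
    module h = _⟶_ h
    go : ∀ t → f.to t ≈ᴹ h.to t
    go 0ᵗ       = ≈ᴹ-trans f.0ᴹ-homo (≈ᴹ-sym h.0ᴹ-homo)
    go (s +ᵗ t) = ≈ᴹ-trans (f.+ᴹ-homo s t) (≈ᴹ-trans (+ᴹ-cong (go s) (go t)) (≈ᴹ-sym (h.+ᴹ-homo s t)))
    go (x ·ᵗ t) = ≈ᴹ-trans (f.*ₗ-homo x t) (≈ᴹ-trans (*ₗ-cong R.refl (go t)) (≈ᴹ-sym (h.*ₗ-homo x t)))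
    go (gen x)  = e x

  module _ {m ℓ m′ ℓ′} {M : Mod m ℓ} {N : Mod m′ ℓ′} where
    private
      module M = LeftModule M
      module N = LeftModule N
      module ΣM = Summation M.+ᴹ-commutativeMonoid
      module ΣN = Summation N.+ᴹ-commutativeMonoid
    open Presented (M.Carrierᴹ × N.Carrierᴹ) using (relation; refl)

    sum-homo : (f : M ⟶ N) → ∀ {n} (x : Vector M.Carrierᴹ n) →
               _⟶_.to f (ΣM.sum x) N.≈ᴹ ΣN.sum (_⟶_.to f ∘ x)
    sum-homo f {zero}  x = _⟶_.0ᴹ-homo f
    sum-homo f {suc n} x = N.≈ᴹ-trans (_⟶_.+ᴹ-homo f _ _) (N.+ᴹ-congˡ (sum-homo f (x ∘ suc)))

    sumₗ : ∀ {n} → (Fin n → M ⟶ N) → M ⟶ N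
    sumₗ {n} f = linear (λ x → ΣN.sum λ i → f.to i x)
      (λ e → ΣN.sum-cong-≋ λ i → f.⟦⟧-cong i e)
      (λ x y → N.≈ᴹ-trans (ΣN.sum-cong-≋ λ i → f.+ᴹ-homo i x y)
                          (ΣN.∑-distrib-+ (λ i → f.to i x) (λ i → f.to i y)))
      (λ s x → N.≈ᴹ-trans (ΣN.sum-cong-≋ λ i → f.*ₗ-homo i s x)
                          (N.≈ᴹ-sym (LinearCombinations.*ₗ-sum R N s λ i → f.to i x)))
      where module f i = _⟶_ (f i)

    _⊗- : M.Carrierᴹ → N ⟶ M ⊗ N
    x ⊗- = linear (λ y → gen (x , y)) (λ e → relation (⊗-cong M.≈ᴹ-refl e))
      (λ y y′ → relation (+ʳ x y y′)) (λ s y → relation (*ʳ s x y))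

    -⊗_ : N.Carrierᴹ → M ⟶ M ⊗ N
    -⊗ y = linear (λ x → gen (x , y)) (λ e → relation (⊗-cong e N.≈ᴹ-refl))
      (λ x x′ → relation (+ˡ x x′ y)) (λ s x → relation (*ˡ s x y))

  lim-lift : ∀ {i e m ℓ o ℓ′} (D : DirectedSystem i e m ℓ) {O : Mod o ℓ′} →
    (f : ∀ j → DirectedSystem.M D j ⟶ O) →
    (∀ {j k} (p : DirectedSystem._≤_ D j k) x →
      LeftModule._≈ᴹ_ O (to (f k) (to (DirectedSystem.res D p) x)) (to (f j) x)) →
    DirectLimit.lim D ⟶ O
  lim-lift D {O} f compatible = linear (λ (j , x) → f.to j x)
    (λ {(j , x)} {(k , y)} (common l p q e) →
      ≈ᴹ-trans (≈ᴹ-sym (compatible p x)) (≈ᴹ-trans (f.⟦⟧-cong l e) (compatible q y)))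
    (λ (j , x) (k , y) → ≈ᴹ-trans (f.+ᴹ-homo (j ∨ k) _ _)
      (+ᴹ-cong (compatible (ubˡ j k) x) (compatible (ubʳ j k) y)))
    (λ s (j , x) → f.*ₗ-homo j s x)
    where
    open DirectedSystem D
    open DirectLimit D using (common)
    open LeftModule O
    module f j = _⟶_ (f j)

  kernel-trivial⇒injective : ∀ {m ℓ m′ ℓ′} {M : Mod m ℓ} {N : Mod m′ ℓ′} (f : M ⟶ N) →
    (∀ x → LeftModule._≈ᴹ_ N (to f x) (LeftModule.0ᴹ N) → LeftModule._≈ᴹ_ M x (LeftModule.0ᴹ M)) →
    ∀ {x y} → LeftModule._≈ᴹ_ N (to f x) (to f y) → LeftModule._≈ᴹ_ M x y
  kernel-trivial⇒injective {M = M} {N} f trivial {x} {y} e =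
    AbelianGroupProperties.x∙y⁻¹≈ε⇒x≈y M.+ᴹ-abelianGroup _ _ (trivial _ (N.≈ᴹ-trans (sub-homo f x y)
      (AbelianGroupProperties.x≈y⇒x∙y⁻¹≈ε N.+ᴹ-abelianGroup e)))
    where
    module M = LeftModule M
    module N = LeftModule N

-- The isomorphism Hom(S, R) ⊗ M ≅ Hom(S, M)

module Abelianization {a} (R : CommutativeRing a a) (G : Group a a)
                      (P : Subgroups.ConjugationInvariantSubset G) where
  private
    module R = CommutativeRing R
    module G = Group G
    module P = Subgroups.ConjugationInvariantSubset P
  open Subgroups G
  open Representations R G
  open HigherOrder R G P
  open ModuleMaps R
  open Presented using (0ᵗ; _+ᵗ_; _·ᵗ_; gen)
  open _⟶_ using (to)

  module _ (S : Subgroup) where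
    private module S = Subgroup S
    open Presented (Σ G.Carrier S.mem) using (Term; relation; evalₗ; presented; refl; sym; trans; _≈ᵗ_; +-cong; ·-cong)

    data _~_ : Rel Term a where
      ~-cong    : ∀ {s t} → proj₁ s G.≈ proj₁ t → gen s ~ gen t
      ~-∙       : ∀ s t → gen (Group._∙_ S.group s t) ~ (gen s +ᵗ gen t)
      ~-vanish  : ∀ s → P.mem (proj₁ s) → gen s ~ 0ᵗ

    -- R ⊗ S^ab modulo the classes of S ∩ P; it represents M ↦ Hom S M.
    Ab : Mod a a
    Ab = presented _~_

    universal : Homᴾ S Ab
    universal = mkHom S Ab gen (λ {s} {t} e → relation (~-cong {s} {t} e))
      (λ s t → relation (~-∙ s t)) (λ s s∈P → relation (~-vanish s s∈P))

    extend : ∀ {m ℓ} {M : Mod m ℓ} → Homᴾ S M → Ab ⟶ M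
    extend {M = M} f = evalₗ _~_ M fun λ
      { (~-cong {s} {t} e) → ⟦⟧-cong {s} {t} e ; (~-∙ s t) → homo s t ; (~-vanish s s∈P) → vanishes s s∈P }
      where open Homᴾ f

    _∘ʰ_ : ∀ {m ℓ m′ ℓ′} {M : Mod m ℓ} {N : Mod m′ ℓ′} → M ⟶ N → Homᴾ S M → Homᴾ S N
    _∘ʰ_ {M = M} {N} h f = mkHom S N (λ s → h.to (fun s)) (λ {s} {t} e → h.⟦⟧-cong (⟦⟧-cong {s} {t} e))
      (λ s t → N.≈ᴹ-trans (h.⟦⟧-cong (homo s t)) (h.+ᴹ-homo _ _))
      (λ s s∈P → N.≈ᴹ-trans (h.⟦⟧-cong (vanishes s s∈P)) h.0ᴹ-homo)
      where
      open Homᴾ f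
      module h = _⟶_ h
      module N = LeftModule N

    -- The elements of S whose class is a combination of the classes `b` form a subgroup containing
    -- the generators. Its membership predicate carries a proof of x ∈ S because `gen` requires one.
    Ab-spans : (fg : FinitelyGenerated S) →
               LinearCombinations.Spans R Ab (λ i → gen (proj₁ (proj₂ fg) i , proj₁ (proj₂ (proj₂ fg)) i))
    Ab-spans (n , s , s∈S , generate) = spans
      where
      open LinearCombinations R Ab
      b : Vector Term n
      b i = gen (s i , s∈S i)
      module U = Homᴾ universal
      combinations : Subgroup
      combinations = record
        { mem = λ x → Σ[ x∈S ∈ x ∈ S ] ∃[ c ] _≈ᵗ_ _~_ (gen (x , x∈S)) (c ∙ b)
        ; resp = λ e (x∈S , c , f) → S.resp e x∈S , c , trans (relation (~-cong (G.sym e))) f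
        ; ε-closed = S.ε-closed , (λ _ → R.0#) , trans U.ε-homo (sym (∙-0 b))
        ; ∙-closed = λ (x∈S , c , f) (y∈S , d , g) → S.∙-closed x∈S y∈S , _ ,
            trans (U.homo _ _) (trans (+-cong f g) (sym (∙-+ c d b)))
        ; ⁻¹-closed = λ (x∈S , c , f) → S.⁻¹-closed x∈S , _ ,
            trans (U.⁻¹-homo _) (trans (·-cong R.refl f) (sym (∙-* (R.- R.1#) c b))) }
      spans : Spans b
      spans 0ᵗ       = _ , sym (∙-0 b)
      spans (t +ᵗ u) = let c , e = spans t ; d , f = spans u in _ , trans (+-cong e f) (sym (∙-+ c d b))
      spans (x ·ᵗ t) = let c , e = spans t in _ , trans (·-cong R.refl e) (sym (∙-* x c b))
      spans (gen (x , x∈S)) with generate combinations (λ i → s∈S i , δ i , sym (δ-∙ i b)) x x∈S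
      ... | _ , c , e = c , trans (relation (~-cong G.refl)) e

    value : ∀ {m ℓ} {M : Mod m ℓ} (s : Σ G.Carrier S.mem) → Hom S M ⟶ M
    value {M = M} s = linear (λ f → Homᴾ.fun f s) (λ e → _≈ʰ_.at e s) (λ _ _ → ≈ᴹ-refl) (λ _ _ → ≈ᴹ-refl)
      where open LeftModule M

  module Evaluation (dualBasis : HasDualBases R) (S : Subgroup) (fg : FinitelyGenerated S) {m ℓ} (M : Mod m ℓ) where
    private
      module S = Subgroup S
      module M = LeftModule M
    open Homᴾ using (fun)
    open Presented (Homᴾ S ⟨R⟩ × M.Carrierᴹ) using (refl; sym; trans; relation)
    private
      module LC = LinearCombinations R (Ab S)
      module Σ⊗ = Summation (LeftModule.+ᴹ-commutativeMonoid (Hom S ⟨R⟩ ⊗ M))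
      module Ev = _⟶_ (evaluate S M)

    open LC.DualBasis (dualBasis (Ab S) _ (Ab-spans S fg))

    point : Fin dimension → Σ G.Carrier S.mem
    point i = proj₁ (proj₂ fg) (select i) , proj₁ (proj₂ (proj₂ fg)) (select i)

    χ : Fin dimension → Homᴾ S ⟨R⟩
    χ i = _∘ʰ_ S (coordinate i) (universal S)

    -- The linear extension of f to `Ab S` is applied to the expansion of the class of s. Thus f is
    -- determined by its values at the finitely many points sᵢ.
    expand : ∀ {m ℓ} {N : Mod m ℓ} (f : Homᴾ S N) s →
             LeftModule._≈ᴹ_ N (fun f s) (Summation.sum (LeftModule.+ᴹ-commutativeMonoid N)
               (λ i → LeftModule._*ₗ_ N (fun (χ i) s) (fun f (point i))))
    expand {N = N} f s = N.≈ᴹ-trans (f̂.⟦⟧-cong (expansion (gen s)))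
      (N.≈ᴹ-trans (sum-homo (extend S f) {dimension} λ i → to (coordinate i) (gen s) ·ᵗ gen (point i))
        (Summation.sum-cong-≋ N.+ᴹ-commutativeMonoid {dimension} λ i → f̂.*ₗ-homo _ (gen (point i))))
      where
      module N = LeftModule N
      module f̂ = _⟶_ (extend S f)

    coefficients : Hom S M ⟶ Hom S ⟨R⟩ ⊗ M
    coefficients = sumₗ λ i → _⊗- {M = Hom S ⟨R⟩} {N = M} (χ i) ∘ₗ value S (point i)

    -- At s the left side is Σ χᵢ(s) f(sᵢ), which `expand` identifies with f(s).
    evaluate-coefficients : ∀ f → LeftModule._≈ᴹ_ (Hom S M) (Ev.to (to coefficients f)) f
    evaluate-coefficients f = pointwise λ s →
      M.≈ᴹ-trans (sum-homo (value S s ∘ₗ evaluate S M) λ i → gen (χ i , fun f (point i)))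
                 (M.≈ᴹ-sym (expand f s))

    -- For a pure tensor ψ ⊗ x, Σ χᵢ ⊗ ψ(sᵢ)x = (Σ ψ(sᵢ)χᵢ) ⊗ x, and the sum in brackets is ψ by
    -- `expand` applied to ψ.
    coefficients-evaluate : ∀ t → LeftModule._≈ᴹ_ (Hom S ⟨R⟩ ⊗ M) (to coefficients (Ev.to t)) t
    coefficients-evaluate = presented-ext (coefficients ∘ₗ evaluate S M) idₗ λ (ψ , x) →
      trans (Σ⊗.sum-cong-≋ λ i → trans (relation (*ʳ (fun ψ (point i)) (χ i) x))
                                       (sym (relation (*ˡ (fun ψ (point i)) (χ i) x))))
      (trans (sym (sum-homo (-⊗_ {M = Hom S ⟨R⟩} {N = M} x) λ i → _·ʰ_ S ⟨R⟩ (fun ψ (point i)) (χ i)))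
      (relation (⊗-cong (pointwise λ s → R.trans
          (sum-homo (value S s) λ i → _·ʰ_ S ⟨R⟩ (fun ψ (point i)) (χ i))
          (R.trans (Summation.sum-cong-≋ R.+-commutativeMonoid {dimension}
            λ i → R.*-comm (fun ψ (point i)) (fun (χ i) s))
                   (R.sym (expand ψ s)))) M.≈ᴹ-refl)))

-- Recognizing the order of v from the elements (γ - 1)v

module HigherOrderInvariants {a} (R : CommutativeRing a a) (G : Group a a)
                             (P : Subgroups.ConjugationInvariantSubset G) where
  private
    module R = CommutativeRing R
    module G = Group G
  open Subgroups G
  open Representations R G
  open HigherOrder R G P
  open Presented using (0ᵗ; _+ᵗ_; _·ᵗ_; gen)

  module _ (S : Subgroup) (V : GModule a a) where
    private
      module S = Subgroup S
      module R[S] = GroupRing R S.group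
      module H q = Submodule (H⁰ S V q)
    open GModule V

    I^-kills-H⁰ : ∀ q {s v} → R[S].I^ q s → H.mem q v → _•_ S V s v ≈ᴹ 0ᴹ
    I^-kills-H⁰ zero    {s} _ v≈0     = ≈ᴹ-trans (•-cong S V s v≈0) (_⟶_.0ᴹ-homo (•ₗ S V s))
    I^-kills-H⁰ (suc q) i (kill , _) = kill i

    module _ (q : ℕ) {v} (Δ∈ : ∀ γ → γ ∈ S → H.mem q (Δ S V γ v)) where
      private module V/H⁰ = LeftModule (quotient (H⁰ S V q))

      -- Modulo `H⁰ S V q` every γ in S fixes v, so the group ring acts on v through the
      -- augmentation.
      •≈aug : ∀ t → _•_ S V t v V/H⁰.≈ᴹ R[S].aug t *ₗ v
      •≈aug 0ᵗ       = V/H⁰.≈ᴹ-sym (V/H⁰.*ₗ-zeroˡ v)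
      •≈aug (s +ᵗ t) = V/H⁰.≈ᴹ-trans (V/H⁰.+ᴹ-cong (•≈aug s) (•≈aug t))
        (V/H⁰.≈ᴹ-sym (V/H⁰.*ₗ-distribʳ v (R[S].aug s) (R[S].aug t)))
      •≈aug (x ·ᵗ t) = V/H⁰.≈ᴹ-trans (V/H⁰.*ₗ-cong R.refl (•≈aug t))
        (V/H⁰.≈ᴹ-sym (V/H⁰.*ₗ-assoc x (R[S].aug t) v))
      •≈aug (gen (γ , γ∈S)) = V/H⁰.≈ᴹ-trans (modulo (Δ∈ γ γ∈S)) (V/H⁰.≈ᴹ-sym (V/H⁰.*ₗ-identityˡ v))

      augmentation-• : ∀ {t} → R[S].aug t R.≈ R.0# → H.mem q (_•_ S V t v)
      augmentation-• {t} e = H.resp q (≈ᴹ-trans (+ᴹ-cong ≈ᴹ-refl ε⁻¹≈ε) (+ᴹ-identityʳ _))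
        (_≈/_.difference (V/H⁰.≈ᴹ-trans (•≈aug t)
          (V/H⁰.≈ᴹ-trans (V/H⁰.*ₗ-cong e V/H⁰.≈ᴹ-refl) (V/H⁰.*ₗ-zeroˡ v))))
        where open AbelianGroupProperties +ᴹ-abelianGroup using (ε⁻¹≈ε)

      -- For a product st with s in the q-th power and t in the augmentation ideal, tv lies in
      -- `H⁰ S V q` and is killed by s.
      I^-kills : ∀ {s} → R[S].I^ (suc q) s → _•_ S V s v ≈ᴹ 0ᴹ
      I^-kills (R[S].prod {s = s} {t} i e) =
        ≈ᴹ-trans (⊛-• S V s t v) (I^-kills-H⁰ q i (augmentation-• {t} e))
      I^-kills (R[S].sum i j)  = ≈ᴹ-trans (+ᴹ-cong (I^-kills i) (I^-kills j)) (+ᴹ-identityˡ 0ᴹ)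
      I^-kills R[S].none       = ≈ᴹ-refl
      I^-kills (R[S].resp e i) = ≈ᴹ-trans (≈ᴹ-sym (R[S].eval-cong R[S]._~_ mod _
        (λ { (R[S].gen-cong e′) → ▷-cong e′ ≈ᴹ-refl }) e)) (I^-kills i)

    -- This is injectivity of the order-lowering map over S. Invariance under P ∩ S is the same
    -- condition in every positive order and is inherited; annihilation comes from `I^-kills`.
    Δ∈H⁰⇒∈H⁰ : ∀ q {v} → H.mem (suc (suc q)) v → (∀ γ → γ ∈ S → H.mem q (Δ S V γ v)) → H.mem (suc q) v
    Δ∈H⁰⇒∈H⁰ q (_ , fixed) Δ∈ = I^-kills q Δ∈ , fixed

  -- Stated for modules at the level of the group, so that the kernel is a Subgroup.
  Homᴾ-generated : ∀ {S} {M : Mod a a} ((n , s , s∈S , _) : FinitelyGenerated S) (f : Homᴾ S M) →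
    (∀ i → LeftModule._≈ᴹ_ M (Homᴾ.fun f (s i , s∈S i)) (LeftModule.0ᴹ M)) →
    ∀ x → LeftModule._≈ᴹ_ M (Homᴾ.fun f x) (LeftModule.0ᴹ M)
  Homᴾ-generated {S} {M} (n , s , s∈S , generate) f f≈0 (x , x∈S) =
    let x∈S′ , e = generate kernel (λ i → s∈S i , f≈0 i) x x∈S in
    ≈ᴹ-trans (⟦⟧-cong {x , x∈S} {x , x∈S′} G.refl) e
    where
    module S = Subgroup S
    open LeftModule M
    open Homᴾ f
    open AbelianGroupProperties +ᴹ-abelianGroup using (ε⁻¹≈ε)
    kernel : Subgroup
    kernel = record
      { mem = λ x → Σ[ x∈S ∈ x ∈ S ] fun (x , x∈S) ≈ᴹ 0ᴹ
      ; resp = λ {x} {y} e (x∈S , f) → S.resp e x∈S , ≈ᴹ-trans (⟦⟧-cong {y , _} {x , x∈S} (G.sym e)) f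
      ; ε-closed = S.ε-closed , ε-homo
      ; ∙-closed = λ (x∈S , f) (y∈S , g) → S.∙-closed x∈S y∈S ,
          ≈ᴹ-trans (homo _ _) (≈ᴹ-trans (+ᴹ-cong f g) (+ᴹ-identityˡ 0ᴹ))
      ; ⁻¹-closed = λ (x∈S , f) → S.⁻¹-closed x∈S , ≈ᴹ-trans (⁻¹-homo _) (≈ᴹ-trans (-ᴹ‿cong f) ε⁻¹≈ε) }

-- The order-lowering map into the tensor product and its naturality

module OrderLowering {a} (R : CommutativeRing a a) (dualBasis : HasDualBases R) (G : Group a a)
                     (P : Subgroups.ConjugationInvariantSubset G) where
  open Subgroups G
  open Representations R G
  open HigherOrder R G P
  open Abelianization R G P
  open ModuleMaps R
  open _⟶_ using (to)
  open Homᴾ using (fun)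

  opaque
    -- Opaque, so that the chosen dual basis stays hidden behind `lowering⊗-lifts` and
    -- `lowering⊗-twist`.
    lowering⊗ : ∀ S → FinitelyGenerated S → ∀ V q → H̄ S V (suc q) ⟶ Hom S ⟨R⟩ ⊗ H̄ S V q
    lowering⊗ S fg V q = Evaluation.coefficients dualBasis S fg (H̄ S V q) ∘ₗ lowering S V q

    lowering⊗-lifts : ∀ S (fg : FinitelyGenerated S) V q v → LeftModule._≈ᴹ_ (Hom S (H̄ S V q))
      (to (evaluate S (H̄ S V q)) (to (lowering⊗ S fg V q) v)) (to (lowering S V q) v)
    lowering⊗-lifts S fg V q v = Evaluation.evaluate-coefficients dualBasis S fg (H̄ S V q) (to (lowering S V q) v)

  module _ {S T : Subgroup} {V W : GModule a a} (t : Twist S T V W) where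
    private
      module W = GModule W
      module t = Twist t

    pullback : ∀ {m ℓ} {M : Mod m ℓ} → Hom T M ⟶ Hom S M
    pullback {M = M} = linear pull
      (λ e → pointwise λ s → _≈ʰ_.at e (t.φ s))
      (λ _ _ → pointwise λ _ → ≈ᴹ-refl) (λ _ _ → pointwise λ _ → ≈ᴹ-refl)
      where
      open LeftModule M
      module φ = GroupMorphisms.IsGroupHomomorphism t.φ-hom
      pull : Homᴾ T M → Homᴾ S M
      pull f = mkHom S M (λ s → f.fun (t.φ s))
        (λ {s} {u} e → f.⟦⟧-cong {t.φ s} {t.φ u} (φ.⟦⟧-cong {s} {u} e))
        (λ s u → ≈ᴹ-trans
          (f.⟦⟧-cong {t.φ (Group._∙_ (Subgroup.group S) s u)} {Group._∙_ (Subgroup.group T) (t.φ s) (t.φ u)}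
            (φ.homo s u))
          (f.homo (t.φ s) (t.φ u)))
        (λ s s∈P → f.vanishes (t.φ s) (t.φ-P s s∈P))
        where module f = Homᴾ f

    evaluate-pullback : ∀ q τ s →
      LeftModule._≈ᴹ_ (H̄ S W q)
        (fun (to (evaluate S (H̄ S W q)) (to (pullback ⊗₁ H̄₁ t q) τ)) s)
        (to (H̄₁ t q) (fun (to (evaluate T (H̄ T V q)) τ) (t.φ s)))
    evaluate-pullback q τ s = presented-ext
      (value S s ∘ₗ evaluate S (H̄ S W q) ∘ₗ (pullback ⊗₁ H̄₁ t q))
      (H̄₁ t q ∘ₗ value T (t.φ s) ∘ₗ evaluate T (H̄ T V q))
      (λ (χ , x) → LeftModule.≈ᴹ-sym (H̄ S W q) (_⟶_.*ₗ-homo (H̄₁ t q) (fun χ (t.φ s)) x)) τ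

    -- F intertwines φ(s) with s, hence F((φ(s) - 1)v) = (s - 1)F(v).
    lowering-twist : ∀ q v s →
      LeftModule._≈ᴹ_ (H̄ S W q)
        (to (H̄₁ t q) (fun (to (lowering T V q) v) (t.φ s)))
        (fun (to (lowering S W q) (to (H̄₁ t (suc q)) v)) s)
    lowering-twist q (v , _) s = H̄-≈ S W q
      (W.≈ᴹ-trans (sub-homo t.F _ v) (W.+ᴹ-cong (t.twisted s v) W.≈ᴹ-refl))

    opaque
      unfolding lowering⊗

      -- The dual bases over S and T are unrelated choices, so the two sides are compared after
      -- `evaluate`, where no basis occurs. The inverse `coefficients` over S then brings the
      -- equality back.
      lowering⊗-twist : ∀ (fgS : FinitelyGenerated S) (fgT : FinitelyGenerated T) q v →
        LeftModule._≈ᴹ_ (Hom S ⟨R⟩ ⊗ H̄ S W q)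
          (to (lowering⊗ S fgS W q) (to (H̄₁ t (suc q)) v))
          (to (pullback ⊗₁ H̄₁ t q) (to (lowering⊗ T fgT V q) v))
      lowering⊗-twist fgS fgT q v = begin
        to ES.coefficients (to (lowering S W q) (to (H̄₁ t (suc q)) v))
          ≈⟨ _⟶_.⟦⟧-cong ES.coefficients same ⟨
        to ES.coefficients (to (evaluate S (H̄ S W q)) τ)
          ≈⟨ ES.coefficients-evaluate τ ⟩
        τ ∎
        where
        module ES = Evaluation dualBasis S fgS (H̄ S W q)
        module ET = Evaluation dualBasis T fgT (H̄ T V q)
        module H = LeftModule (H̄ S W q)
        τ : LeftModule.Carrierᴹ (Hom S ⟨R⟩ ⊗ H̄ S W q)
        τ = to (pullback ⊗₁ H̄₁ t q) (to (lowering⊗ T fgT V q) v)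
        same : LeftModule._≈ᴹ_ (Hom S (H̄ S W q)) (to (evaluate S (H̄ S W q)) τ)
                 (to (lowering S W q) (to (H̄₁ t (suc q)) v))
        same = pointwise λ s → H.≈ᴹ-trans (evaluate-pullback q (to (lowering⊗ T fgT V q) v) s)
          (H.≈ᴹ-trans (_⟶_.⟦⟧-cong (H̄₁ t q)
            (_≈ʰ_.at (ET.evaluate-coefficients (to (lowering T V q) v)) (t.φ s)))
            (lowering-twist q v s))
        open SetoidReasoning (LeftModule.≈ᴹ-setoid (Hom S ⟨R⟩ ⊗ H̄ S W q))

-- Passage to the limit and construction of Φ

module HeckeLowering {a} (R : CommutativeRing a a) (dualBasis : HasDualBases R) (G : Group a a)
                     (Γ : Subgroups.Subgroup G) (P : Subgroups.ConjugationInvariantSubset G)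
                     (finGen : (S : Subgroups.CongruenceSubgroup G Γ) →
                       Subgroups.FinitelyGenerated G (Subgroups.CongruenceSubgroup.subgroup S)) where
  private
    module R = CommutativeRing R
    module G = Group G
  open Subgroups G
  open Representations R G
  open HigherOrder R G P
  open Hecke R G Γ P
  open CongruenceSubgroup using (subgroup)
  open _⊇_ using () renaming (inclusion to ⊇-inclusion)
  open OrderLowering R dualBasis G P
  open Abelianization R G P
  open ModuleMaps R
  open HigherOrderInvariants R G P
  open Presented using (0ᵗ; _+ᵗ_; _·ᵗ_; gen; refl; sym; trans; relation)
  open _⟶_ using (to)
  open Homᴾ using (fun)

  tensorLowering : ∀ (S : Congruence) V q → TensorLowering (subgroup S) V q
  tensorLowering S V q = record
    { canonical = (λ {x} {y} e → trans (sym (E.coefficients-evaluate x))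
          (trans (_⟶_.⟦⟧-cong E.coefficients e) (E.coefficients-evaluate y)))
      , (λ f → to E.coefficients f , λ e → H.≈ᴹ-trans (_⟶_.⟦⟧-cong (evaluate (subgroup S) (H̄ (subgroup S) V q)) e)
                                                     (E.evaluate-coefficients f))
    ; lowering⊗ = lowering⊗ (subgroup S) (finGen S) V q
    ; lifts = lowering⊗-lifts (subgroup S) (finGen S) V q }
    where
    module E = Evaluation dualBasis (subgroup S) (finGen S) (H̄ (subgroup S) V q)
    module H = LeftModule (Hom (subgroup S) (H̄ (subgroup S) V q))

  module _ (V : GModule a a) (q : ℕ) where
    classes : (S : Congruence) → Hom (subgroup S) ⟨R⟩ ⊗ H̄ (subgroup S) V q ⟶ GModule.mod (Ĥom ⊗ᴳ L q V)
    classes S = classᴴ S ⊗₁ class q V S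

    loweringAt : (S : Congruence) → H̄ (subgroup S) V (suc q) ⟶ GModule.mod (Ĥom ⊗ᴳ L q V)
    loweringAt S = classes S ∘ₗ lowering⊗ (subgroup S) (finGen S) V q

  -- One naturality square with three uses: restriction gives compatibility with the limit,
  -- translation gives equivariance, and coefficient maps give naturality in V. The maps α and β are
  -- those induced by the twist on the limits.
  loweringAt-twist : ∀ {S T : Congruence} {V W} (t : Twist (subgroup S) (subgroup T) V W) q
    (α : GModule.mod Ĥom ⟶ GModule.mod Ĥom) (β : GModule.mod (L q V) ⟶ GModule.mod (L q W)) →
    (∀ χ → (S , to (pullback t) χ) Ĥ.≈ to α (T , χ)) →
    (∀ x → GModule._≈ᴹ_ (L q W) (S , to (H̄₁ t q) x) (to β (T , x))) →
    ∀ v → GModule._≈ᴹ_ (Ĥom ⊗ᴳ L q W)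
      (to (loweringAt W q S) (to (H̄₁ t (suc q)) v))
      (to (α ⊗₁ β) (to (loweringAt V q T) v))
  loweringAt-twist {S} {T} {V} {W} t q α β α-class β-class v = trans
    (_⟶_.⟦⟧-cong (classes W q S) (lowering⊗-twist {subgroup S} {subgroup T} t (finGen S) (finGen T) q v))
    (presented-ext (classes W q S ∘ₗ (pullback t ⊗₁ H̄₁ t q)) ((α ⊗₁ β) ∘ₗ classes V q T)
      (λ (χ , x) → relation (⊗-cong (α-class χ) (β-class x)))
      (to (lowering⊗ (subgroup T) (finGen T) V q) v))

  -- Translation by g and restriction to S ∩ gSg⁻¹, combined into a single twist so that
  -- `loweringAt-twist` applies.
  shrinkTwist : ∀ V g (S : Congruence) → Twist (subgroup (shrink Γ g S)) (subgroup S) V V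
  shrinkTwist V g S = record
    { φ = t.φ ∘ restricted
    ; φ-hom = mkGroupHomomorphism (Subgroup.group (subgroup (shrink Γ g S))) (Subgroup.group (subgroup S)) _
        (λ e → ^-cong e G.refl) (λ (x , _) (y , _) → ^-∙ x y g)
    ; φ-P = λ s → t.φ-P (restricted s)
    ; F = t.F
    ; twisted = λ s → t.twisted (restricted s) }
    where
    module t = Twist (translate g (subgroup S) V)
    restricted : Σ G.Carrier (_∈ subgroup (shrink Γ g S)) → Σ G.Carrier (_∈ conj g (subgroup S))
    restricted (x , x∈) = x , conj⊇shrink g S x x∈

  opaque
    L-lowering : ∀ V q → GModule.mod (L (suc q) V) ⟶ GModule.mod (Ĥom ⊗ᴳ L q V)
    L-lowering V q = lim-lift (H̄-system (suc q) V) (loweringAt V q) λ {S} {T} p x → trans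
      (loweringAt-twist {T} {S} {V} {V} (inclusion (⊇-inclusion p) V) q idₗ idₗ
        (λ χ → same-hom λ _ _ e → Homᴾ.⟦⟧-cong χ e)
        (λ _ → same-vector q V (GModule.≈ᴹ-refl V)) x)
      -- Restriction does not change classes in the limits, so both α and β are identities; their
      -- tensor product is the identity on generators.
      (presented-ext (idₗ ⊗₁ idₗ) idₗ (λ _ → refl) (to (loweringAt V q S) x))

    -- Makes the computation inside the opaque block available outside it.
    L-lowering-class : ∀ V q (S : Congruence) v →
      GModule._≈ᴹ_ (Ĥom ⊗ᴳ L q V) (to (L-lowering V q) (S , v)) (to (loweringAt V q S) v)
    L-lowering-class V q S v = refl

    L-lowering-equivariant : ∀ V q g x →
      GModule._≈ᴹ_ (Ĥom ⊗ᴳ L q V)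
        (to (L-lowering V q) (GModule._▷_ (L (suc q) V) g x))
        (GModule._▷_ (Ĥom ⊗ᴳ L q V) g (to (L-lowering V q) x))
    L-lowering-equivariant V q g (S , v) = trans
      -- The action is a composite of two maps `H̄₁`, the twist gives one; both have the underlying
      -- vector gv.
      (_⟶_.⟦⟧-cong (loweringAt V q (shrink Γ g S)) (H̄-≈ _ V (suc q) (GModule.≈ᴹ-refl V)))
      (loweringAt-twist {shrink Γ g S} {S} {V} {V} (shrinkTwist V g S) q (GModule.▷ₗ Ĥom g) (GModule.▷ₗ (L q V) g)
        (λ χ → same-hom λ s t e → Homᴾ.⟦⟧-cong χ (^-cong e G.refl))
        (λ _ → same-vector q V (GModule.≈ᴹ-refl V)) v)

    L-lowering-natural : ∀ q {V W : GModule a a} (f : V ⟶ᴳ W) x →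
      GModule._≈ᴹ_ (Ĥom ⊗ᴳ L q W)
        (to (L-lowering W q) (to (L-map (suc q) {V} {W} f) x))
        (to (_⊗₁_ {M = GModule.mod Ĥom} {M′ = GModule.mod Ĥom} idₗ (L-map q {V} {W} f)) (to (L-lowering V q) x))
    L-lowering-natural q {V} {W} f (S , v) = trans
      (_⟶_.⟦⟧-cong (loweringAt W q S) (H̄-≈ (subgroup S) W (suc q) (GModule.≈ᴹ-refl W)))
      (loweringAt-twist {S} {S} {V} {W} (mapCoefficients (subgroup S) f) q idₗ (L-map q {V} {W} f)
        (λ χ → same-hom λ _ _ e → Homᴾ.⟦⟧-cong χ e)
        (λ _ → same-vector q W (GModule.≈ᴹ-refl W)) v)

  -- (γ - 1)v lies in H⁰ of order 0, which is zero. Hence S itself witnesses that v is smooth.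
  order-one-fixed : ∀ (V : GModule a a) (S : Congruence) (v : LeftModule.Carrierᴹ (H̄ (subgroup S) V (suc zero))) →
              ∀ γ → γ ∈ subgroup S → GModule._≈ᴹ_ V (GModule._▷_ V γ (proj₁ v)) (proj₁ v)
  order-one-fixed V S (v , v∈) γ γ∈S = x∙y⁻¹≈ε⇒x≈y _ _ (Δ-H⁰ (subgroup S) V 1 γ∈S v∈)
    where open AbelianGroupProperties (GModule.+ᴹ-abelianGroup V) using (x∙y⁻¹≈ε⇒x≈y)

  order-one-≈ : ∀ (V : GModule a a) S {v w} → LeftModule._≈ᴹ_ (H̄ S V (suc zero)) v w → GModule._≈ᴹ_ V (proj₁ v) (proj₁ w)
  order-one-≈ V S (modulo e) = AbelianGroupProperties.x∙y⁻¹≈ε⇒x≈y (GModule.+ᴹ-abelianGroup V) _ _ e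

  Φ₀ : (V : GModule a a) → L (suc zero) V ⟶ᴳ Target zero V
  Φ₀ V = record
    { linearMap = lim-lift (H̄-system (suc zero) V)
        (λ S → linear (λ v → proj₁ v , S , order-one-fixed V S v) (λ e → lift (order-one-≈ V (subgroup S) e))
                      (λ _ _ → lift ≈ᴹ-refl) (λ _ _ → lift ≈ᴹ-refl))
        (λ _ _ → lift ≈ᴹ-refl)
    ; equivariant = λ _ _ → lift ≈ᴹ-refl }
    where open GModule V

  module _ (n : ℕ) (V : GModule a a) (Φ′ : L (suc n) V ⟶ᴳ Target n V) where
    private
      module Φ′ = _⟶ᴳ_ Φ′

    Ĥom⊗Φ′ : GModule.mod (Ĥom ⊗ᴳ L (suc n) V) ⟶ GModule.mod (Target (suc n) V)
    Ĥom⊗Φ′ = _⊗₁_ {M = GModule.mod Ĥom} {N = GModule.mod (L (suc n) V)}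
                   {M′ = GModule.mod Ĥom} {N′ = GModule.mod (Target n V)} idₗ Φ′.linearMap

    Φ-suc-linear : GModule.mod (L (suc (suc n)) V) ⟶ GModule.mod (Target (suc n) V)
    Φ-suc-linear = Ĥom⊗Φ′ ∘ₗ L-lowering V (suc n)

    Ĥom⊗Φ′-equivariant : ∀ g t → GModule._≈ᴹ_ (Target (suc n) V)
      (to Ĥom⊗Φ′ (GModule._▷_ (Ĥom ⊗ᴳ L (suc n) V) g t)) (GModule._▷_ (Target (suc n) V) g (to Ĥom⊗Φ′ t))
    Ĥom⊗Φ′-equivariant g =
      presented-ext (Ĥom⊗Φ′ ∘ₗ GModule.▷ₗ (Ĥom ⊗ᴳ L (suc n) V) g) (GModule.▷ₗ (Target (suc n) V) g ∘ₗ Ĥom⊗Φ′)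
        (λ (χ , y) → relation (⊗-cong (GModule.≈ᴹ-refl Ĥom) (Φ′.equivariant g y)))

    Ĥom⊗Φ′-cong : ∀ {x y} → GModule._≈ᴹ_ (Ĥom ⊗ᴳ L (suc n) V) x y →
                  GModule._≈ᴹ_ (Target (suc n) V) (to Ĥom⊗Φ′ x) (to Ĥom⊗Φ′ y)
    Ĥom⊗Φ′-cong = _⟶_.⟦⟧-cong Ĥom⊗Φ′

    Φ-suc-equivariant : ∀ g x → GModule._≈ᴹ_ (Target (suc n) V)
      (to Φ-suc-linear (GModule._▷_ (L (suc (suc n)) V) g x)) (GModule._▷_ (Target (suc n) V) g (to Φ-suc-linear x))
    Φ-suc-equivariant g x = trans
      (Ĥom⊗Φ′-cong {to (L-lowering V (suc n)) (GModule._▷_ (L (suc (suc n)) V) g x)}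
        {GModule._▷_ (Ĥom ⊗ᴳ L (suc n) V) g (to (L-lowering V (suc n)) x)}
        (L-lowering-equivariant V (suc n) g x))
      (Ĥom⊗Φ′-equivariant g (to (L-lowering V (suc n)) x))

    Φ-suc : L (suc (suc n)) V ⟶ᴳ Target (suc n) V
    Φ-suc = record { linearMap = Φ-suc-linear ; equivariant = Φ-suc-equivariant }

  Φ : ∀ n (V : GModule a a) → L (suc n) V ⟶ᴳ Target n V
  Φ zero    V = Φ₀ V
  Φ (suc n) V = Φ-suc n V (Φ n V)

  Φ-natural : ∀ n → IsNatural n (Φ n)
  Φ-natural zero    {V} {W} f x = lift (GModule.≈ᴹ-refl W)
  Φ-natural (suc n) {V} {W} f x = trans
    (Ĥom⊗Φ′-cong n W (Φ n W) (L-lowering-natural (suc n) {V} {W} f x))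
    (square (to (L-lowering V (suc n)) x))
    where
    Ĥom⊗f : GModule.mod (Ĥom ⊗ᴳ L (suc n) V) ⟶ GModule.mod (Ĥom ⊗ᴳ L (suc n) W)
    Ĥom⊗f = _⊗₁_ {M = GModule.mod Ĥom} {M′ = GModule.mod Ĥom} idₗ (L-map (suc n) {V} {W} f)
    square : ∀ t → GModule._≈ᴹ_ (Target (suc n) W)
      (to (Ĥom⊗Φ′ n W (Φ n W)) (to Ĥom⊗f t)) (to (Target₁ (suc n) {V} {W} f) (to (Ĥom⊗Φ′ n V (Φ n V)) t))
    square = presented-ext (Ĥom⊗Φ′ n W (Φ n W) ∘ₗ Ĥom⊗f) (Target₁ (suc n) {V} {W} f ∘ₗ Ĥom⊗Φ′ n V (Φ n V))
      (λ (_ , y) → relation (⊗-cong (GModule.≈ᴹ-refl Ĥom) (Φ-natural n f y)))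

  Φ-class : ∀ n V (S : Congruence) v → GModule._≈ᴹ_ (Target (suc n) V)
    (_⟶ᴳ_.to (Φ (suc n) V) (S , v))
    (to (classᴴ S ⊗₁ (_⟶ᴳ_.linearMap (Φ n V) ∘ₗ class (suc n) V S)) (to (lowering⊗ (subgroup S) (finGen S) V (suc n)) v))
  Φ-class n V S v = trans
    (Ĥom⊗Φ′-cong n V (Φ n V) (L-lowering-class V (suc n) S v))
    (compose (to (lowering⊗ (subgroup S) (finGen S) V (suc n)) v))
    where
    compose : ∀ t → GModule._≈ᴹ_ (Target (suc n) V)
      (to (Ĥom⊗Φ′ n V (Φ n V)) (to (classes V (suc n) S) t))
      (to (classᴴ S ⊗₁ (_⟶ᴳ_.linearMap (Φ n V) ∘ₗ class (suc n) V S)) t)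
    compose = presented-ext (Ĥom⊗Φ′ n V (Φ n V) ∘ₗ classes V (suc n) S)
      (classᴴ S ⊗₁ (_⟶ᴳ_.linearMap (Φ n V) ∘ₗ class (suc n) V S)) (λ _ → refl)

  Φ-iterated : ∀ n (V : GModule a a) → IteratedLowering n V (Φ n V)
  Φ-iterated zero    V S v = GModule.≈ᴹ-refl V
  Φ-iterated (suc n) V = Φ n V , Φ-iterated n V , λ S → tensorLowering S V (suc n) , Φ-class n V S

  -- Injectivity of Φ

  -- In the limit of this system an element vanishes only if it is zero on some congruence subgroup.
  -- This makes vanishing in a tensor product with `Ĥom` testable pointwise.
  Hom-into : ∀ {m ℓ} → Mod m ℓ → DirectedSystem (lsuc a) a (a ⊔ m ⊔ ℓ) (a ⊔ ℓ)
  Hom-into N = record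
    { Index = Congruence
    ; base = whole Γ
    ; _≤_ = _≽_
    ; ≤-refl = ≽-refl
    ; ≤-trans = ≽-trans
    ; _∨_ = _∧_
    ; ubˡ = meetˡ
    ; ubʳ = meetʳ
    ; M = λ S → Hom (subgroup S) N
    ; res = λ p → restrict (⊇-inclusion p)
    ; res-id = λ _ f → pointwise λ s → Homᴾ.⟦⟧-cong f G.refl
    ; res-∘ = λ _ _ _ f → pointwise λ s → Homᴾ.⟦⟧-cong f G.refl }

  germ : ∀ {m ℓ} (N : Mod m ℓ) → GModule.mod Ĥom ⊗ N ⟶ DirectLimit.lim (Hom-into N)
  germ N = ⊗-lift β
    (λ {(common U p q e) f → H.common U p q (pointwise λ s → N.*ₗ-cong (_≈ʰ_.at e s) f)})
    (λ (S , χ) (T , ψ) y → H.≈-at {S ∧ T} (pointwise λ s → N.*ₗ-distribʳ y _ _))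
    (λ (S , χ) y y′ → H.≈-trans (H.≈-at {S} (pointwise λ s → N.*ₗ-distribˡ (fun χ s) y y′))
                                (H.≈-sym (H.+-here (β (S , χ) y .proj₂) (β (S , χ) y′ .proj₂))))
    (λ c (S , χ) y → H.≈-at {S} (pointwise λ s → N.*ₗ-assoc c (fun χ s) y))
    (λ c (S , χ) y → H.≈-at {S} (pointwise λ s → *ₗ-comm N (fun χ s) c y))
    where
    open DirectLimit Hom-system using (common)
    module H = DirectLimit (Hom-into N)
    module N = LeftModule N
    β : Ĥ.Element → N.Carrierᴹ → H.Element
    β (S , χ) y = S , to (evaluate (subgroup S) N) (gen (χ , y))

  push : ∀ S {m ℓ m′ ℓ′} {M : Mod m ℓ} {N : Mod m′ ℓ′} → M ⟶ N → Hom S M ⟶ Hom S N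
  push S {N = N} h = linear (_∘ʰ_ S h) (λ e → pointwise λ s → h.⟦⟧-cong (_≈ʰ_.at e s))
    (λ f f′ → pointwise λ s → h.+ᴹ-homo (fun f s) (fun f′ s)) (λ c f → pointwise λ s → h.*ₗ-homo c (fun f s))
    where module h = _⟶_ h

  -- On χ ⊗ x this is χ(s)h(x) = h(χ(s)x).
  germ-class : ∀ (S : Congruence) {m ℓ m′ ℓ′} {M : Mod m ℓ} {N : Mod m′ ℓ′} (h : M ⟶ N) t →
    DirectLimit._≈_ (Hom-into N) (to (germ N) (to (classᴴ S ⊗₁ h) t))
                                 (S , to (push (subgroup S) h) (to (evaluate (subgroup S) M) t))
  germ-class S {M = M} {N} h = presented-ext (germ N ∘ₗ (classᴴ S ⊗₁ h))
    (DirectLimit.ι (Hom-into N) S ∘ₗ push (subgroup S) h ∘ₗ evaluate (subgroup S) M)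
    (λ (χ , x) → DirectLimit.≈-at (Hom-into N) {S} (pointwise λ s → N.≈ᴹ-sym (_⟶_.*ₗ-homo h (fun χ s) x)))
    where module N = LeftModule N

  -- By `germ-class` the germ of h ∘ f is the image of a tensor that is zero, so h ∘ f vanishes on a
  -- smaller congruence subgroup.
  germ-kernel : ∀ (S : Congruence) {m ℓ m′ ℓ′} {M : Mod m ℓ} {N : Mod m′ ℓ′} (h : M ⟶ N) t f →
    LeftModule._≈ᴹ_ (Hom (subgroup S) M) (to (evaluate (subgroup S) M) t) f →
    LeftModule._≈ᴹ_ (GModule.mod Ĥom ⊗ N) (to (classᴴ S ⊗₁ h) t) (LeftModule.0ᴹ (GModule.mod Ĥom ⊗ N)) →
    Σ[ U ∈ Congruence ] Σ[ S≽U ∈ S ≽ U ] (∀ s s∈U →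
      LeftModule._≈ᴹ_ N (to h (fun f (s , ⊇-inclusion S≽U s s∈U))) (LeftModule.0ᴹ N))
  germ-kernel S {M = M} {N} h t f e z = conclude
    (H.≈-trans (H.≈-sym (H.≈-at {S} (_⟶_.⟦⟧-cong (push (subgroup S) h) e)))
      (H.≈-trans (H.≈-sym (germ-class S h t)) (H.≈-trans (_⟶_.⟦⟧-cong (germ N) z) (_⟶_.0ᴹ-homo (germ N)))))
    where
    module H = DirectLimit (Hom-into N)
    conclude : (S , to (push (subgroup S) h) f) H.≈ H.0# →
      Σ[ U ∈ Congruence ] Σ[ S≽U ∈ S ≽ U ] (∀ s s∈U →
        LeftModule._≈ᴹ_ N (to h (fun f (s , ⊇-inclusion S≽U s s∈U))) (LeftModule.0ᴹ N))
    conclude (H.common U S≽U _ (pointwise z)) = U , S≽U , λ s s∈U → z (s , s∈U)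

  refine : ∀ {k} (U : Congruence) (T : Fin k → Congruence) → Σ[ W ∈ Congruence ] U ≽ W × (∀ i → T i ≽ W)
  refine {zero}  U T = U , ≽-refl , λ ()
  refine {suc k} U T =
    let W , U≽W , T≽W = refine (U ∧ T zero) (T ∘ suc) in
    W , ≽-trans {U} {U ∧ T zero} {W} (meetˡ U (T zero)) U≽W , λ
      { zero    → ≽-trans {T zero} {U ∧ T zero} {W} (meetʳ U (T zero)) U≽W
      ; (suc i) → T≽W i }

  module _ (V : GModule a a) where
    private
      module V = GModule V
    open AbelianGroupProperties V.+ᴹ-abelianGroup using (ε⁻¹≈ε)

    _∈H⁰[_,_] : V.Carrierᴹ → ℕ → Congruence → Set a
    v ∈H⁰[ q , S ] = Submodule.mem (H⁰ (subgroup S) V q) v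

    ∈H⁰-restrict : ∀ q {S T : Congruence} {v} → S ≽ T → v ∈H⁰[ q , S ] → v ∈H⁰[ q , T ]
    ∈H⁰-restrict q {S} {T} p = H⁰-mem {subgroup T} {subgroup S} (inclusion (⊇-inclusion p) V) q

    x-0≈x : ∀ x → x V.+ᴹ V.-ᴹ V.0ᴹ V.≈ᴹ x
    x-0≈x x = V.≈ᴹ-trans (V.+ᴹ-congˡ ε⁻¹≈ε) (V.+ᴹ-identityʳ x)

    -- Equality in the limit is equality in some H̄_q(T), hence membership of x - 0 in H⁰ of order q
    -- - 1 over T.
    class≈0⁻ : ∀ q {S : Congruence} {x} → GModule._≈ᴹ_ (L q V) (S , x) (GModule.0ᴹ (L q V)) →
              Σ[ T ∈ Congruence ] proj₁ x ∈H⁰[ pred q , T ]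
    class≈0⁻ q {S} {x , _} (DirectLimit.common T _ _ (modulo x∈)) =
      T , Submodule.resp (H⁰ (subgroup T) V (pred q)) (x-0≈x x) x∈

    class≈0⁺ : ∀ q {S T : Congruence} {x} → S ≽ T → proj₁ x ∈H⁰[ pred q , T ] →
              GModule._≈ᴹ_ (L q V) (S , x) (GModule.0ᴹ (L q V))
    -- The zero of the limit lives at the index Γ, whence the inclusion T ⊆ Γ.
    class≈0⁺ q {S} {T} {x , _} S≽T x∈ = DirectLimit.common T S≽T (contained (CongruenceSubgroup.⊆Γ T))
      (modulo (Submodule.resp (H⁰ (subgroup T) V (pred q)) (V.≈ᴹ-sym (x-0≈x x)) x∈))

    -- Vanishing at generators of U suffices, so a single T works for all of U.
    lowering-locally-zero : ∀ q (S U : Congruence) v (S≽U : S ≽ U) →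
      (∀ s s∈U → GModule._≈ᴹ_ (L (suc q) V)
        (S , fun (to (lowering (subgroup S) V (suc q)) v) (s , ⊇-inclusion S≽U s s∈U))
        (GModule.0ᴹ (L (suc q) V))) →
      GModule._≈ᴹ_ (L (suc (suc q)) V) (S , v) (GModule.0ᴹ (L (suc (suc q)) V))
    lowering-locally-zero q S U v@(v₀ , v∈) S≽U zero-class = class≈0⁺ (suc (suc q)) {S} {W} {v} S≽W
      (Δ∈H⁰⇒∈H⁰ (subgroup W) V q (∈H⁰-restrict (suc (suc q)) {S} {W} S≽W v∈) Δ∈H⁰)
      where
      u = proj₁ (proj₂ (finGen U))
      u∈U = proj₁ (proj₂ (proj₂ (finGen U)))
      local : ∀ i → Σ[ T ∈ Congruence ] Δ (subgroup S) V (u i) v₀ ∈H⁰[ q , T ]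
      local i = class≈0⁻ (suc q) {S} (zero-class (u i) (u∈U i))
      refined = refine U (proj₁ ∘ local)
      W = proj₁ refined
      U≽W = proj₁ (proj₂ refined)
      S≽W : S ≽ W
      S≽W = ≽-trans {S} {U} {W} S≽U U≽W
      -- The map γ ↦ (γ - 1)v has domain U but values over W: the generators at which it is known to
      -- vanish are in U and need not be in W.
      difference : Homᴾ (subgroup U) (H̄ (subgroup W) V (suc q))
      difference = _∘ʰ_ (subgroup U) (H̄₁ {subgroup W} {subgroup U} (inclusion (⊇-inclusion U≽W) V) (suc q))
        (to (lowering (subgroup U) V (suc q))
          (v₀ , ∈H⁰-restrict (suc (suc q)) {S} {U} S≽U v∈))
      difference≈0 : ∀ x → LeftModule._≈ᴹ_ (H̄ (subgroup W) V (suc q)) (fun difference x)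
                             (LeftModule.0ᴹ (H̄ (subgroup W) V (suc q)))
      difference≈0 = Homᴾ-generated (finGen U) difference λ i → modulo
        (Submodule.resp (H⁰ (subgroup W) V q) (V.≈ᴹ-sym (x-0≈x _))
          (∈H⁰-restrict q {proj₁ (local i)} {W} (proj₂ (proj₂ refined) i) (proj₂ (local i))))
      Δ∈H⁰ : ∀ γ → γ ∈ subgroup W → Δ (subgroup W) V γ v₀ ∈H⁰[ q , W ]
      Δ∈H⁰ γ γ∈W = Submodule.resp (H⁰ (subgroup W) V q) (x-0≈x _)
        (_≈/_.difference (difference≈0 (γ , ⊇-inclusion U≽W γ γ∈W)))

  -- `germ-kernel` is applied to h = Φₙ ∘ class and to the homomorphism γ ↦ (γ - 1)v. Injectivity of
  -- Φₙ then removes Φₙ from its conclusion.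
  Φ-suc-kernel : ∀ n (V : GModule a a) → IsInjective n V (Φ n V) → ∀ x →
    GModule._≈ᴹ_ (Target (suc n) V) (_⟶ᴳ_.to (Φ (suc n) V) x) (GModule.0ᴹ (Target (suc n) V)) →
    GModule._≈ᴹ_ (L (suc (suc n)) V) x (GModule.0ᴹ (L (suc (suc n)) V))
  Φ-suc-kernel n V injective (S , v) e = conclude
    (germ-kernel S {M = H̄ (subgroup S) V (suc n)} {N = T.mod} h τ (to (lowering (subgroup S) V (suc n)) v)
      (lowering⊗-lifts (subgroup S) (finGen S) V (suc n) v)
      (trans (sym (Φ-class n V S v)) e))
    where
    module T = GModule (Target n V)
    module Φ = _⟶ᴳ_ (Φ n V)
    h : H̄ (subgroup S) V (suc n) ⟶ GModule.mod (Target n V)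
    h = Φ.linearMap ∘ₗ class (suc n) V S
    τ = to (lowering⊗ (subgroup S) (finGen S) V (suc n)) v
    conclude : Σ[ U ∈ Congruence ] Σ[ S≽U ∈ S ≽ U ] (∀ s s∈U →
        GModule._≈ᴹ_ (Target n V)
          (to h (fun (to (lowering (subgroup S) V (suc n)) v) (s , ⊇-inclusion S≽U s s∈U))) (GModule.0ᴹ (Target n V))) →
      GModule._≈ᴹ_ (L (suc (suc n)) V) (S , v) (GModule.0ᴹ (L (suc (suc n)) V))
    conclude (U , S≽U , z) = lowering-locally-zero V n S U v S≽U λ s s∈U →
      injective (T.≈ᴹ-trans (z s s∈U) (T.≈ᴹ-sym Φ.0ᴹ-homo))

  Φ-injective : ∀ n (V : GModule a a) → IsInjective n V (Φ n V)
  Φ-injective zero    V {S , v} {T , w} (lift e) = same-vector (suc zero) V {S , v} {T , w} e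
  Φ-injective (suc n) V {x} {y} e =
    kernel-trivial⇒injective (_⟶ᴳ_.linearMap (Φ (suc n) V)) (Φ-suc-kernel n V (Φ-injective n V)) {x} {y} e

  -- Smoothness of source and target

  -- A homomorphism to the abelian group R is invariant under inner automorphisms. The conjugate is
  -- a separate argument y so that any proof of its membership in S is allowed.
  Homᴾ-^ : ∀ {S : Subgroup} (χ : Homᴾ S ⟨R⟩) (x g y : Σ G.Carrier (_∈ S)) →
           proj₁ x ^ proj₁ g G.≈ proj₁ y → fun χ y R.≈ fun χ x
  Homᴾ-^ {S} χ x g y e = begin
    fun χ y                                       ≈⟨ χ.⟦⟧-cong {y} {(g S.⁻¹ S.∙ x) S.∙ g} (G.sym e) ⟩
    fun χ ((g S.⁻¹ S.∙ x) S.∙ g)                  ≈⟨ χ.homo (g S.⁻¹ S.∙ x) g ⟩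
    fun χ (g S.⁻¹ S.∙ x) R.+ fun χ g              ≈⟨ R.+-congʳ (χ.homo (g S.⁻¹) x) ⟩
    fun χ (g S.⁻¹) R.+ fun χ x R.+ fun χ g        ≈⟨ R.+-congʳ (R.+-congʳ (χ.⁻¹-homo g)) ⟩
    R.- fun χ g R.+ fun χ x R.+ fun χ g           ≈⟨ R.+-congʳ (R.+-comm _ _) ⟩
    fun χ x R.+ R.- fun χ g R.+ fun χ g           ≈⟨ //-rightDividesˡ (fun χ g) (fun χ x) ⟩
    fun χ x                                       ∎
    where
    module χ = Homᴾ χ
    module S = Group (Subgroup.group S)
    open SetoidReasoning R.setoid
    open GroupProperties R.+-group using (//-rightDividesˡ)

  Ĥom-smooth : IsSmooth Ĥom
  Ĥom-smooth (S , χ) = S , λ g g∈S → same-hom λ (x , x∈S , x^g∈S) y e → R.trans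
    (Homᴾ-^ χ (x , x∈S) (g , g∈S) (x ^ g , x^g∈S) G.refl) (Homᴾ.⟦⟧-cong χ {x , x∈S} {y} e)

  -- For g in S, (g - 1)v has lower order by `Δ-H⁰`, so gv and v agree in the quotient over S ∩
  -- gSg⁻¹.
  L-smooth : ∀ n (V : GModule a a) → IsSmooth (L (suc n) V)
  L-smooth n V (S , v , v∈) = S , λ g g∈S →
    DirectLimit.common (shrink Γ g S) ≽-refl (contained λ _ → proj₁)
      (modulo (H⁰-mem (inclusion (λ _ → proj₁) V) n (Δ-H⁰ (subgroup S) V (suc n) g∈S v∈)))

  -- Smooth elements form a submodule, and a pure tensor is fixed by the intersection of the
  -- subgroups fixing its factors.
  ⊗-smooth : ∀ {m ℓ m′ ℓ′} (V : GModule m ℓ) (W : GModule m′ ℓ′) → IsSmooth V → IsSmooth W → IsSmooth (V ⊗ᴳ W)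
  ⊗-smooth V W V-smooth W-smooth = go
    where
    module S = Submodule (smoothElements (V ⊗ᴳ W))
    go : ∀ t → S.mem t
    go 0ᵗ       = S.0-closed
    go (s +ᵗ t) = S.+-closed (go s) (go t)
    go (x ·ᵗ t) = S.*-closed x (go t)
    go (gen (v , w)) = let S , f = V-smooth v ; T , h = W-smooth w in
      S ∧ T , λ g (g∈S , g∈T) → relation (⊗-cong (f g g∈S) (h g g∈T))

  Target-smooth : ∀ n (V : GModule a a) → IsSmooth (Target n V)
  Target-smooth zero    V (v , S , f) = S , λ g g∈S → lift (f g g∈S)
  Target-smooth (suc n) V = ⊗-smooth Ĥom (Target n V) Ĥom-smooth (Target-smooth n V)

proposition1p2p2 :
    ∀ {a} → (∀ {ℓ} → ExcludedMiddle ℓ) →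
    (F : Field a) (G : Group a a) →
    let R = Field.commutativeRing F
        open Subgroups G in
    (Γ : Subgroup) → IsHeckePair Γ → FinitelyGenerated Γ →
    (P : ConjugationInvariantSubset) (n : ℕ) →
    let open Representations R G
        open Hecke R G Γ P
        q = suc n in
    Σ[ Φ ∈ ((V : GModule a a) → L q V ⟶ᴳ Target n V) ]
      ((V : GModule a a) →
        IsSmooth (L q V) × IsSmooth (Target n V) ×
        IsInjective n V (Φ V) × IteratedLowering n V (Φ V)) ×
      IsNatural n Φ
proposition1p2p2 em F G Γ hecke fg P n =
  Φ n , (λ V → L-smooth n V , Target-smooth n V , Φ-injective n V , Φ-iterated n V) , Φ-natural n
  where
  open HeckeLowering (Field.commutativeRing F) (VectorSpaces.dualBasis em F) G Γ P
    (CongruenceSubgroups.congruenceFinitelyGenerated em G hecke fg)
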